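{- Let $l\ge 3$ be a prime and let $q=p^{r}\equiv 1 \pmod{2l^{2}}$ be a prime power. Fix a generator $\gamma$ of $\mathbb{F}_q^*$ and let $w=\mathrm{ind}_\gamma 2$. Write $\zeta_{l^2}=\exp(2\pi i/l^2)$, and let $\chi=\chi_{2l^2}$, the Jacobi sums $J_{2l^2}(i,j)$ and the integers $c_{i,m}$ be as defined in the context. All congruences are in $\mathbb{Z}[\zeta_{l^2}]=\mathbb{Z}[\zeta_{2l^2}]$ modulo the ideal generated by $(1-\zeta_{l^2})^{l+1}$. Let $n$ be an odd integer with $1\le n\le 2l^2-1$. (1) If $n=l^2$, then $$J_{2l^2}(1,n)\equiv \zeta_{l^2}^{ -w}\Bigl(-1+\sum_{i=3}^{l}c_{i,(l^2-1)/2}(\zeta_{l^2}-1)^i\Bigr)\pmod{(1-\zeta_{l^2})^{l+1}}.$$ (2) If $n=dl$ with $d$ an odd integer, $1\le d\le 2l-1$, $d\ne l$, then $$J_{2l^2}(1,n)\equiv -\zeta_{l^2}^{ -w(dl+1)}\Bigl(-1+\sum_{i=3}^{l}c_{i,(l^2-1)/2}(\zeta_{l^2}-1)^i\Bigr)\Bigl(-1+\sum_{i=3}^{l}c_{i,dl-1}\bigl(\zeta_{l^2}^{(-1-dl)/2}-1\bigr)^i\Bigr)\pmod{(1-\zeta_{l^2})^{l+1}}.$$ (3) If $\gcd(n,2l^2)=1$ and $1\le n<2l^2-1$, then $$J_{2l^2}(1,n)\equiv \zeta_{l^2}^{ -w(n+1)}\Bigl(-1+\sum_{i=3}^{l}c_{i,(l^2-1)/2}(\zeta_{l^2}-1)^i\Bigr)\Bigl(-1+\sum_{i=3}^{l}c_{i,(l^2-1)/2}(\zeta_{l^2}^{n}-1)^i\Bigr)\Bigl(-1+\sum_{i=3}^{l}c_{i,-1-n}\bigl(\zeta_{l^2}^{(1-l^2)/2}-1\bigr)^i\Bigr)\pmod{(1-\zeta_{l^2})^{l+1}}.$$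 (4) If $n=2l^2-1$, then $J_{2l^2}(1,n)\equiv -1\pmod{(1-\zeta_{l^2})^{l+1}}$. Moreover, if $n$ is an even integer with $2\le n\le 2l^2-2$, then $J_{2l^2}(1,n)=\chi(-1)\,J_{2l^2}(1,2l^2-n-1)$, where $2l^2-n-1$ is odd (so that the congruences above determine $J_{2l^2}(1,n)$ modulo $(1-\zeta_{l^2})^{l+1}$).
   Context: For an integer $e\ge 2$ with $q\equiv 1\pmod e$, put $\zeta_e=\exp(2\pi i/e)$ and let $\chi_e$ be the multiplicative character of $\mathbb{F}_q^*$ with $\chi_e(\gamma)=\zeta_e$ (the same fixed generator $\gamma$ is used for all $e$). For every integer $i$, $\chi_e^i$ is extended to $\mathbb{F}_q$ by $\chi_e^i(0)=0$ (also for $i\equiv 0 \pmod e$). The Jacobi sum of order $e$ is $$J_e(i,j)=\sum_{v\in\mathbb{F}_q}\chi_e^i(v)\,\chi_e^j(v+1),$$ with $i,j$ read modulo $e$. One has $\zeta_{l^2}=\zeta_{2l^2}^2$ and $\chi_{l^2}=\chi_{2l^2}^2$. For $x\in\mathbb{F}_q^*$, $\mathrm{ind}_\gamma x$ is the integer $a\in\{0,\dots,q-2\}$ with $\gamma^a=x$. Here $\mathrm{ind}_\gamma 2$ means the index of the element $2\in\mathbb{F}_q^*$. The coefficients $c_{i,m}$ ($m\in\mathbb{Z}$, $3\le i\le l$) are defined as follows. For $v\in\mathbb{F}_q\setminus\{0,-1\}$ put $N_m(v)=\mathrm{ind}_\gamma v+m\,\mathrm{ind}_\gamma(v+1)$.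 For $0\le s\le l-1$ let $b_{s,m}$ be the number of $v\in\mathbb{F}_q\setminus\{0,-1\}$ with $N_m(v)\equiv s\pmod l$; thus $J_l(1,m)=\sum_{s=0}^{l-1}b_{s,m}\zeta_l^s$. Then $$c_{i,m}=\sum_{s=i}^{l-1}\binom{s}{i}b_{s,m}\quad(3\le i\le l-1),\qquad c_{l,m}=S(m)=\sum_{v\in\mathbb{F}_q\setminus\{0,-1\}}\Bigl\lfloor\frac{N_m(v)}{l}\Bigr\rfloor .$$ Only the residues of the $c_{i,m}$ modulo $l$ matter for congruences modulo $(1-\zeta_{l^2})^{l+1}$, and these residues depend only on $m$ modulo $l^2$. They are the coefficients occurring in the expansion $J_{l^2}(1,m)\equiv -1+\sum_{i=3}^{l}c_{i,m}(\zeta_{l^2}-1)^i\pmod{(1-\zeta_{l^2})^{l+1}}$ of the Jacobi sums of order $l^2$. -}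

module Defs where

open import Level using (Level; _⊔_; suc)
open import Algebra.Apartness.Bundles using (HeytingField; module HeytingCommutativeRing)
open import Algebra.Bundles using (CommutativeRing; CommutativeMonoid)
import Algebra.Properties.Semiring.Mult as Mult
import Algebra.Properties.CommutativeMonoid.Sum as Sum
import Algebra.Properties.Semiring.Exp as Exp
open import Data.Bool.Base using (if_then_else_)
open import Data.Fin.Base using (Fin; toℕ)
import Data.Fin.Properties as Fin
open import Data.Integer.Base as ℤ using (ℤ; +_; -[1+_]; _%ℕ_; _/ℕ_)
import Data.Integer.Properties as ℤ
open import Data.Nat.Base as ℕ using (ℕ; zero; NonZero; _<_)
open import Data.Nat.Combinatorics using (_C_)
import Data.Nat.Properties as ℕ
open import Data.Product.Base using (∃-syntax; _×_)
open import Function.Bundles using (Inverse)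
open import Function.Properties.Inverse using (Inverse⇒Injection)
import Function.Construct.Symmetry as Symmetry
open import Relation.Binary.Definitions using (Decidable)
import Relation.Binary.PropositionalEquality as ≡
open import Relation.Nullary.Decidable using (Dec; does; ¬?; _×-dec_; via-injection)
open import Relation.Nullary.Negation using (¬_)

private
  variable
    a b c ℓ ℓ₁ ℓ₂ : Level

-- ∑[ M ∣ i ≔ m ⋯ n ] f  is the sum of f i over m ≤ i ≤ n, both ends included.
rangeSum : (M : CommutativeMonoid c ℓ) (m n : ℕ) →
           (ℕ → CommutativeMonoid.Carrier M) → CommutativeMonoid.Carrier M
rangeSum M m n f = Sum.sum M {ℕ.suc n ℕ.∸ m} (λ k → f (m ℕ.+ toℕ k))

syntax rangeSum M m n (λ i → x) = ∑[ M ∣ i ≔ m ⋯ n ] x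

-- The library's fields are Heyting fields: x # 0 says that x is invertible,
-- and an element that is not invertible is 0.
fieldRing : HeytingField c ℓ₁ ℓ₂ → CommutativeRing c ℓ₁
fieldRing K = HeytingCommutativeRing.commutativeRing (HeytingField.heytingCommutativeRing K)

record FiniteField (c ℓ₁ ℓ₂ : Level) : Set (suc (c ⊔ ℓ₁ ⊔ ℓ₂)) where
  field
    heytingField : HeytingField c ℓ₁ ℓ₂

  open HeytingField heytingField public using (_#_)
  open CommutativeRing (fieldRing heytingField) public

  field
    order : ℕ
    enum  : Inverse (≡.setoid (Fin order)) setoid

  open Exp semiring public using (_^_)

  _≟_ : Decidable _≈_
  _≟_ = via-injection (Inverse⇒Injection (Symmetry.inverse enum)) Fin._≟_

  ∑F : (M : CommutativeMonoid a b) →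
       (Carrier → CommutativeMonoid.Carrier M) → CommutativeMonoid.Carrier M
  ∑F M f = Sum.sum M (λ k → f (Inverse.to enum k))

  -- γ generates the unit group; as that group is finite, natural powers suffice.
  IsGenerator : Carrier → Set (c ⊔ ℓ₁ ⊔ ℓ₂)
  IsGenerator γ = γ # 0# × (∀ x → x # 0# → ∃[ k ] γ ^ k ≈ x)

  -- The least a in {0,…,q-2} with γ^a = x.  If there is none (for a generator γ
  -- this means x = 0), the value is the meaningless q-1.
  ind : Carrier → Carrier → ℕ
  ind γ x = search (order ℕ.∸ 1) 0
    where
    search : (fuel start : ℕ) → ℕ
    search zero           s = s
    search (ℕ.suc fuel) s =
      if does ((γ ^ s) ≟ x) then s else search fuel (ℕ.suc s)

-- coeff i m is the coefficient c_{i,m}; it is meaningful for 3 ≤ i ≤ l only.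
module Coefficients (l : ℕ) .{{_ : NonZero l}}
                    (F : FiniteField c ℓ₁ ℓ₂) (γ : FiniteField.Carrier F) where

  open FiniteField F

  admissible? : (v : Carrier) → Dec (¬ v ≈ 0# × ¬ v ≈ - 1#)
  admissible? v = ¬? (v ≟ 0#) ×-dec ¬? (v ≟ (- 1#))

  N : ℤ → Carrier → ℤ
  N m v = + ind γ v ℤ.+ m ℤ.* + ind γ (v + 1#)

  b[_,_] : ℕ → ℤ → ℕ
  b[ s , m ] = ∑F ℕ.+-0-commutativeMonoid λ v →
    if does (admissible? v ×-dec (N m v %ℕ l) ℕ.≟ s) then 1 else 0

  -- _/ℕ_ rounds towards -∞ for a positive divisor, so it is the floor.
  S : ℤ → ℤ
  S m = ∑F ℤ.+-0-commutativeMonoid λ v →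
    if does (admissible? v) then N m v /ℕ l else + 0

  coeff : ℕ → ℤ → ℤ
  coeff i m =
    if does (i ℕ.≟ l)
    then S m
    else + (∑[ ℕ.+-0-commutativeMonoid ∣ s ≔ i ⋯ l ℕ.∸ 1 ] ((s C i) ℕ.* b[ s , m ]))

module RingNotions (R : CommutativeRing c ℓ) where

  open CommutativeRing R
  open Exp semiring public using (_^_)
  open Mult semiring using () renaming (_×_ to _·_)

  fromℤ : ℤ → Carrier
  fromℤ (+ n)      = n · 1#
  fromℤ (-[1+ n ]) = - (ℕ.suc n · 1#)

  CharacteristicZero : Set ℓ
  CharacteristicZero = ∀ n → n · 1# ≈ 0# → n ≡.≡ 0

  IsPrimitiveRoot : ℕ → Carrier → Set ℓ
  IsPrimitiveRoot e z = z ^ e ≈ 1# × (∀ k → 0 < k → k < e → ¬ z ^ k ≈ 1#)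

  -- The power z^k for an integer k; correct only when z ^ e ≈ 1#.
  powMod : (e : ℕ) .{{_ : NonZero e}} → Carrier → ℤ → Carrier
  powMod e z k = z ^ (k %ℕ e)

  -- The subring ℤ[z] of R.
  data ℤ[_] (z : Carrier) : Carrier → Set (c ⊔ ℓ) where
    gen  : ℤ[ z ] z
    one  : ℤ[ z ] 1#
    add  : ∀ {x y} → ℤ[ z ] x → ℤ[ z ] y → ℤ[ z ] (x + y)
    neg  : ∀ {x} → ℤ[ z ] x → ℤ[ z ] (- x)
    mul  : ∀ {x y} → ℤ[ z ] x → ℤ[ z ] y → ℤ[ z ] (x * y)
    resp : ∀ {x y} → x ≈ y → ℤ[ z ] x → ℤ[ z ] y

  -- Congruence modulo the ideal of ℤ[z] generated by g; the cofactor is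
  -- required to lie in ℤ[z], not merely in R.
  CongruentMod : (z g x y : Carrier) → Set (c ⊔ ℓ)
  CongruentMod z g x y = ∃[ t ] (ℤ[ z ] t × x - y ≈ g * t)

module Characters (F : FiniteField a ℓ₁ ℓ₂) (R : CommutativeRing c ℓ) where

  private
    module F = FiniteField F
  open CommutativeRing R
  open RingNotions R

  -- A homomorphism from the unit group of F to that of R; being multiplicative
  -- and unital already makes the values units.  The value at 0 is irrelevant.
  record IsMultiplicativeCharacter (χ : F.Carrier → Carrier) : Set (a ⊔ ℓ₁ ⊔ ℓ₂ ⊔ ℓ) where
    field
      cong   : ∀ {x y} → x F.≈ y → χ x ≈ χ y
      1-homo : χ F.1# ≈ 1#
      *-homo : ∀ {x y} → x F.# F.0# → y F.# F.0# → χ (x F.* y) ≈ χ x * χ y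

  module _ (e : ℕ) .{{_ : NonZero e}} (χ : F.Carrier → Carrier) where

    -- The i-th power of a character of order e, extended by 0 at 0 for every i.
    charPower : ℤ → F.Carrier → Carrier
    charPower i v = if does (v F.≟ F.0#) then 0# else powMod e (χ v) i

    jacobiSum : ℤ → ℤ → Carrier
    jacobiSum i j =
      F.∑F +-commutativeMonoid λ v → charPower i v * charPower j (v F.+ F.1#)

-- R is to be thought of as ℂ, ζ as ζ_{2l²} = exp(πi/l²) and χ as χ_{2l²},
-- so that ζ_{l²} = ζ².
module Setting (l : ℕ) .{{_ : NonZero l}}
               (F : FiniteField a ℓ₁ ℓ₂) (γ : FiniteField.Carrier F)
               (R : CommutativeRing c ℓ) (ζ : CommutativeRing.Carrier R)
               (χ : FiniteField.Carrier F → CommutativeRing.Carrier R) where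

  open CommutativeRing R
  open RingNotions R
  open Coefficients l F γ

  private
    instance
      l²≢0 : NonZero (l ℕ.^ 2)
      l²≢0 = ℕ.m^n≢0 l 2

      2l²≢0 : NonZero (2 ℕ.* l ℕ.^ 2)
      2l²≢0 = ℕ.m*n≢0 2 (l ℕ.^ 2)

  J : ℤ → ℤ → Carrier
  J = Characters.jacobiSum F R (2 ℕ.* l ℕ.^ 2) χ

  ζ[l²] : Carrier
  ζ[l²] = ζ ^ 2

  ζ[l²]^_ : ℤ → Carrier
  ζ[l²]^ k = powMod (l ℕ.^ 2) ζ[l²] k

  P : ℤ → Carrier → Carrier
  P m y = - 1# + (∑[ +-commutativeMonoid ∣ i ≔ 3 ⋯ l ] (fromℤ (coeff i m) * (y - 1#) ^ i))

  infix 9 ζ[l²]^_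
  infix 4 _≅_

  -- ℤ[ζ_{2l²}] = ℤ[ζ_{l²}], so either generator describes the ring of congruence.
  _≅_ : Carrier → Carrier → Set (c ⊔ ℓ)
  _≅_ = CongruentMod ζ[l²] ((1# - ζ[l²]) ^ (l ℕ.+ 1))

{-# OPTIONS --safe #-}
module Submission where

-- With η = χ^(l²), A = χ^(1+l²) and B = Aⁿ one has χ = A η and, for odd n, χⁿ = B η. Convolving characters as
-- functions on the additive group of the field gives, without Gauss sums, the identity
--   q J(Aη, Bη) = η(-1) J(Ā, η) J(B̄, η) J(A, B),
-- and counting square roots gives J(C, C) = C̄(4) J(C, η). Thus q J(χ, χⁿ) is a power of ζ_{l²} times three Jacobi
-- sums of order l², and q ≡ 1. A Jacobi sum of order l² is expanded in the quotient of ℤ[ζ_{l²}], which has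
-- characteristic l because (1 - ζ_{l²})^(l+1) divides l. There yˡ = 1 + (y - 1)ˡ, so that y^N only depends on
-- N mod l and ⌊N / l⌋; the coefficients of (y - 1)⁰, (y - 1)¹ and (y - 1)² are -1, 0 and 0, because the sums of
-- ind v, (ind v)² and ind v · ind (v + 1) over v vanish modulo l.

open import Defs
open import Level using (Level; _⊔_)
import Algebra.Apartness.Properties.HeytingCommutativeRing as HeytingProperties
open import Algebra.Apartness.Bundles using (HeytingField)
open import Algebra.Bundles using (CommutativeRing; CommutativeMonoid)
import Algebra.Properties.CommutativeMonoid.Sum as MonoidSum
import Algebra.Properties.CommutativeSemiring.Exp as Exp
import Algebra.Properties.Ring as RingProperties
import Algebra.Properties.Semiring.Mult as Mult
import Algebra.Properties.Semiring.Sum as Sum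
import Algebra.Solver.Ring as Solver
open import Algebra.Solver.Ring.AlmostCommutativeRing using (fromCommutativeRing; _-Raw-AlmostCommutative⟶_)
open import Data.Bool.Base using (if_then_else_; true; false)
open import Data.Fin.Base using (Fin; zero; suc; toℕ; fromℕ; fromℕ<; inject₁; punchIn)
open import Data.Fin.Permutation using (permutation; ↔⇒≡)
import Data.Fin.Properties as Fin
open import Data.Integer.Base as ℤ using (ℤ; +_; -[1+_]; _%ℕ_; _/ℕ_)
import Data.Integer.DivMod as ℤ
import Data.Integer.Properties as ℤ
open import Data.Integer.Tactic.RingSolver using () renaming (solve-∀ to ℤ-solve)
open import Data.Maybe.Base using (Maybe; just; nothing)
open import Data.Nat.Base as ℕ using (ℕ; zero; suc; NonZero; _<_; _≤_; s≤s; z≤n)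
open import Data.Nat.Combinatorics using (_C_; nCn≡1; nC1≡n; nCk≡nC[n∸k]; nCk+nC[k+1]≡[n+1]C[k+1]; k>n⇒nCk≡0)
open import Data.Nat.Divisibility as ℕ∣ using (_∣_; _∤_)
import Data.Nat.DivMod as ℕ
open import Data.Nat.GCD using (gcd; gcd-greatest)
open import Data.Nat.Induction using (<-rec)
open import Data.Nat.Primality using (Prime; ¬prime[0]; ¬prime[1]; prime[2]; euclidsLemma; prime⇒irreducible)
import Data.Nat.Properties as ℕ
open import Data.Nat.Tactic.RingSolver using () renaming (solve-∀ to ℕ-solve)
open import Data.Product.Base using (∃-syntax; _×_; _,_; proj₁; proj₂)
open import Data.Sum.Base using (_⊎_; inj₁; inj₂)
open import Function.Base using (_∘_)
open import Function.Bundles using (Inverse)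
open import Relation.Binary.Definitions using (tri<; tri≈; tri>)
open import Relation.Binary.PropositionalEquality as ≡ using (_≡_; _≢_)
import Relation.Binary.Reasoning.Setoid as SetoidReasoning
open import Relation.Nullary.Decidable using (Dec; yes; no; does; ¬?; _×-dec_)
open import Relation.Nullary.Negation using (¬_; contradiction)

-- The twist identity is assembled from two uses of the associativity of convolution, two
-- reflections `J(f, g) = f(-1) J(f, k)` with `k` inverse to `fg`, and one product formula, which is
-- where `q` enters. Since `l` divides `q - 1`, the factor `q` is replaced by 1 and never divided
-- out. Before a sum of order l² is expanded, reflection brings it to the form J(ψ, ψ^m) with ψ =
-- χ_{l²}^j; this is the origin of the indices (l² - 1)/2, -1 - n and dl - 1. It is then evaluated
-- directly at y = ζ_{l²}^j, in place of a Galois automorphism, so j need not be prime to l. For n =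
-- dl the factor belonging to B has y - 1 divisible by (1 - ζ_{l²})^l and reduces to -1: hence the
-- sign and the missing factor in that case. The congruences hold in ℤ[ζ_{l²}] and not merely in the
-- field, so every divisibility carries a cofactor with a proof of membership. The divisibility of
-- `l` is bootstrapped from binomial expansions, without norms or cyclotomic polynomials.

private
  variable
    a b c ℓ ℓ₁ ℓ₂ : Level

-- Integers in a commutative ring, and a ring solver with integer coefficients.

module IntegerMultiples (R : CommutativeRing c ℓ) where

  open CommutativeRing R hiding (zero)
  open RingNotions R
  open Mult semiring using (×-homo-+) renaming (_×_ to _·_)
  open RingProperties ring using (-0#≈0#; -‿involutive; -‿+-comm; -‿distribˡ-*)
  open SetoidReasoning setoid

  private
    a-a+b-b : ∀ x m n → (x + m) - (x + n) ≈ m - n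
    a-a+b-b x m n = begin
      (x + m) - (x + n) ≈⟨ +-cong (+-comm x m) (sym (-‿+-comm x n)) ⟩
      (m + x) + (- x + - n) ≈⟨ +-assoc m x _ ⟩
      m + (x + (- x + - n)) ≈⟨ +-congˡ (sym (+-assoc x (- x) (- n))) ⟩
      m + ((x + - x) + - n) ≈⟨ +-congˡ (+-congʳ (-‿inverseʳ x)) ⟩
      m + (0# + - n) ≈⟨ +-congˡ (+-identityˡ _) ⟩
      m - n ∎

  fromℤ-⊖ : ∀ m n → fromℤ (m ℤ.⊖ n) ≈ m · 1# - n · 1#
  fromℤ-⊖ m       zero    = sym (trans (+-congˡ -0#≈0#) (+-identityʳ _))
  fromℤ-⊖ zero    (suc n) = sym (+-identityˡ _)
  fromℤ-⊖ (suc m) (suc n) = begin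
    fromℤ (suc m ℤ.⊖ suc n) ≡⟨ ≡.cong fromℤ (ℤ.[1+m]⊖[1+n]≡m⊖n m n) ⟩
    fromℤ (m ℤ.⊖ n) ≈⟨ fromℤ-⊖ m n ⟩
    m · 1# - n · 1# ≈⟨ a-a+b-b 1# _ _ ⟨
    suc m · 1# - suc n · 1# ∎

  fromℤ-+ : ∀ i j → fromℤ (i ℤ.+ j) ≈ fromℤ i + fromℤ j
  fromℤ-+ (+ m)    (+ n)    = ×-homo-+ 1# m n
  fromℤ-+ (+ m)    -[1+ n ] = fromℤ-⊖ m (suc n)
  fromℤ-+ -[1+ m ] (+ n)    = trans (fromℤ-⊖ n (suc m)) (+-comm _ _)
  fromℤ-+ -[1+ m ] -[1+ n ] = begin
    - (suc (suc (m ℕ.+ n)) · 1#) ≡⟨ ≡.cong (λ k → - (suc k · 1#)) (ℕ.+-suc m n) ⟨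
    - ((suc m ℕ.+ suc n) · 1#) ≈⟨ -‿cong (×-homo-+ 1# (suc m) (suc n)) ⟩
    - (suc m · 1# + suc n · 1#) ≈⟨ -‿+-comm _ _ ⟨
    - (suc m · 1#) - (suc n · 1#) ∎

  fromℤ-neg : ∀ i → fromℤ (ℤ.- i) ≈ - fromℤ i
  fromℤ-neg (+ zero)    = sym -0#≈0#
  fromℤ-neg (+ (suc n)) = refl
  fromℤ-neg -[1+ n ]    = sym (-‿involutive _)

  private
    fromℤ-*⁺ : ∀ m j → fromℤ (+ m ℤ.* j) ≈ m · 1# * fromℤ j
    fromℤ-*⁺ zero    j = trans (reflexive (≡.cong fromℤ (ℤ.*-zeroˡ j))) (sym (zeroˡ _))
    fromℤ-*⁺ (suc m) j = begin
      fromℤ (+ suc m ℤ.* j) ≡⟨ ≡.cong fromℤ (ℤ.suc-* (+ m) j) ⟩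
      fromℤ (j ℤ.+ + m ℤ.* j) ≈⟨ fromℤ-+ j (+ m ℤ.* j) ⟩
      fromℤ j + fromℤ (+ m ℤ.* j) ≈⟨ +-cong (sym (*-identityˡ _)) (fromℤ-*⁺ m j) ⟩
      1# * fromℤ j + (m · 1#) * fromℤ j ≈⟨ distribʳ _ _ _ ⟨
      (suc m · 1#) * fromℤ j ∎

  fromℤ-* : ∀ i j → fromℤ (i ℤ.* j) ≈ fromℤ i * fromℤ j
  fromℤ-* (+ m)    j = fromℤ-*⁺ m j
  fromℤ-* -[1+ m ] j = begin
    fromℤ (-[1+ m ] ℤ.* j) ≡⟨ ≡.cong fromℤ (ℤ.neg-distribˡ-* (+ suc m) j) ⟨
    fromℤ (ℤ.- (+ suc m ℤ.* j)) ≈⟨ fromℤ-neg (+ suc m ℤ.* j) ⟩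
    - fromℤ (+ suc m ℤ.* j) ≈⟨ -‿cong (fromℤ-*⁺ (suc m) j) ⟩
    - ((suc m · 1#) * fromℤ j) ≈⟨ -‿distribˡ-* _ _ ⟩
    - (suc m · 1#) * fromℤ j ∎

  fromℤ-1 : fromℤ (+ 1) ≈ 1#
  fromℤ-1 = +-identityʳ 1#

  private
    -- fromℤ 1 is the sum 1# + 0#; the coefficient 1 of a solver expression should be 1# itself.
    coefficient : ℤ → Carrier
    coefficient (+ 1) = 1#
    coefficient i     = fromℤ i

    coefficient≈fromℤ : ∀ i → coefficient i ≈ fromℤ i
    coefficient≈fromℤ (+ 0)           = refl
    coefficient≈fromℤ (+ 1)           = sym fromℤ-1
    coefficient≈fromℤ (+ suc (suc _)) = refl
    coefficient≈fromℤ -[1+ _ ]        = refl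

    coefficient-morphism : ℤ.+-*-rawRing -Raw-AlmostCommutative⟶ fromCommutativeRing R
    coefficient-morphism = record
      { ⟦_⟧    = coefficient
      ; +-homo = λ i j → via (i ℤ.+ j) (trans (fromℤ-+ i j) (sym (+-cong (coefficient≈fromℤ i) (coefficient≈fromℤ j))))
      ; *-homo = λ i j → via (i ℤ.* j) (trans (fromℤ-* i j) (sym (*-cong (coefficient≈fromℤ i) (coefficient≈fromℤ j))))
      ; -‿homo = λ i → via (ℤ.- i) (trans (fromℤ-neg i) (sym (-‿cong (coefficient≈fromℤ i))))
      ; 0-homo = refl
      ; 1-homo = refl
      }
      where
      via : ∀ i {x} → fromℤ i ≈ x → coefficient i ≈ x
      via i = trans (coefficient≈fromℤ i)

    _≟_ : ∀ i j → Maybe (coefficient i ≈ coefficient j)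
    i ≟ j with i ℤ.≟ j
    ... | yes i≡j = just (reflexive (≡.cong coefficient i≡j))
    ... | no  _   = nothing

  open Solver ℤ.+-*-rawRing (fromCommutativeRing R) coefficient-morphism _≟_ public
    using (solve; _:=_; _:+_; _:*_; _:-_; :-_; _:^_; con)

-- Division with remainder.

ℕ-difference : ∀ r s t d → + r ≡ + s ℤ.+ t ℤ.* + d →
               (∃[ c ] (t ≡ + c × r ≡ s ℕ.+ c ℕ.* d)) ⊎ (∃[ c ] (t ≡ -[1+ c ] × s ≡ r ℕ.+ suc c ℕ.* d))
ℕ-difference r s (+ c)    d eq = inj₁ (c , ≡.refl , ℤ.+-injective (≡.trans eq (≡.sym (+-*-pos s c d))))
  where
  +-*-pos : ∀ s c d → + (s ℕ.+ c ℕ.* d) ≡ + s ℤ.+ + c ℤ.* + d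
  +-*-pos s c d = ≡.cong (λ x → + s ℤ.+ x) (ℤ.pos-* c d)
ℕ-difference r s -[1+ c ] d eq = inj₂ (c , ≡.refl , ℤ.+-injective (begin
  + s ≡⟨ cancel (+ s) (+ suc c) (+ d) ⟨
  + s ℤ.- + suc c ℤ.* + d ℤ.+ + suc c ℤ.* + d ≡⟨ ≡.cong (λ x → + s ℤ.+ x ℤ.+ + suc c ℤ.* + d) (ℤ.neg-distribˡ-* (+ suc c) (+ d)) ⟩
  + s ℤ.+ -[1+ c ] ℤ.* + d ℤ.+ + suc c ℤ.* + d ≡⟨ ≡.cong (ℤ._+ + suc c ℤ.* + d) eq ⟨
  + r ℤ.+ + suc c ℤ.* + d ≡⟨ ≡.cong (λ x → + r ℤ.+ x) (ℤ.pos-* (suc c) d) ⟨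
  + (r ℕ.+ suc c ℕ.* d) ∎))
  where
  open ≡.≡-Reasoning
  cancel : ∀ s c d → s ℤ.- c ℤ.* d ℤ.+ c ℤ.* d ≡ s
  cancel = ℤ-solve

-- The remainder `r` need not be below `d`. With `ℕ-difference`, which moves a negative multiple of
-- `d` to the other side, this compares any such representation of `i` with the canonical one inside
-- ℕ.
divMod-difference : ∀ i {r} k d .{{_ : NonZero d}} → i ≡ + r ℤ.+ k ℤ.* + d →
                    + r ≡ + (i %ℕ d) ℤ.+ (i /ℕ d ℤ.- k) ℤ.* + d
divMod-difference i {r} k d eq = begin
  + r ≡⟨ cancel (+ r) (k ℤ.* + d) ⟨
  + r ℤ.+ k ℤ.* + d ℤ.- k ℤ.* + d ≡⟨ ≡.cong (ℤ._- k ℤ.* + d) eq ⟨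
  i ℤ.- k ℤ.* + d ≡⟨ ≡.cong (ℤ._- k ℤ.* + d) (ℤ.a≡a%ℕn+[a/ℕn]*n i d) ⟩
  + (i %ℕ d) ℤ.+ i /ℕ d ℤ.* + d ℤ.- k ℤ.* + d ≡⟨ collect (+ (i %ℕ d)) (i /ℕ d) k (+ d) ⟩
  + (i %ℕ d) ℤ.+ (i /ℕ d ℤ.- k) ℤ.* + d ∎
  where
  open ≡.≡-Reasoning
  cancel : ∀ x y → x ℤ.+ y ℤ.- y ≡ x
  cancel = ℤ-solve
  collect : ∀ s t k d → s ℤ.+ t ℤ.* d ℤ.- k ℤ.* d ≡ s ℤ.+ (t ℤ.- k) ℤ.* d
  collect = ℤ-solve

-- If the quotients differed, one of the two remainders would exceed the other by at least `d`.
%ℕ-/ℕ-unique : ∀ i {r} k d .{{_ : NonZero d}} → r < d → i ≡ + r ℤ.+ k ℤ.* + d →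
               i %ℕ d ≡ r × i /ℕ d ≡ k
%ℕ-/ℕ-unique i {r} k d r<d eq with ℕ-difference r (i %ℕ d) (i /ℕ d ℤ.- k) d (divMod-difference i k d eq)
... | inj₁ (zero , q-k≡0 , r≡) =
      ≡.sym (≡.trans r≡ (ℕ.+-identityʳ _)) , ℤ.i-j≡0⇒i≡j (i /ℕ d) k q-k≡0
... | inj₁ (suc c , _ , r≡) = contradiction r<d (ℕ.≤⇒≯ (ℕ.≤-trans (ℕ.m≤n⇒m≤o+n (i %ℕ d) (ℕ.m≤m+n d (c ℕ.* d))) (ℕ.≤-reflexive (≡.sym r≡))))
... | inj₂ (c , _ , s≡) = contradiction (ℤ.n%ℕd<d i d) (ℕ.≤⇒≯ (ℕ.≤-trans (ℕ.m≤n⇒m≤o+n r (ℕ.m≤m+n d (c ℕ.* d))) (ℕ.≤-reflexive (≡.sym s≡))))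

-- Binomial coefficients and their divisibility by a prime.

nC0≡1 : ∀ n → n C 0 ≡ 1
nC0≡1 n = ≡.trans (nCk≡nC[n∸k] {k = 0} {n = n} z≤n) (nCn≡1 n)

-- The absorption identity without division. Euclid's lemma extracts `p ∣ p C suc k` from it, and
-- the case `k = 1` gives twice the binomial coefficient over 2.
[k+1]*[n+1]C[k+1] : ∀ n k → suc k ℕ.* (suc n C suc k) ≡ suc n ℕ.* (n C k)
[k+1]*[n+1]C[k+1] n zero = begin
  1 ℕ.* (suc n C 1) ≡⟨ ℕ.*-identityˡ _ ⟩
  suc n C 1 ≡⟨ nC1≡n (suc n) ⟩
  suc n ≡⟨ ℕ.*-identityʳ (suc n) ⟨
  suc n ℕ.* 1 ≡⟨ ≡.cong (suc n ℕ.*_) (nC0≡1 n) ⟨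
  suc n ℕ.* (n C 0) ∎
  where open ≡.≡-Reasoning
[k+1]*[n+1]C[k+1] zero (suc k) = ≡.trans (≡.cong (suc (suc k) ℕ.*_) (k>n⇒nCk≡0 {n = 1} {k = suc (suc k)} (s≤s (s≤s z≤n))))
  (≡.trans (ℕ.*-zeroʳ (suc (suc k))) (≡.sym (≡.trans (ℕ.*-identityˡ _) (k>n⇒nCk≡0 {n = 0} {k = suc k} (s≤s z≤n)))))
[k+1]*[n+1]C[k+1] (suc n) (suc k) = begin
  suc (suc k) ℕ.* (suc (suc n) C suc (suc k))
    ≡⟨ ≡.cong (suc (suc k) ℕ.*_) (nCk+nC[k+1]≡[n+1]C[k+1] (suc n) (suc k)) ⟨
  suc (suc k) ℕ.* (suc n C suc k ℕ.+ suc n C suc (suc k))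
    ≡⟨ split (suc k) (suc n C suc k) (suc n C suc (suc k)) ⟩
  suc n C suc k ℕ.+ suc k ℕ.* (suc n C suc k) ℕ.+ suc (suc k) ℕ.* (suc n C suc (suc k))
    ≡⟨ ≡.cong₂ (λ x y → suc n C suc k ℕ.+ x ℕ.+ y) ([k+1]*[n+1]C[k+1] n k) ([k+1]*[n+1]C[k+1] n (suc k)) ⟩
  suc n C suc k ℕ.+ suc n ℕ.* (n C k) ℕ.+ suc n ℕ.* (n C suc k)
    ≡⟨ ℕ.+-assoc (suc n C suc k) _ _ ⟩
  suc n C suc k ℕ.+ (suc n ℕ.* (n C k) ℕ.+ suc n ℕ.* (n C suc k))
    ≡⟨ ≡.cong (suc n C suc k ℕ.+_) (ℕ.*-distribˡ-+ (suc n) (n C k) (n C suc k)) ⟨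
  suc n C suc k ℕ.+ suc n ℕ.* (n C k ℕ.+ n C suc k)
    ≡⟨ ≡.cong (λ x → suc n C suc k ℕ.+ suc n ℕ.* x) (nCk+nC[k+1]≡[n+1]C[k+1] n k) ⟩
  suc (suc n) ℕ.* (suc n C suc k)
    ∎
  where
  open ≡.≡-Reasoning
  split : ∀ k x y → suc k ℕ.* (x ℕ.+ y) ≡ x ℕ.+ k ℕ.* x ℕ.+ suc k ℕ.* y
  split = ℕ-solve

prime∣binomial : ∀ {p} → Prime p → ∀ k → suc k < p → p ∣ p C suc k
prime∣binomial {suc n} p-prime k k<p
  with euclidsLemma (suc k) (suc n C suc k) p-prime (ℕ∣.divides (n C k) (≡.trans ([k+1]*[n+1]C[k+1] n k) (ℕ.*-comm (suc n) (n C k))))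
... | inj₁ p∣k+1 = contradiction (ℕ∣.∣⇒≤ p∣k+1) (ℕ.<⇒≱ k<p)
... | inj₂ p∣C   = p∣C

-- Parity.

odd≡1+2* : ∀ {n} → ¬ 2 ∣ n → n ≡ suc (n ℕ./ 2 ℕ.* 2)
odd≡1+2* {n} 2∤n = ≡.trans (ℕ.m≡m%n+[m/n]*n n 2) (≡.cong (ℕ._+ n ℕ./ 2 ℕ.* 2) (remainder (n ℕ.% 2) ≡.refl (ℕ.m%n<n n 2)))
  where
  remainder : ∀ r → n ℕ.% 2 ≡ r → r < 2 → r ≡ 1
  remainder 0 n%2≡0 _ = contradiction (ℕ∣.m%n≡0⇒n∣m n 2 n%2≡0) 2∤n
  remainder 1 _     _ = ≡.refl
  remainder (suc (suc _)) _ (s≤s (s≤s ()))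

prime-odd : ∀ {p} → Prime p → 3 ≤ p → ¬ 2 ∣ p
prime-odd p-prime 3≤p 2∣p with prime⇒irreducible p-prime 2∣p
... | inj₂ ≡.refl = contradiction 3≤p (ℕ.<⇒≱ ℕ.≤-refl)

odd-+ : ∀ n → ¬ 2 ∣ n → + n ≡ + 1 ℤ.+ + 2 ℤ.* + (n ℕ./ 2)
odd-+ n 2∤n = ≡.trans (≡.cong +_ (odd≡1+2* 2∤n)) (≡.cong (λ x → + 1 ℤ.+ x) (≡.trans (ℤ.pos-* (n ℕ./ 2) 2) (ℤ.*-comm (+ (n ℕ./ 2)) (+ 2))))

odd≢even : ∀ i j → ¬ + 1 ℤ.+ + 2 ℤ.* i ≡ + 2 ℤ.* j
odd≢even i j eq = contradiction (ℕ∣.∣⇒≤ (ℕ∣.divides ℤ.∣ j ℤ.- i ∣ (≡.trans (≡.cong ℤ.∣_∣ 1≡2*) (≡.trans (ℤ.abs-* (+ 2) (j ℤ.- i)) (ℕ.*-comm 2 ℤ.∣ j ℤ.- i ∣))))) (ℕ.<⇒≱ {1} ℕ.≤-refl)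
  where
  1≡2* : + 1 ≡ + 2 ℤ.* (j ℤ.- i)
  1≡2* = ≡.trans (isolate i) (≡.trans (≡.cong (ℤ._- + 2 ℤ.* i) eq) (factor i j))
    where
    isolate : ∀ i → + 1 ≡ + 1 ℤ.+ + 2 ℤ.* i ℤ.- + 2 ℤ.* i
    isolate = ℤ-solve
    factor : ∀ i j → + 2 ℤ.* j ℤ.- + 2 ℤ.* i ≡ + 2 ℤ.* (j ℤ.- i)
    factor = ℤ-solve

exact-/ℕ : ∀ i k → i ≡ + 2 ℤ.* k → i /ℕ 2 ≡ k
exact-/ℕ i k eq = proj₂ (%ℕ-/ℕ-unique i k 2 (s≤s z≤n) (≡.trans eq (≡.trans (ℤ.*-comm (+ 2) k) (≡.sym (ℤ.+-identityˡ _)))))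

-- Integer powers of a root of unity.

module Powers (R : CommutativeRing c ℓ) where

  open CommutativeRing R hiding (zero)
  open RingNotions R
  open Exp commutativeSemiring using (^-congˡ; ^-congʳ; ^-homo-*; ^-assocʳ; ^-distrib-*) public
  open SetoidReasoning setoid

  1^n≈1 : ∀ n → 1# ^ n ≈ 1#
  1^n≈1 zero    = refl
  1^n≈1 (suc n) = trans (*-identityˡ _) (1^n≈1 n)

  module _ (e : ℕ) .{{_ : NonZero e}} {z : Carrier} (z^e≈1 : z ^ e ≈ 1#) where

    ^-+*e : ∀ n k → z ^ (n ℕ.+ k ℕ.* e) ≈ z ^ n
    ^-+*e n k = begin
      z ^ (n ℕ.+ k ℕ.* e) ≈⟨ ^-homo-* z n (k ℕ.* e) ⟩
      z ^ n * z ^ (k ℕ.* e) ≡⟨ ≡.cong (λ x → z ^ n * z ^ x) (ℕ.*-comm k e) ⟩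
      z ^ n * z ^ (e ℕ.* k) ≈⟨ *-congˡ (^-assocʳ z e k) ⟨
      z ^ n * (z ^ e) ^ k ≈⟨ *-congˡ (trans (^-congˡ k z^e≈1) (1^n≈1 k)) ⟩
      z ^ n * 1# ≈⟨ *-identityʳ _ ⟩
      z ^ n ∎

    -- The canonical exponent `i %ℕ e` may be below or above `n`; in either case the larger exponent
    -- is the smaller one plus a multiple of `e`. The laws of `powMod` follow by exhibiting a
    -- quotient.
    powMod≈^ : ∀ i n k → i ≡ + n ℤ.+ k ℤ.* + e → powMod e z i ≈ z ^ n
    powMod≈^ i n k eq with ℕ-difference n (i %ℕ e) (i /ℕ e ℤ.- k) e (divMod-difference i k e eq)
    ... | inj₁ (c , _ , n≡) = sym (trans (^-congʳ z n≡) (^-+*e (i %ℕ e) c))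
    ... | inj₂ (c , _ , r≡) = trans (^-congʳ z r≡) (^-+*e n (suc c))

    powMod-pos : ∀ n → powMod e z (+ n) ≈ z ^ n
    powMod-pos n = powMod≈^ (+ n) n (+ 0) (≡.sym (≡.trans (≡.cong (ℤ._+_ (+ n)) (ℤ.*-zeroˡ (+ e))) (ℤ.+-identityʳ (+ n))))

    powMod-shift : ∀ i k → powMod e z (i ℤ.+ k ℤ.* + e) ≈ powMod e z i
    powMod-shift i k = powMod≈^ (i ℤ.+ k ℤ.* + e) (i %ℕ e) (i /ℕ e ℤ.+ k) (≡.trans
      (≡.cong (ℤ._+ k ℤ.* + e) (ℤ.a≡a%ℕn+[a/ℕn]*n i e)) (collect (+ (i %ℕ e)) (i /ℕ e) k (+ e)))
      where
      collect : ∀ r q k e → r ℤ.+ q ℤ.* e ℤ.+ k ℤ.* e ≡ r ℤ.+ (q ℤ.+ k) ℤ.* e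
      collect = ℤ-solve

    powMod-+ : ∀ i j → powMod e z (i ℤ.+ j) ≈ powMod e z i * powMod e z j
    powMod-+ i j = trans
      (powMod≈^ (i ℤ.+ j) (i %ℕ e ℕ.+ j %ℕ e) (i /ℕ e ℤ.+ j /ℕ e) (≡.trans
        (≡.cong₂ ℤ._+_ (ℤ.a≡a%ℕn+[a/ℕn]*n i e) (ℤ.a≡a%ℕn+[a/ℕn]*n j e))
        (collect (+ (i %ℕ e)) (+ (j %ℕ e)) (i /ℕ e) (j /ℕ e) (+ e))))
      (^-homo-* z (i %ℕ e) (j %ℕ e))
      where
      collect : ∀ r s q t e → r ℤ.+ q ℤ.* e ℤ.+ (s ℤ.+ t ℤ.* e) ≡ r ℤ.+ s ℤ.+ (q ℤ.+ t) ℤ.* e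
      collect = ℤ-solve

    powMod-* : ∀ i j → powMod e z (i ℤ.* j) ≈ powMod e (powMod e z i) j
    powMod-* i j = trans
      (powMod≈^ (i ℤ.* j) (i %ℕ e ℕ.* (j %ℕ e)) (r ℤ.* t ℤ.+ q ℤ.* j) divided)
      (sym (^-assocʳ z (i %ℕ e) (j %ℕ e)))
      where
      r = + (i %ℕ e)
      s = + (j %ℕ e)
      q = i /ℕ e
      t = j /ℕ e
      expand : ∀ r q j e → (r ℤ.+ q ℤ.* e) ℤ.* j ≡ r ℤ.* j ℤ.+ q ℤ.* j ℤ.* e
      expand = ℤ-solve
      collect : ∀ r s q t j e → r ℤ.* (s ℤ.+ t ℤ.* e) ℤ.+ q ℤ.* j ℤ.* e ≡ r ℤ.* s ℤ.+ (r ℤ.* t ℤ.+ q ℤ.* j) ℤ.* e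
      collect = ℤ-solve
      divided : i ℤ.* j ≡ + (i %ℕ e ℕ.* (j %ℕ e)) ℤ.+ (r ℤ.* t ℤ.+ q ℤ.* j) ℤ.* + e
      divided = ≡.trans (≡.cong (ℤ._* j) (ℤ.a≡a%ℕn+[a/ℕn]*n i e))
        (≡.trans (expand r q j (+ e))
        (≡.trans (≡.cong (λ x → r ℤ.* x ℤ.+ q ℤ.* j ℤ.* + e) (ℤ.a≡a%ℕn+[a/ℕn]*n j e))
        (≡.trans (collect r s q t j (+ e))
        (≡.cong (ℤ._+ (r ℤ.* t ℤ.+ q ℤ.* j) ℤ.* + e) (≡.sym (ℤ.pos-* (i %ℕ e) (j %ℕ e)))))))

    powMod^e≈1 : ∀ i → powMod e z i ^ e ≈ 1#
    powMod^e≈1 i = begin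
      (z ^ (i %ℕ e)) ^ e ≈⟨ ^-assocʳ z (i %ℕ e) e ⟩
      z ^ (i %ℕ e ℕ.* e) ≈⟨ ^-+*e 0 (i %ℕ e) ⟩
      1# ∎

  powMod-cong : ∀ e .{{_ : NonZero e}} {x y} i → x ≈ y → powMod e x i ≈ powMod e y i
  powMod-cong e i = ^-congˡ (i %ℕ e)

  -- Exponents of `z ^ 2` count modulo `e` and those of `z` modulo `2 * e`; doubling passes from one
  -- to the other, as needed for ζ_{l²} = ζ².
  powMod-square : ∀ e .{{_ : NonZero e}} .{{_ : NonZero (2 ℕ.* e)}} {z} → z ^ (2 ℕ.* e) ≈ 1# → ∀ i →
                  powMod e (z ^ 2) i ≈ powMod (2 ℕ.* e) z (+ 2 ℤ.* i)
  powMod-square e {z} z^2e≈1 i = trans (^-assocʳ z 2 (i %ℕ e)) (sym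
    (powMod≈^ (2 ℕ.* e) z^2e≈1 (+ 2 ℤ.* i) (2 ℕ.* (i %ℕ e)) (i /ℕ e) (≡.trans
      (≡.cong (+ 2 ℤ.*_) (ℤ.a≡a%ℕn+[a/ℕn]*n i e))
      (≡.trans (expand (+ (i %ℕ e)) (i /ℕ e) (+ e))
        (≡.sym (≡.cong₂ (λ x y → x ℤ.+ i /ℕ e ℤ.* y) (ℤ.pos-* 2 (i %ℕ e)) (ℤ.pos-* 2 e)))))))
    where
    expand : ∀ r q e → + 2 ℤ.* (r ℤ.+ q ℤ.* e) ≡ + 2 ℤ.* r ℤ.+ q ℤ.* (+ 2 ℤ.* e)
    expand = ℤ-solve

-- Membership in ℤ[z].

module Subrings (R : CommutativeRing c ℓ) where

  open CommutativeRing R hiding (zero)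
  open RingNotions R
  open Mult semiring using () renaming (_×_ to _·_)
  open Sum semiring using (sum)

  module _ {z : Carrier} where

    zero∈ : ℤ[ z ] 0#
    zero∈ = resp (-‿inverseʳ 1#) (add one (neg one))

    sub : ∀ {x y} → ℤ[ z ] x → ℤ[ z ] y → ℤ[ z ] (x - y)
    sub x∈ y∈ = add x∈ (neg y∈)

    pow : ∀ {x} n → ℤ[ z ] x → ℤ[ z ] (x ^ n)
    pow zero    x∈ = one
    pow (suc n) x∈ = mul x∈ (pow n x∈)

    multiple : ∀ {x} n → ℤ[ z ] x → ℤ[ z ] (n · x)
    multiple zero    x∈ = zero∈
    multiple (suc n) x∈ = add x∈ (multiple n x∈)

    fromℤ∈ : ∀ i → ℤ[ z ] (fromℤ i)
    fromℤ∈ (+ n)    = multiple n one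
    fromℤ∈ -[1+ n ] = neg (multiple (suc n) one)

    sum∈ : ∀ {n} (f : Fin n → Carrier) → (∀ i → ℤ[ z ] (f i)) → ℤ[ z ] (sum f)
    sum∈ {zero}  f f∈ = zero∈
    sum∈ {suc n} f f∈ = add (f∈ zero) (sum∈ (f ∘ suc) (f∈ ∘ suc))

  -- Carries the cofactors of `frobenius`, which are polynomials in `u`, into ℤ[z] for `u` in ℤ[z].
  adjoin-⊆ : ∀ {y z} → ℤ[ z ] y → ∀ {x} → ℤ[ y ] x → ℤ[ z ] x
  adjoin-⊆ y∈ gen         = y∈
  adjoin-⊆ y∈ one         = one
  adjoin-⊆ y∈ (add p q)   = add (adjoin-⊆ y∈ p) (adjoin-⊆ y∈ q)
  adjoin-⊆ y∈ (neg p)     = neg (adjoin-⊆ y∈ p)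
  adjoin-⊆ y∈ (mul p q)   = mul (adjoin-⊆ y∈ p) (adjoin-⊆ y∈ q)
  adjoin-⊆ y∈ (resp eq p) = resp eq (adjoin-⊆ y∈ p)

-- The binomial theorem and its form modulo a prime.

module BinomialSums (R : CommutativeRing c ℓ) where

  open CommutativeRing R hiding (zero)
  open RingNotions R
  open Subrings R
  open Powers R
  open IntegerMultiples R using (solve; _:=_; _:+_; _:*_; con)
  open Mult semiring using (×-homo-+; ×1-homo-*; ×-comm-*; ×-assoc-*; ×-congˡ; ×-congʳ; ×-homo-1) renaming (_×_ to _·_)
  open Sum semiring using (sum; sum-cong-≋; ∑-distrib-+; *-distribˡ-sum; sum-replicate-zero; sum-init-last)
  open SetoidReasoning setoid

  -- The number `n` of terms is independent of the exponent `s`, so that sums for varying `s` share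
  -- one index set and can be interchanged with a sum over the field.
  binomialSum : ℕ → ℕ → Carrier → Carrier
  binomialSum s n u = sum {n} (λ i → (s C toℕ i) · u ^ toℕ i)

  binomialSum-pascal : ∀ s n u → binomialSum (suc s) (suc n) u ≈ binomialSum s (suc n) u + u * binomialSum s n u
  binomialSum-pascal s n u = begin
    (suc s C 0) · 1# + sum {n} (λ i → (suc s C suc (toℕ i)) · u ^ suc (toℕ i))
      ≈⟨ +-cong (×-congˡ (≡.trans (nC0≡1 (suc s)) (≡.sym (nC0≡1 s)))) (sum-cong-≋ {n} term) ⟩
    (s C 0) · 1# + sum {n} (λ i → (s C suc (toℕ i)) · u ^ suc (toℕ i) + u * ((s C toℕ i) · u ^ toℕ i))
      ≈⟨ +-congˡ (∑-distrib-+ {n} (λ i → (s C suc (toℕ i)) · u ^ suc (toℕ i)) (λ i → u * ((s C toℕ i) · u ^ toℕ i))) ⟩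
    (s C 0) · 1# + (sum {n} (λ i → (s C suc (toℕ i)) · u ^ suc (toℕ i)) + sum {n} (λ i → u * ((s C toℕ i) · u ^ toℕ i)))
      ≈⟨ +-assoc _ _ _ ⟨
    binomialSum s (suc n) u + sum {n} (λ i → u * ((s C toℕ i) · u ^ toℕ i))
      ≈⟨ +-congˡ (*-distribˡ-sum {n} u (λ i → (s C toℕ i) · u ^ toℕ i)) ⟨
    binomialSum s (suc n) u + u * binomialSum s n u ∎
    where
    term : ∀ (i : Fin n) → (suc s C suc (toℕ i)) · u ^ suc (toℕ i) ≈
                           (s C suc (toℕ i)) · u ^ suc (toℕ i) + u * ((s C toℕ i) · u ^ toℕ i)
    term i = begin
      (suc s C suc k) · u ^ suc k ≈⟨ ×-congˡ (nCk+nC[k+1]≡[n+1]C[k+1] s k) ⟨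
      (s C k ℕ.+ s C suc k) · u ^ suc k ≈⟨ ×-homo-+ _ (s C k) (s C suc k) ⟩
      (s C k) · u ^ suc k + (s C suc k) · u ^ suc k ≈⟨ +-comm _ _ ⟩
      (s C suc k) · u ^ suc k + (s C k) · u ^ suc k ≈⟨ +-congˡ (×-comm-* (s C k) u (u ^ k)) ⟨
      (s C suc k) · u ^ suc k + u * ((s C k) · u ^ k) ∎
      where k = toℕ i

  binomialSum≈[1+u]^s : ∀ s n u → s < n → binomialSum s n u ≈ (1# + u) ^ s
  binomialSum≈[1+u]^s zero (suc n) u _ = begin
    (0 C 0) · 1# + sum {n} (λ i → (0 C suc (toℕ i)) · u ^ suc (toℕ i))
      ≈⟨ +-cong (×-homo-1 1#) (sum-cong-≋ {n} (λ i → ×-congˡ {u ^ suc (toℕ i)} (k>n⇒nCk≡0 {n = 0} {k = suc (toℕ i)} (s≤s z≤n)))) ⟩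
    1# + sum {n} (λ i → 0#) ≈⟨ +-congˡ (sum-replicate-zero n) ⟩
    1# + 0# ≈⟨ +-identityʳ 1# ⟩
    1# ∎
  binomialSum≈[1+u]^s (suc s) (suc n) u (s≤s s<n) = begin
    binomialSum (suc s) (suc n) u ≈⟨ binomialSum-pascal s n u ⟩
    binomialSum s (suc n) u + u * binomialSum s n u
      ≈⟨ +-cong (binomialSum≈[1+u]^s s (suc n) u (ℕ.m<n⇒m<1+n s<n)) (*-congˡ (binomialSum≈[1+u]^s s n u s<n)) ⟩
    (1# + u) ^ s + u * (1# + u) ^ s ≈⟨ solve 2 (λ u x → x :+ u :* x := (con (+ 1) :+ u) :* x) refl u ((1# + u) ^ s) ⟩
    (1# + u) ^ suc s ∎

  -- `y` collects the binomials C(p, k) with 2 ≤ k < p, divided by `p`. The linear term is kept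
  -- apart, so that the cofactor of `p` is `u * (1# + u * y)`: when (1 + u)^p = 1, cancelling `u`
  -- leaves p (1 + u y), in which `p` stands alone up to a multiple of `u`.
  frobenius : ∀ p → Prime p → ∀ u → ∃[ y ] (ℤ[ u ] y × (1# + u) ^ p ≈ 1# + u ^ p + (p · 1#) * (u * (1# + u * y)))
  frobenius zero          p-prime u = contradiction p-prime ¬prime[0]
  frobenius (suc zero)    p-prime u = contradiction p-prime ¬prime[1]
  frobenius p@(suc (suc m)) p-prime u = y , sum∈ _ (λ i → multiple (d i) (pow (toℕ i) gen)) , (begin
    (1# + u) ^ p
      ≈⟨ binomialSum≈[1+u]^s p (suc p) u ℕ.≤-refl ⟨
    (p C 0) · 1# + ((p C 1) · u ^ 1 + sum t)
      ≈⟨ +-cong (trans (×-congˡ (nC0≡1 p)) (×-homo-1 1#)) (+-cong head (trans (sum-init-last t) (+-cong middle end))) ⟩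
    1# + ((p · 1#) * u + ((p · 1#) * (u * (u * y)) + u ^ p))
      ≈⟨ solve 4 (λ p u y w → con (+ 1) :+ (p :* u :+ (p :* (u :* (u :* y)) :+ w))
                           := con (+ 1) :+ w :+ p :* (u :* (con (+ 1) :+ u :* y))) refl (p · 1#) u y (u ^ p) ⟩
    1# + u ^ p + (p · 1#) * (u * (1# + u * y)) ∎)
    where
    -- With p = m + 2, the exponents in `t` run from 2 to p: the last term is `u ^ p`, and the
    -- binomials of the other `m` terms are divisible by `p`.
    t : Fin (suc m) → Carrier
    t i = (p C suc (suc (toℕ i))) · u ^ suc (suc (toℕ i))

    p∣C : ∀ (i : Fin m) → p ∣ p C suc (suc (toℕ i))
    p∣C i = prime∣binomial p-prime (suc (toℕ i)) (s≤s (s≤s (Fin.toℕ<n i)))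

    d : Fin m → ℕ
    d i = ℕ∣.quotient (p∣C i)

    y : Carrier
    y = sum {m} (λ i → d i · u ^ toℕ i)

    head : (p C 1) · u ^ 1 ≈ (p · 1#) * u
    head = begin
      (p C 1) · (u * 1#) ≈⟨ ×-congˡ (nC1≡n p) ⟩
      p · (u * 1#) ≈⟨ ×-congʳ p (*-comm u 1#) ⟩
      p · (1# * u) ≈⟨ ×-assoc-* p 1# u ⟨
      (p · 1#) * u ∎

    end : (p C suc (suc (toℕ (fromℕ m)))) · u ^ suc (suc (toℕ (fromℕ m))) ≈ u ^ p
    end = begin
      (p C suc (suc (toℕ (fromℕ m)))) · u ^ suc (suc (toℕ (fromℕ m)))
        ≡⟨ ≡.cong (λ k → (p C suc (suc k)) · u ^ suc (suc k)) (Fin.toℕ-fromℕ m) ⟩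
      (p C p) · u ^ p ≈⟨ ×-congˡ (nCn≡1 p) ⟩
      1 · u ^ p ≈⟨ ×-homo-1 _ ⟩
      u ^ p ∎

    middle-term : ∀ i → t (inject₁ i) ≈ (p · 1# * (u * u)) * (d i · u ^ toℕ i)
    middle-term i = begin
      t (inject₁ i)
        ≡⟨ ≡.cong (λ k → (p C suc (suc k)) · u ^ suc (suc k)) (Fin.toℕ-inject₁ i) ⟩
      (p C suc (suc k)) · u ^ suc (suc k)
        ≈⟨ ×-congˡ (ℕ∣.m∣n⇒n≡m*quotient (p∣C i)) ⟩
      (p ℕ.* d i) · (u * (u * u ^ k))
        ≈⟨ ×-congʳ (p ℕ.* d i) (*-identityˡ _) ⟨
      (p ℕ.* d i) · (1# * (u * (u * u ^ k)))
        ≈⟨ ×-assoc-* (p ℕ.* d i) 1# _ ⟨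
      (p ℕ.* d i) · 1# * (u * (u * u ^ k))
        ≈⟨ *-congʳ (×1-homo-* p (d i)) ⟩
      p · 1# * (d i · 1#) * (u * (u * u ^ k))
        ≈⟨ solve 4 (λ p d u w → p :* d :* (u :* (u :* w)) := (p :* (u :* u)) :* (d :* w)) refl (p · 1#) (d i · 1#) u (u ^ k) ⟩
      (p · 1# * (u * u)) * (d i · 1# * u ^ k)
        ≈⟨ *-congˡ (trans (×-assoc-* (d i) 1# (u ^ k)) (×-congʳ (d i) (*-identityˡ _))) ⟩
      (p · 1# * (u * u)) * (d i · u ^ k) ∎
      where k = toℕ i

    middle : sum {m} (t ∘ inject₁) ≈ (p · 1#) * (u * (u * y))
    middle = begin
      sum {m} (t ∘ inject₁) ≈⟨ sum-cong-≋ {m} middle-term ⟩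
      sum {m} (λ i → (p · 1# * (u * u)) * (d i · u ^ toℕ i)) ≈⟨ *-distribˡ-sum {m} _ (λ i → d i · u ^ toℕ i) ⟨
      (p · 1# * (u * u)) * y ≈⟨ solve 3 (λ p u y → (p :* (u :* u)) :* y := p :* (u :* (u :* y))) refl (p · 1#) u y ⟩
      (p · 1#) * (u * (u * y)) ∎

-- Divisibility and congruence in ℤ[z].

module Ideals (R : CommutativeRing c ℓ) (z : CommutativeRing.Carrier R) where

  open CommutativeRing R hiding (zero)
  open RingNotions R
  open Subrings R
  open Powers R
  open IntegerMultiples R using (solve; _:=_; _:+_; _:*_; _:-_; :-_; con)
  open SetoidReasoning setoid

  infix 4 _divides_

  -- Chosen so that `CongruentMod z g x y` unfolds to `g divides (x - y)`; the facts on divisibility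
  -- then serve for congruences without conversion.
  _divides_ : Carrier → Carrier → Set _
  g divides x = ∃[ t ] (ℤ[ z ] t × x ≈ g * t)

  private
    variable
      g h x y : Carrier

  divides-resp : x ≈ y → g divides x → g divides y
  divides-resp x≈y (t , t∈ , x≈) = t , t∈ , trans (sym x≈y) x≈

  divides-congˡ : g ≈ h → g divides x → h divides x
  divides-congˡ g≈h (t , t∈ , x≈) = t , t∈ , trans x≈ (*-congʳ g≈h)

  divides-refl : g divides g
  divides-refl = 1# , one , sym (*-identityʳ _)

  divides-+ : g divides x → g divides y → g divides x + y
  divides-+ (s , s∈ , x≈) (t , t∈ , y≈) = s + t , add s∈ t∈ , trans (+-cong x≈ y≈) (sym (distribˡ _ s t))

  divides-neg : g divides x → g divides - x
  divides-neg {g} {x} (t , t∈ , x≈) = - t , neg t∈ , (begin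
    - x ≈⟨ -‿cong x≈ ⟩
    - (g * t) ≈⟨ solve 2 (λ g t → :- (g :* t) := g :* :- t) refl g t ⟩
    g * - t ∎)

  divides-*ʳ : ℤ[ z ] y → g divides x → g divides x * y
  divides-*ʳ {y} y∈ (t , t∈ , x≈) = t * y , mul t∈ y∈ , trans (*-congʳ x≈) (*-assoc _ t y)

  divides-*ˡ : ℤ[ z ] y → g divides x → g divides y * x
  divides-*ˡ y∈ d = divides-resp (*-comm _ _) (divides-*ʳ y∈ d)

  divides-* : g divides x → h divides y → g * h divides x * y
  divides-* {g} {x} {h} {y} (s , s∈ , x≈) (t , t∈ , y≈) = s * t , mul s∈ t∈ , (begin
    x * y ≈⟨ *-cong x≈ y≈ ⟩
    (g * s) * (h * t) ≈⟨ solve 4 (λ g s h t → (g :* s) :* (h :* t) := (g :* h) :* (s :* t)) refl g s h t ⟩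
    (g * h) * (s * t) ∎)

  divides-^ : ∀ n → g divides x → g ^ n divides x ^ n
  divides-^ zero    d = divides-refl
  divides-^ (suc n) d = divides-* d (divides-^ n d)

  divides-trans : g divides h → h divides x → g divides x
  divides-trans (s , s∈ , h≈) (t , t∈ , x≈) = s * t , mul s∈ t∈ , trans x≈ (trans (*-congʳ h≈) (*-assoc _ s t))

  ^-divides-^ : ∀ {m n} → ℤ[ z ] g → m ≤ n → g ^ m divides g ^ n
  ^-divides-^ {g} {m} {n} g∈ m≤n = g ^ (n ℕ.∸ m) , pow (n ℕ.∸ m) g∈ , (begin
    g ^ n ≡⟨ ≡.cong (g ^_) (ℕ.m+[n∸m]≡n m≤n) ⟨
    g ^ (m ℕ.+ (n ℕ.∸ m)) ≈⟨ ^-homo-* g m (n ℕ.∸ m) ⟩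
    g ^ m * g ^ (n ℕ.∸ m) ∎)

  ^-divides-≤ : ∀ {m n} → ℤ[ z ] g → m ≤ n → g ^ n divides x → g ^ m divides x
  ^-divides-≤ g∈ m≤n = divides-trans (^-divides-^ g∈ m≤n)

  x-1-divides-x^n-1 : ℤ[ z ] x → ∀ n → (x - 1#) divides (x ^ n - 1#)
  x-1-divides-x^n-1 {x} x∈ zero    = 0# , zero∈ , trans (-‿inverseʳ 1#) (sym (zeroʳ _))
  x-1-divides-x^n-1 {x} x∈ (suc n) = divides-resp
    (solve 2 (λ x y → x :* (y :- con (+ 1)) :+ (x :- con (+ 1)) := x :* y :- con (+ 1)) refl x (x ^ n))
    (divides-+ (divides-*ˡ x∈ (x-1-divides-x^n-1 x∈ n)) divides-refl)

  divides-sum : ∀ {n} (t : Fin n → Carrier) → (∀ i → g divides t i) → g divides Sum.sum semiring t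
  divides-sum {g} {zero}  t d = 0# , zero∈ , sym (zeroʳ g)
  divides-sum {g} {suc n} t d = divides-+ (d zero) (divides-sum (t ∘ suc) (d ∘ suc))

  module _ {g : Carrier} where

    private
      variable
        x′ y′ w : Carrier

    ≈⇒congruent : x ≈ y → CongruentMod z g x y
    ≈⇒congruent {x} {y} x≈y = 0# , zero∈ , trans (+-congʳ x≈y) (trans (-‿inverseʳ y) (sym (zeroʳ g)))

    congruent-sym : CongruentMod z g x y → CongruentMod z g y x
    congruent-sym {x} {y} d = divides-resp (solve 2 (λ x y → :- (x :- y) := y :- x) refl x y) (divides-neg d)

    congruent-trans : CongruentMod z g x y → CongruentMod z g y w → CongruentMod z g x w
    congruent-trans {x} {y} {w} d e = divides-resp (solve 3 (λ x y w → (x :- y) :+ (y :- w) := x :- w) refl x y w) (divides-+ d e)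

    congruent-+ : CongruentMod z g x x′ → CongruentMod z g y y′ → CongruentMod z g (x + y) (x′ + y′)
    congruent-+ {x} {x′} {y} {y′} d e =
      divides-resp (solve 4 (λ x x′ y y′ → (x :- x′) :+ (y :- y′) := (x :+ y) :- (x′ :+ y′)) refl x x′ y y′) (divides-+ d e)

    congruent-neg : CongruentMod z g x y → CongruentMod z g (- x) (- y)
    congruent-neg {x} {y} d = divides-resp (solve 2 (λ x y → :- (x :- y) := :- x :- :- y) refl x y) (divides-neg d)

    -- From xy - x′y′ = (x - x′) y + x′ (y - y′): the elements `y` and `x′` multiply cofactors,
    -- hence must lie in ℤ[z].
    congruent-* : ℤ[ z ] x′ → ℤ[ z ] y → CongruentMod z g x x′ → CongruentMod z g y y′ → CongruentMod z g (x * y) (x′ * y′)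
    congruent-* {x′} {y} {x} {y′} x′∈ y∈ d e =
      divides-resp (solve 4 (λ x x′ y y′ → (x :- x′) :* y :+ x′ :* (y :- y′) := (x :* y) :- (x′ :* y′)) refl x x′ y y′)
        (divides-+ (divides-*ʳ y∈ d) (divides-*ˡ x′∈ e))

    divides⇒congruent-0 : g divides x → CongruentMod z g x 0#
    divides⇒congruent-0 {x} = divides-resp (solve 1 (λ x → x := x :- con (+ 0)) refl x)

-- The quotient of ℤ[z] by a principal ideal.

module Quotient (R : CommutativeRing c ℓ) (z g : CommutativeRing.Carrier R) where

  private module R = CommutativeRing R
  open RingNotions R using (ℤ[_]; CongruentMod; one; add; neg; mul)
  open Subrings R
  open Ideals R z
  open Sum R.semiring using (sum)

  -- Membership belongs to the element, because congruence respects products only inside ℤ[z].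
  Element : Set _
  Element = ∃[ x ] ℤ[ z ] x

  quotient : CommutativeRing _ _
  quotient = record
    { Carrier = Element
    ; _≈_ = λ x y → CongruentMod z g (proj₁ x) (proj₁ y)
    ; _+_ = λ x y → proj₁ x R.+ proj₁ y , add (proj₂ x) (proj₂ y)
    ; _*_ = λ x y → proj₁ x R.* proj₁ y , mul (proj₂ x) (proj₂ y)
    ; -_ = λ x → R.- proj₁ x , neg (proj₂ x)
    ; 0# = R.0# , zero∈
    ; 1# = R.1# , one
    ; isCommutativeRing = record
      { isRing = record
        { +-isAbelianGroup = record
          { isGroup = record
            { isMonoid = record
              { isSemigroup = record
                { isMagma = record
                  { isEquivalence = record { refl = ≈⇒congruent R.refl ; sym = congruent-sym ; trans = congruent-trans }
                  ; ∙-cong = congruent-+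
                  }
                ; assoc = λ x y w → ≈⇒congruent (R.+-assoc (proj₁ x) (proj₁ y) (proj₁ w))
                }
              ; identity = (λ x → ≈⇒congruent (R.+-identityˡ (proj₁ x))) , (λ x → ≈⇒congruent (R.+-identityʳ (proj₁ x)))
              }
            ; inverse = (λ x → ≈⇒congruent (R.-‿inverseˡ (proj₁ x))) , (λ x → ≈⇒congruent (R.-‿inverseʳ (proj₁ x)))
            ; ⁻¹-cong = congruent-neg
            }
          ; comm = λ x y → ≈⇒congruent (R.+-comm (proj₁ x) (proj₁ y))
          }
        ; *-cong = λ {_} {x′} {y} → congruent-* (proj₂ x′) (proj₂ y)
        ; *-assoc = λ x y w → ≈⇒congruent (R.*-assoc (proj₁ x) (proj₁ y) (proj₁ w))
        ; *-identity = (λ x → ≈⇒congruent (R.*-identityˡ (proj₁ x))) , (λ x → ≈⇒congruent (R.*-identityʳ (proj₁ x)))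
        ; distrib = (λ x y w → ≈⇒congruent (R.distribˡ (proj₁ x) (proj₁ y) (proj₁ w)))
                  , (λ x y w → ≈⇒congruent (R.distribʳ (proj₁ x) (proj₁ y) (proj₁ w)))
        }
      ; *-comm = λ x y → ≈⇒congruent (R.*-comm (proj₁ x) (proj₁ y))
      }
    }
  private
    module Q = CommutativeRing quotient
    module RN = RingNotions R
    module QN = RingNotions quotient

  -- An equality of representatives, not a mere congruence: expressions formed in the quotient can
  -- be read back in R.
  proj₁-sum : ∀ {n} (t : Fin n → Element) → proj₁ (Sum.sum Q.semiring t) ≡ sum (λ i → proj₁ (t i))
  proj₁-sum {zero}  t = ≡.refl
  proj₁-sum {suc n} t = ≡.cong (λ y → proj₁ (t zero) R.+ y) (proj₁-sum (t ∘ suc))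

  proj₁-^ : ∀ x n → proj₁ (x QN.^ n) ≡ proj₁ x RN.^ n
  proj₁-^ x zero    = ≡.refl
  proj₁-^ x (suc n) = ≡.cong (proj₁ x R.*_) (proj₁-^ x n)

  proj₁-·1 : ∀ n → proj₁ (Mult._×_ Q.semiring n Q.1#) ≡ Mult._×_ R.semiring n R.1#
  proj₁-·1 zero    = ≡.refl
  proj₁-·1 (suc n) = ≡.cong (R.1# R.+_) (proj₁-·1 n)

  proj₁-fromℤ : ∀ i → proj₁ (QN.fromℤ i) ≡ RN.fromℤ i
  proj₁-fromℤ (+ n)    = proj₁-·1 n
  proj₁-fromℤ -[1+ n ] = ≡.cong R.-_ (proj₁-·1 (suc n))

-- Cancellation in a field, and the divisors of a prime in ℤ[z].

module Domains (K : HeytingField c ℓ₁ ℓ₂) where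

  private R = fieldRing K
  open HeytingField K using (tight; #⇒invertible)
  open CommutativeRing R hiding (zero)
  open RingNotions R
  open Subrings R
  open Powers R
  open BinomialSums R using (frobenius)
  open Mult semiring using () renaming (_×_ to _·_)
  open IntegerMultiples R using (solve; _:=_; _:+_; _:*_; _:-_; :-_; con)
  open SetoidReasoning setoid

  -- By tightness it is enough to refute `y # 0#`, and an inverse of `y` would cancel it from the
  -- product, making `x` zero.
  *-cancel-0 : ∀ {x y} → x * y ≈ 0# → ¬ x ≈ 0# → y ≈ 0#
  *-cancel-0 {x} {y} xy≈0 x≉0 = proj₁ (tight y 0#) λ y#0 →
    let y⁻¹ , _ , y*y⁻¹≈1 = #⇒invertible y#0 in
    x≉0 (begin
      x ≈⟨ *-identityʳ x ⟨
      x * 1# ≈⟨ *-congˡ y*y⁻¹≈1 ⟨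
      x * ((y - 0#) * y⁻¹) ≈⟨ solve 3 (λ x y w → x :* ((y :- con (+ 0)) :* w) := (x :* y) :* w) refl x y y⁻¹ ⟩
      x * y * y⁻¹ ≈⟨ *-congʳ xy≈0 ⟩
      0# * y⁻¹ ≈⟨ zeroˡ y⁻¹ ⟩
      0# ∎)

  *-cancelˡ : ∀ {a x y} → ¬ a ≈ 0# → a * x ≈ a * y → x ≈ y
  *-cancelˡ {a} {x} {y} a≉0 ax≈ay = begin
    x ≈⟨ solve 2 (λ x y → x := (x :- y) :+ y) refl x y ⟩
    (x - y) + y ≈⟨ +-congʳ (*-cancel-0 zero-product a≉0) ⟩
    0# + y ≈⟨ +-identityˡ y ⟩
    y ∎
    where
    zero-product : a * (x - y) ≈ 0#
    zero-product = begin
      a * (x - y) ≈⟨ solve 3 (λ a x y → a :* (x :- y) := a :* x :- a :* y) refl a x y ⟩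
      a * x - a * y ≈⟨ +-congʳ ax≈ay ⟩
      a * y - a * y ≈⟨ -‿inverseʳ _ ⟩
      0# ∎

  -- With u = zᵖ - 1, the binomial expansion of (1 + u)ᵖ = 1 gives uᵖ⁻¹ + p (1 + u y) = 0, so that uᵖ⁻¹
  -- divides p; and u is divisible by (1 - z)ᵖ as soon as (1 - z)ᵖ⁻¹ divides p.
  module _ (p : ℕ) (p-prime : Prime p) (3≤p : 3 ≤ p)
           (z : Carrier) (z^pp≈1 : (z ^ p) ^ p ≈ 1#) (z^p≉1 : ¬ z ^ p ≈ 1#) where

    open Ideals R z

    private
      π = 1# - z
      v = z - 1#
      u = z ^ p - 1#

      π∈ : ℤ[ z ] π
      π∈ = sub one gen

      v∈ : ℤ[ z ] v
      v∈ = sub gen one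

      u∈ : ℤ[ z ] u
      u∈ = sub (pow p gen) one

      u≉0 : ¬ u ≈ 0#
      u≉0 u≈0 = z^p≉1 (trans (solve 1 (λ w → w := (w :- con (+ 1)) :+ con (+ 1)) refl (z ^ p))
                             (trans (+-congʳ u≈0) (+-identityˡ 1#)))

      q = p ℕ.∸ 1

      p≡1+q : p ≡ suc q
      p≡1+q = ≡.sym (ℕ.m+[n∸m]≡n (ℕ.≤-trans (s≤s z≤n) 3≤p))

      2≤q : 2 ≤ q
      2≤q = ℕ.∸-monoˡ-≤ 1 3≤p

      1+[x-1]≈x : ∀ x → 1# + (x - 1#) ≈ x
      1+[x-1]≈x = solve 1 (λ x → con (+ 1) :+ (x :- con (+ 1)) := x) refl

      expansion-u : ∃[ y ] (ℤ[ z ] y × p · 1# ≈ - (u ^ q) + (p · 1#) * (u * - y))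
      expansion-u with frobenius p p-prime u
      ... | y , y∈ , eq = y , adjoin-⊆ u∈ y∈ , (begin
        p · 1#
          ≈⟨ solve 4 (λ p u y w → p := (w :+ p :* (con (+ 1) :+ u :* y)) :+ (:- w :+ p :* (u :* :- y))) refl (p · 1#) u y (u ^ q) ⟩
        (u ^ q + p · 1# * (1# + u * y)) + (- (u ^ q) + p · 1# * (u * - y))
          ≈⟨ +-congʳ (*-cancel-0 u*≈0 u≉0) ⟩
        0# + (- (u ^ q) + p · 1# * (u * - y))
          ≈⟨ +-identityˡ _ ⟩
        - (u ^ q) + p · 1# * (u * - y) ∎)
        where
        u*≈0 : u * (u ^ q + p · 1# * (1# + u * y)) ≈ 0#
        u*≈0 = begin
          u * (u ^ q + p · 1# * (1# + u * y))
            ≈⟨ solve 4 (λ p u y w → u :* (w :+ p :* (con (+ 1) :+ u :* y))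
                                 := con (+ 1) :+ u :* w :+ p :* (u :* (con (+ 1) :+ u :* y)) :- con (+ 1))
                 refl (p · 1#) u y (u ^ q) ⟩
          1# + u ^ suc q + p · 1# * (u * (1# + u * y)) - 1#
            ≡⟨ ≡.cong (λ k → 1# + u ^ k + p · 1# * (u * (1# + u * y)) - 1#) p≡1+q ⟨
          1# + u ^ p + p · 1# * (u * (1# + u * y)) - 1#
            ≈⟨ +-congʳ eq ⟨
          (1# + u) ^ p - 1#
            ≈⟨ +-congʳ (trans (^-congˡ p (1+[x-1]≈x (z ^ p))) z^pp≈1) ⟩
          1# - 1#
            ≈⟨ -‿inverseʳ 1# ⟩
          0# ∎

      expansion-v : ∃[ y ] (ℤ[ z ] y × u ≈ v ^ p + (p · 1#) * (v * (1# + v * y)))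
      expansion-v with frobenius p p-prime v
      ... | y , y∈ , eq = y , adjoin-⊆ v∈ y∈ , (begin
        z ^ p - 1# ≈⟨ +-congʳ (^-congˡ p (1+[x-1]≈x z)) ⟨
        (1# + v) ^ p - 1# ≈⟨ +-congʳ eq ⟩
        1# + v ^ p + p · 1# * (v * (1# + v * y)) - 1#
          ≈⟨ solve 2 (λ a b → con (+ 1) :+ a :+ b :- con (+ 1) := a :+ b) refl (v ^ p) (p · 1# * (v * (1# + v * y))) ⟩
        v ^ p + p · 1# * (v * (1# + v * y)) ∎)

      p∈ : ℤ[ z ] (p · 1#)
      p∈ = multiple p one

      π∣v : π divides v
      π∣v = divides-resp (solve 1 (λ z → :- (con (+ 1) :- z) := z :- con (+ 1)) refl z) (divides-neg divides-refl)

      -- Induction on `j` in the relation p = - u^(p - 1) + p u (- y): `g ^ suc j` divides the first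
      -- summand because `suc j ≤ q` and `g` divides `u`, and the second because `g ^ j` divides `p`
      -- and `g` divides `u`.
      divides-p : ∀ {g} → ℤ[ z ] g → g divides u → ∀ j → j ≤ q → g ^ j divides p · 1#
      divides-p g∈ g∣u zero    _   = p · 1# , p∈ , sym (*-identityˡ _)
      divides-p {g} g∈ g∣u (suc j) j<q = divides-resp (sym (proj₂ (proj₂ expansion-u)))
        (divides-+ (divides-neg (^-divides-≤ g∈ j<q (divides-^ q g∣u)))
          (divides-congˡ (*-comm (g ^ j) g)
            (divides-* (divides-p g∈ g∣u j (ℕ.<⇒≤ j<q)) (divides-*ʳ (neg (proj₁ (proj₂ expansion-u))) g∣u))))

      π∣u : π divides u
      π∣u = divides-resp (sym (proj₂ (proj₂ expansion-v)))
        (divides-+ (divides-resp (sym (^-congʳ v p≡1+q)) (divides-*ʳ (pow q v∈) π∣v))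
          (divides-*ˡ p∈ (divides-*ʳ (add one (mul v∈ (proj₁ (proj₂ expansion-v)))) π∣v)))

    [1-z]^p-divides-z^p-1 : π ^ p divides u
    [1-z]^p-divides-z^p-1 = divides-resp (sym (proj₂ (proj₂ expansion-v)))
      (divides-+ (divides-^ p π∣v)
        (divides-congˡ (trans (*-comm _ _) (^-congʳ π (≡.sym p≡1+q)))
          (divides-* (divides-p π∈ π∣u q ℕ.≤-refl) (divides-*ʳ (add one (mul v∈ (proj₁ (proj₂ expansion-v)))) π∣v))))

    -- A second run of `divides-p`, now with g = (1 - z)^p, which has just been shown to divide `u`.
    -- Its second power is allowed since 2 ≤ p - 1, and gives the exponent 2p, which is at least p +
    -- 1.
    [1-z]^[p+1]-divides-p : π ^ (p ℕ.+ 1) divides p · 1#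
    [1-z]^[p+1]-divides-p = ^-divides-≤ π∈ p+1≤p*2
      (divides-congˡ (^-assocʳ π p 2) (divides-p (pow p π∈) [1-z]^p-divides-z^p-1 2 2≤q))
      where
      p+1≤p*2 : p ℕ.+ 1 ≤ p ℕ.* 2
      p+1≤p*2 = ℕ.≤-trans (ℕ.+-monoʳ-≤ p (ℕ.≤-trans (s≤s z≤n) 3≤p)) (ℕ.≤-reflexive (double p))
        where
        double : ∀ p → p ℕ.+ p ≡ p ℕ.* 2
        double = ℕ-solve

-- Conditionals and finite sums in commutative monoids.

if-elim : ∀ {A : Set a} {B : Set b} (Q : B → Set c) (p : Dec A) {x y} →
          (A → Q x) → (¬ A → Q y) → Q (if does p then x else y)
if-elim Q (yes p) qx qy = qx p
if-elim Q (no ¬p) qx qy = qy ¬p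

module Sums (M : CommutativeMonoid c ℓ) where

  open CommutativeMonoid M
  open MonoidSum M

  sum-single : ∀ {n} (t : Fin n → Carrier) i {x} → t i ≈ x → (∀ k → ¬ k ≡ i → t k ≈ ε) → sum t ≈ x
  sum-single {suc n} t i ti≈x t≈ε = trans (sum-remove {i = i} t)
    (trans (∙-cong ti≈x (trans (sum-cong-≋ (λ k → t≈ε (punchIn i k) (Fin.punchInᵢ≢i i k))) (sum-replicate-zero n)))
           (identityʳ _))

  sum-split : ∀ m n (f : ℕ → Carrier) → sum {m ℕ.+ n} (λ k → f (toℕ k)) ≈ sum {m} (λ k → f (toℕ k)) ∙ sum {n} (λ k → f (m ℕ.+ toℕ k))
  sum-split zero    n f = sym (identityˡ _)
  sum-split (suc m) n f = trans (∙-congˡ (sum-split m n (f ∘ suc))) (sym (assoc _ _ _))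

  -- The definition of rangeSum truncates n + 1 - m, so m ≤ n + 1 is needed here.
  rangeSum-snoc : ∀ m n (f : ℕ → Carrier) → m ≤ suc n → rangeSum M m (suc n) f ≈ rangeSum M m n f ∙ f (suc n)
  rangeSum-snoc m n f m≤1+n = trans (reflexive (≡.cong (λ k → sum {k} (λ i → f (m ℕ.+ toℕ i))) length≡))
    (trans (sum-split (suc n ℕ.∸ m) 1 (λ k → f (m ℕ.+ k)))
      (∙-congˡ (trans (identityʳ _) (reflexive (≡.cong f
        (≡.trans (≡.cong (m ℕ.+_) (ℕ.+-identityʳ _)) (ℕ.m+[n∸m]≡n m≤1+n)))))))
    where
    length≡ : suc (suc n) ℕ.∸ m ≡ suc n ℕ.∸ m ℕ.+ 1
    length≡ = ≡.trans (ℕ.+-∸-assoc 1 m≤1+n) (ℕ.+-comm 1 _)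

  sum≈rangeSum : ∀ m n (f : ℕ → Carrier) → m ≤ suc n → sum {suc n} (λ k → f (toℕ k)) ≈ sum {m} (λ k → f (toℕ k)) ∙ rangeSum M m n f
  sum≈rangeSum m n f m≤1+n = trans (reflexive (≡.cong (λ k → sum {k} (λ i → f (toℕ i))) (≡.sym (ℕ.m+[n∸m]≡n m≤1+n))))
    (sum-split m (suc n ℕ.∸ m) f)

module SumHomomorphism (M : CommutativeMonoid a ℓ₁) (M′ : CommutativeMonoid b ℓ₂) where

  private
    module M = CommutativeMonoid M
    module M′ = CommutativeMonoid M′

  sum-homo : (⟦_⟧ : M.Carrier → M′.Carrier) → ⟦ M.ε ⟧ M′.≈ M′.ε → (∀ x y → ⟦ x M.∙ y ⟧ M′.≈ ⟦ x ⟧ M′.∙ ⟦ y ⟧) →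
             ∀ {n} (t : Fin n → M.Carrier) → ⟦ MonoidSum.sum M t ⟧ M′.≈ MonoidSum.sum M′ (λ k → ⟦ t k ⟧)
  sum-homo ⟦_⟧ ε-homo ∙-homo {zero}  t = ε-homo
  sum-homo ⟦_⟧ ε-homo ∙-homo {suc n} t =
    M′.trans (∙-homo (t zero) _) (M′.∙-congˡ (sum-homo ⟦_⟧ ε-homo ∙-homo (t ∘ suc)))

-- Finite fields: inverses and sums over all elements.

module FiniteFields (F : FiniteField a ℓ₁ ℓ₂) where

  open FiniteField F hiding (zero) public
  open Inverse enum public using () renaming (to to element; from to index)
  open Domains heytingField public using (*-cancel-0; *-cancelˡ)
  open Powers (fieldRing heytingField) public using (^-congʳ; ^-homo-*; ^-assocʳ; ^-+*e)
  open IntegerMultiples (fieldRing heytingField) public using (solve; _:=_; _:+_; _:*_; _:-_; :-_; _:^_; con)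
  open RingProperties ring public using (-0#≈0#; -‿involutive; -1*x≈-x)
  private
    module H = HeytingField heytingField
    module HP = HeytingProperties H.heytingCommutativeRing
    module S = SetoidReasoning setoid

  element-index : ∀ x → element (index x) ≈ x
  element-index = Inverse.strictlyInverseˡ enum

  index-element : ∀ k → index (element k) ≡ k
  index-element = Inverse.strictlyInverseʳ enum

  index-cong : ∀ {x y} → x ≈ y → index x ≡ index y
  index-cong = Inverse.from-cong enum

  #0⇒≉0 : ∀ {x} → x # 0# → ¬ x ≈ 0#
  #0⇒≉0 {x} x#0 x≈0 = proj₂ (H.tight x 0#) x≈0 x#0

  1≉0 : ¬ 1# ≈ 0#
  1≉0 = #0⇒≉0 HP.1#0

  x*y≈1⇒#0 : ∀ {x y} → x * y ≈ 1# → x # 0#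
  x*y≈1⇒#0 {x} {y} xy≈1 = HP.invertibleʳ⇒# (y , trans (*-congʳ (trans (+-congˡ -0#≈0#) (+-identityʳ x))) xy≈1)

  private
    -- Apartness need not be decidable in a Heyting field, but finiteness turns the existence of an
    -- inverse into a finite search; this makes inversion a total function.
    hasInverse? : ∀ x → Dec (∃[ k ] x * element k ≈ 1#)
    hasInverse? x = Fin.any? (λ k → (x * element k) ≟ 1#)

  infix 9 _⁻¹

  -- 0⁻¹ is 0, which makes _⁻¹ an involution of the whole field.
  _⁻¹ : Carrier → Carrier
  x ⁻¹ with hasInverse? x
  ... | yes (k , _) = element k
  ... | no  _       = 0#

  *-inverse : ∀ {x} → ¬ x ≈ 0# → x * x ⁻¹ ≈ 1#
  *-inverse {x} x≉0 with hasInverse? x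
  ... | yes (k , xk≈1) = xk≈1
  ... | no  ¬inverse   = contradiction (proj₁ (H.tight x 0#) not-apart) x≉0
    where
    not-apart : ¬ x # 0#
    not-apart x#0 with y , _ , xy≈1 ← H.#⇒invertible x#0 = ¬inverse (index y , (S.begin
      x * element (index y) S.≈⟨ *-congˡ (element-index y) ⟩
      x * y S.≈⟨ *-congʳ (trans (+-congˡ -0#≈0#) (+-identityʳ x)) ⟨
      (x - 0#) * y S.≈⟨ xy≈1 ⟩
      1# S.∎))

  ≉0⇒#0 : ∀ {x} → ¬ x ≈ 0# → x # 0#
  ≉0⇒#0 x≉0 = x*y≈1⇒#0 (*-inverse x≉0)

  *-≉0 : ∀ {x y} → ¬ x ≈ 0# → ¬ y ≈ 0# → ¬ x * y ≈ 0#
  *-≉0 x≉0 y≉0 xy≈0 = y≉0 (*-cancel-0 xy≈0 x≉0)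

  ^-≉0 : ∀ {x} n → ¬ x ≈ 0# → ¬ x ^ n ≈ 0#
  ^-≉0 zero    x≉0 = 1≉0
  ^-≉0 (suc n) x≉0 = *-≉0 x≉0 (^-≉0 n x≉0)

  -1# : Carrier
  -1# = - 1#

  -1≉0 : ¬ -1# ≈ 0#
  -1≉0 -1≈0 = 1≉0 (trans (sym (-‿involutive 1#)) (trans (-‿cong -1≈0) -0#≈0#))

  ⁻¹-zero : ∀ {x} → x ≈ 0# → x ⁻¹ ≈ 0#
  ⁻¹-zero {x} x≈0 with hasInverse? x
  ... | yes (k , xk≈1) = contradiction (trans (sym xk≈1) (trans (*-congʳ x≈0) (zeroˡ _))) 1≉0
  ... | no  _          = refl

  ⁻¹-unique : ∀ {x y} → x * y ≈ 1# → x ⁻¹ ≈ y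
  ⁻¹-unique {x} {y} xy≈1 = *-cancelˡ x≉0 (trans (*-inverse x≉0) (sym xy≈1))
    where
    x≉0 : ¬ x ≈ 0#
    x≉0 = #0⇒≉0 (x*y≈1⇒#0 xy≈1)

  ⁻¹-cong : ∀ {x y} → x ≈ y → x ⁻¹ ≈ y ⁻¹
  ⁻¹-cong {x} {y} x≈y with y ≟ 0#
  ... | yes y≈0 = trans (⁻¹-zero (trans x≈y y≈0)) (sym (⁻¹-zero y≈0))
  ... | no  y≉0 = ⁻¹-unique (trans (*-congʳ x≈y) (*-inverse y≉0))

  ⁻¹-≉0 : ∀ {x} → ¬ x ≈ 0# → ¬ x ⁻¹ ≈ 0#
  ⁻¹-≉0 {x} x≉0 x⁻¹≈0 = 1≉0 (trans (sym (*-inverse x≉0)) (trans (*-congˡ x⁻¹≈0) (zeroʳ x)))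

  ⁻¹-involutive : ∀ x → (x ⁻¹) ⁻¹ ≈ x
  ⁻¹-involutive x with x ≟ 0#
  ... | yes x≈0 = trans (⁻¹-zero (⁻¹-zero x≈0)) (sym x≈0)
  ... | no  x≉0 = ⁻¹-unique (trans (*-comm _ _) (*-inverse x≉0))

  module Summation (M : CommutativeMonoid c ℓ) where

    private module M = CommutativeMonoid M
    open CommutativeMonoid M using () renaming (Carrier to A; _≈_ to _≈ᴹ_; ε to ε)
    open MonoidSum M using (sum; sum-permute; sum-cong-≋; sum-replicate-zero)

    ∑ : (Carrier → A) → A
    ∑ = ∑F M

    ∑-cong : ∀ {f g : Carrier → A} → (∀ v → f v ≈ᴹ g v) → ∑ f ≈ᴹ ∑ g
    ∑-cong f≈g = sum-cong-≋ (λ k → f≈g (element k))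

    ∑-zero : ∀ {f : Carrier → A} → (∀ v → f v ≈ᴹ ε) → ∑ f ≈ᴹ ε
    ∑-zero f≈0 = M.trans (∑-cong f≈0) (sum-replicate-zero order)

    module _ {f : Carrier → A} (f-cong : ∀ {x y} → x ≈ y → f x ≈ᴹ f y) where

      ∑-substitute : (φ ψ : Carrier → Carrier) → (∀ {x y} → x ≈ y → φ x ≈ φ y) → (∀ {x y} → x ≈ y → ψ x ≈ ψ y) →
                     (∀ x → φ (ψ x) ≈ x) → (∀ x → ψ (φ x) ≈ x) → ∑ f ≈ᴹ ∑ (λ v → f (φ v))
      ∑-substitute φ ψ φ-cong ψ-cong φψ ψφ = M.trans
        (sum-permute (λ k → f (element k)) (permutation (conjugate φ) (conjugate ψ) (cancel φ ψ φ-cong φψ) (cancel ψ φ ψ-cong ψφ)))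
        (sum-cong-≋ (λ k → f-cong (element-index (φ (element k)))))
        where
        conjugate : (Carrier → Carrier) → Fin order → Fin order
        conjugate φ k = index (φ (element k))

        cancel : ∀ (φ ψ : Carrier → Carrier) → (∀ {x y} → x ≈ y → φ x ≈ φ y) → (∀ x → φ (ψ x) ≈ x) →
                 ∀ k → conjugate φ (conjugate ψ k) ≡ k
        cancel φ ψ φ-cong φψ k = ≡.trans (index-cong (trans (φ-cong (element-index _)) (φψ (element k)))) (index-element k)

      ∑-enumerate : ∀ {n} (to : Fin n → Carrier) (from : Carrier → Fin n) → (∀ {x y} → x ≈ y → from x ≡ from y) →
                    (∀ x → to (from x) ≈ x) → (∀ k → from (to k) ≡ k) → ∑ f ≈ᴹ sum (λ k → f (to k))
      ∑-enumerate to from from-cong to-from from-to = M.trans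
        (sum-permute (λ k → f (element k)) (permutation (λ k → index (to k)) (λ k → from (element k))
          (λ k → ≡.trans (index-cong (to-from (element k))) (index-element k))
          (λ k → ≡.trans (from-cong (element-index (to k))) (from-to k))))
        (sum-cong-≋ (λ k → f-cong (element-index (to k))))

      ∑-single : ∀ a → (∀ v → ¬ v ≈ a → f v ≈ᴹ ε) → ∑ f ≈ᴹ f a
      ∑-single a f≈0 = Sums.sum-single M (λ k → f (element k)) (index a) (f-cong (element-index a))
        (λ k k≢ → f≈0 (element k) (λ k≈a → k≢ (≡.trans (≡.sym (index-element k)) (index-cong k≈a))))

  module RingSummation (R : CommutativeRing c ℓ) where

    private module R = CommutativeRing R
    open CommutativeRing R using () renaming (Carrier to A; _≈_ to _≈ᴿ_; _+_ to _+ᴿ_; _*_ to _*ᴿ_)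
    open Summation R.+-commutativeMonoid public
    private module RS = Sum R.semiring

    ∑-+ : ∀ (f g : Carrier → A) → ∑ (λ v → f v +ᴿ g v) ≈ᴿ ∑ f +ᴿ ∑ g
    ∑-+ f g = RS.∑-distrib-+ {order} (f ∘ element) (g ∘ element)

    ∑-*ˡ : ∀ x (f : Carrier → A) → ∑ (λ v → x *ᴿ f v) ≈ᴿ x *ᴿ ∑ f
    ∑-*ˡ x f = R.sym (RS.*-distribˡ-sum {order} x (f ∘ element))

    ∑-*ʳ : ∀ (f : Carrier → A) x → ∑ (λ v → f v *ᴿ x) ≈ᴿ ∑ f *ᴿ x
    ∑-*ʳ f x = R.sym (RS.*-distribʳ-sum {order} x (f ∘ element))

    ∑-sum : ∀ {n} (f : Carrier → Fin n → A) → ∑ (λ v → RS.sum (f v)) ≈ᴿ RS.sum (λ i → ∑ (λ v → f v i))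
    ∑-sum {n} f = RS.∑-comm {order} {n} (f ∘ element)

    ∑-∑-comm : ∀ (f : Carrier → Carrier → A) → ∑ (λ v → ∑ (λ w → f v w)) ≈ᴿ ∑ (λ w → ∑ (λ v → f v w))
    ∑-∑-comm f = RS.∑-comm {order} {order} (λ i j → f (element i) (element j))

  -- The cyclic group of units and its discrete logarithm.

  module _ {γ : Carrier} (generates : IsGenerator γ) where

    private
      γ≉0 : ¬ γ ≈ 0#
      γ≉0 = #0⇒≉0 (proj₁ generates)

      cancel-power : ∀ i k → γ ^ i ≈ γ ^ (i ℕ.+ k) → γ ^ k ≈ 1#
      cancel-power i k eq = *-cancelˡ (^-≉0 i γ≉0) (trans (sym (^-homo-* γ i k)) (trans (sym eq) (sym (*-identityʳ _))))

      least : ∀ n → 0 < n → γ ^ n ≈ 1# → ∃[ d ] (0 < d × γ ^ d ≈ 1# × (∀ k → 0 < k → k < d → ¬ γ ^ k ≈ 1#))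
      least = <-rec _ λ n rec 0<n γ^n≈1 → decide n rec 0<n γ^n≈1 (ℕ.anyUpTo? (λ k → 0 ℕ.<? k ×-dec ((γ ^ k) ≟ 1#)) n)
        where
        decide : ∀ n → (∀ {m} → m < n → 0 < m → γ ^ m ≈ 1# → ∃[ d ] (0 < d × γ ^ d ≈ 1# × (∀ k → 0 < k → k < d → ¬ γ ^ k ≈ 1#))) →
                 0 < n → γ ^ n ≈ 1# → Dec (∃[ k ] (k < n × 0 < k × γ ^ k ≈ 1#)) →
                 ∃[ d ] (0 < d × γ ^ d ≈ 1# × (∀ k → 0 < k → k < d → ¬ γ ^ k ≈ 1#))
        decide n rec _   _     (yes (k , k<n , 0<k , γ^k≈1)) = rec k<n 0<k γ^k≈1
        decide n rec 0<n γ^n≈1 (no ¬smaller) = n , 0<n , γ^n≈1 , λ k 0<k k<n γ^k≈1 → ¬smaller (k , k<n , 0<k , γ^k≈1)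

      abstract
        -- Two of the powers γ⁰, …, γ^order coincide.
        γ-order : ∃[ d ] (0 < d × γ ^ d ≈ 1# × (∀ k → 0 < k → k < d → ¬ γ ^ k ≈ 1#))
        γ-order with i , j , i<j , eq ← Fin.pigeonhole (ℕ.n<1+n order) (λ k → index (γ ^ toℕ k)) =
          least (toℕ j ℕ.∸ toℕ i) (ℕ.m<n⇒0<n∸m i<j) (cancel-power (toℕ i) _ (begin
            γ ^ toℕ i ≈⟨ element-index _ ⟨
            element (index (γ ^ toℕ i)) ≡⟨ ≡.cong element eq ⟩
            element (index (γ ^ toℕ j)) ≈⟨ element-index _ ⟩
            γ ^ toℕ j ≡⟨ ≡.cong (γ ^_) (ℕ.m+[n∸m]≡n (ℕ.<⇒≤ i<j)) ⟨
            γ ^ (toℕ i ℕ.+ (toℕ j ℕ.∸ toℕ i)) ∎))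
          where open S

      d = proj₁ γ-order

      0<d : 0 < d
      0<d = proj₁ (proj₂ γ-order)

      γ^d≈1 : γ ^ d ≈ 1#
      γ^d≈1 = proj₁ (proj₂ (proj₂ γ-order))

      instance
        d≢0 : NonZero d
        d≢0 = ℕ.>-nonZero 0<d

      γ^[k%d] : ∀ k → γ ^ (k ℕ.% d) ≈ γ ^ k
      γ^[k%d] k = trans (sym (^-+*e d γ^d≈1 (k ℕ.% d) (k ℕ./ d))) (^-congʳ γ (≡.sym (ℕ.m≡m%n+[m/n]*n k d)))

      γ^≈1⇒∣ : ∀ k → γ ^ k ≈ 1# → d ∣ k
      γ^≈1⇒∣ k γ^k≈1 with k ℕ.% d ℕ.≟ 0
      ... | yes k%d≡0 = ℕ∣.m%n≡0⇒n∣m k d k%d≡0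
      ... | no  k%d≢0 = contradiction (trans (γ^[k%d] k) γ^k≈1)
        (proj₂ (proj₂ (proj₂ γ-order)) (k ℕ.% d) (ℕ.n≢0⇒n>0 k%d≢0) (ℕ.m%n<n k d))

      ^-injective-< : ∀ {i j} → i < j → j < d → ¬ γ ^ i ≈ γ ^ j
      ^-injective-< {i} {j} i<j j<d eq = proj₂ (proj₂ (proj₂ γ-order)) (j ℕ.∸ i) (ℕ.m<n⇒0<n∸m i<j)
        (ℕ.≤-<-trans (ℕ.m∸n≤m j i) j<d)
        (cancel-power i _ (trans eq (^-congʳ γ (≡.sym (ℕ.m+[n∸m]≡n (ℕ.<⇒≤ i<j))))))

      ^-injective : ∀ {i j} → i < d → j < d → γ ^ i ≈ γ ^ j → i ≡ j
      ^-injective {i} {j} i<d j<d eq with ℕ.<-cmp i j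
      ... | tri< i<j _ _ = contradiction eq (^-injective-< i<j j<d)
      ... | tri≈ _ i≡j _ = i≡j
      ... | tri> _ _ j<i = contradiction (sym eq) (^-injective-< j<i i<d)

      -- With `logarithm` as its inverse, a second enumeration of the field: 0 followed by the
      -- powers of γ. Compared with `enum` it gives `order ≡ suc d`, and it turns sums over the
      -- field into sums over exponents.
      power : Fin (suc d) → Carrier
      power zero    = 0#
      power (suc i) = γ ^ toℕ i

      logarithm : Carrier → Fin (suc d)
      logarithm x with x ≟ 0#
      ... | yes _   = zero
      ... | no  x≉0 = suc (fromℕ< (ℕ.m%n<n (proj₁ (proj₂ generates x (≉0⇒#0 x≉0))) d))

      power-injective : ∀ {i j} → power i ≈ power j → i ≡ j
      power-injective {zero}  {zero}  _  = ≡.refl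
      power-injective {zero}  {suc j} eq = contradiction (sym eq) (^-≉0 (toℕ j) γ≉0)
      power-injective {suc i} {zero}  eq = contradiction eq (^-≉0 (toℕ i) γ≉0)
      power-injective {suc i} {suc j} eq = ≡.cong suc (Fin.toℕ-injective (^-injective (Fin.toℕ<n i) (Fin.toℕ<n j) eq))

      power-logarithm : ∀ x → power (logarithm x) ≈ x
      power-logarithm x with x ≟ 0#
      ... | yes x≈0 = sym x≈0
      ... | no  x≉0 with k , γ^k≈x ← proj₂ generates x (≉0⇒#0 x≉0) =
        trans (^-congʳ γ (Fin.toℕ-fromℕ< (ℕ.m%n<n k d))) (trans (γ^[k%d] k) γ^k≈x)

      logarithm-power : ∀ k → logarithm (power k) ≡ k
      logarithm-power k = power-injective (power-logarithm (power k))

      logarithm-cong : ∀ {x y} → x ≈ y → logarithm x ≡ logarithm y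
      logarithm-cong x≈y = power-injective (trans (power-logarithm _) (trans x≈y (sym (power-logarithm _))))

      order≡1+d : order ≡ suc d
      order≡1+d = ↔⇒≡ (permutation (λ k → logarithm (element k)) (λ k → index (power k))
        (λ k → ≡.trans (logarithm-cong (element-index (power k))) (logarithm-power k))
        (λ k → ≡.trans (index-cong (power-logarithm (element k))) (index-element k)))

      order-1≡d : order ℕ.∸ 1 ≡ d
      order-1≡d = ≡.cong (ℕ._∸ 1) order≡1+d

    0<order-1 : 0 < order ℕ.∸ 1
    0<order-1 = ≡.subst (0 <_) (≡.sym order-1≡d) 0<d

    order≡1+[order-1] : order ≡ suc (order ℕ.∸ 1)
    order≡1+[order-1] = ≡.trans order≡1+d (≡.cong suc (≡.sym order-1≡d))

    γ^[order-1]≈1 : γ ^ (order ℕ.∸ 1) ≈ 1#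
    γ^[order-1]≈1 = trans (^-congʳ γ order-1≡d) γ^d≈1

    γ^k≈1⇒order-1∣k : ∀ k → γ ^ k ≈ 1# → order ℕ.∸ 1 ∣ k
    γ^k≈1⇒order-1∣k k γ^k≈1 = ≡.subst (_∣ k) (≡.sym order-1≡d) (γ^≈1⇒∣ k γ^k≈1)

    generator-≉0 : ¬ γ ≈ 0#
    generator-≉0 = γ≉0

    module _ (M : CommutativeMonoid c ℓ) where

      private module M = CommutativeMonoid M
      open Summation M
      open MonoidSum M using (sum)

      ∑-powers : ∀ {f : Carrier → M.Carrier} → (∀ {x y} → x ≈ y → f x M.≈ f y) →
                 ∑ f M.≈ f 0# M.∙ sum {order ℕ.∸ 1} (λ k → f (γ ^ toℕ k))
      ∑-powers {f} f-cong = ≡.subst (λ n → ∑ f M.≈ f 0# M.∙ sum {n} (λ k → f (γ ^ toℕ k))) (≡.sym order-1≡d)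
        (∑-enumerate f-cong power logarithm logarithm-cong power-logarithm logarithm-power)

  data LeastPower (γ x : Carrier) (fuel start : ℕ) : ℕ → Set ℓ₁ where
    found : ∀ {s} → s < start ℕ.+ fuel → γ ^ s ≈ x → LeastPower γ x fuel start s
    none  : ∀ {s} → s ≡ start ℕ.+ fuel → (∀ k → start ≤ k → k < start ℕ.+ fuel → ¬ γ ^ k ≈ x) → LeastPower γ x fuel start s

  private
    -- The loop in `ind` is local and cannot be named from outside, so the claim is made for every
    -- function obeying the same two recursion equations.
    search-correct : ∀ γ x (search : ℕ → ℕ → ℕ) → (∀ s → search zero s ≡ s) →
                     (∀ n s → search (suc n) s ≡ (if does ((γ ^ s) ≟ x) then s else search n (suc s))) →
                     ∀ n s → LeastPower γ x n s (search n s)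
    search-correct γ x search base step zero    s = none (≡.trans (base s) (≡.sym (ℕ.+-identityʳ s))) λ k s≤k k<s → contradiction (≡.subst (k <_) (ℕ.+-identityʳ s) k<s) (ℕ.≤⇒≯ s≤k)
    search-correct γ x search base step (suc n) s = ≡.subst (LeastPower γ x (suc n) s) (≡.sym (step n s)) this
      where
      this : LeastPower γ x (suc n) s (if does ((γ ^ s) ≟ x) then s else search n (suc s))
      this = if-elim (LeastPower γ x (suc n) s) ((γ ^ s) ≟ x)
        (found (ℕ.m<m+n s (s≤s z≤n)))
        (λ γ^s≉x → extend γ^s≉x (search-correct γ x search base step n (suc s)))
        where
        extend : ¬ γ ^ s ≈ x → ∀ {t} → LeastPower γ x n (suc s) t → LeastPower γ x (suc n) s t
        extend γ^s≉x {t} (found y< γ^y≈x) = found (≡.subst (t <_) (≡.sym (ℕ.+-suc s n)) y<) γ^y≈x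
        extend γ^s≉x (none y≡ ¬found) = none (≡.trans y≡ (≡.sym (ℕ.+-suc s n))) λ k s≤k k< → later k (ℕ.m≤n⇒m<n∨m≡n s≤k) k<
          where
          later : ∀ k → s < k ⊎ s ≡ k → k < s ℕ.+ suc n → ¬ γ ^ k ≈ x
          later k (inj₁ s<k)    k< = ¬found k s<k (≡.subst (k <_) (ℕ.+-suc s n) k<)
          later k (inj₂ ≡.refl) k< = γ^s≉x

  ind-leastPower : ∀ γ x → LeastPower γ x (order ℕ.∸ 1) 0 (ind γ x)
  -- Abstracting fuel and start to variables lets unification find the local loop for the
  -- underscore.
  ind-leastPower γ x with search-correct γ x _ (λ _ → ≡.refl) (λ _ _ → ≡.refl) | order ℕ.∸ 1 | 0
  ... | correct | n | s = correct n s

  module _ {γ : Carrier} (generates : IsGenerator γ) where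

    γ^ind≈ : ∀ {x} → ¬ x ≈ 0# → γ ^ ind γ x ≈ x
    γ^ind≈ {x} x≉0 with ind γ x | ind-leastPower γ x
    ... | _ | found _ γ^ind≈x = γ^ind≈x
    -- Some power of γ is `x`; its exponent reduced modulo `order ∸ 1` lies in the range that was
    -- searched.
    ... | _ | none _ ¬found   = contradiction (trans γ^[k%n]≈γ^k (proj₂ power)) (¬found (k ℕ.% n) z≤n (ℕ.m%n<n k n))
      where
      power = proj₂ generates x (≉0⇒#0 x≉0)
      k = proj₁ power
      n = order ℕ.∸ 1
      instance
        n≢0 : NonZero n
        n≢0 = ℕ.>-nonZero (0<order-1 generates)
      γ^[k%n]≈γ^k : γ ^ (k ℕ.% n) ≈ γ ^ k
      γ^[k%n]≈γ^k = trans (sym (^-+*e n (γ^[order-1]≈1 generates) (k ℕ.% n) (k ℕ./ n))) (^-congʳ γ (≡.sym (ℕ.m≡m%n+[m/n]*n k n)))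

    ind-0 : ∀ {x} → x ≈ 0# → ind γ x ≡ order ℕ.∸ 1
    ind-0 {x} x≈0 with ind γ x | ind-leastPower γ x
    ... | k | found _ γ^k≈x = contradiction (trans γ^k≈x x≈0) (^-≉0 k (generator-≉0 generates))
    ... | _ | none s≡ _     = s≡

-- Character sums with values in a ring where l = 0.

module Expansion (F : FiniteField a ℓ₁ ℓ₂) {γ : FiniteField.Carrier F} (generates : FiniteField.IsGenerator F γ)
                 (l : ℕ) .{{_ : NonZero l}} (l-prime : Prime l) (3≤l : 3 ≤ l) (l*l∣order-1 : l ℕ.* l ∣ FiniteField.order F ℕ.∸ 1)
                 (R : CommutativeRing c ℓ) (l≈0 : CommutativeRing._≈_ R (Mult._×_ (CommutativeRing.semiring R) l (CommutativeRing.1# R)) (CommutativeRing.0# R))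
                 where

  private
    module F = FiniteFields F
  open FiniteField F using (order; ind) renaming (Carrier to 𝔽)
  open Coefficients l F γ
  open CommutativeRing R hiding (zero)
  open RingNotions R
  open IntegerMultiples R
  open Powers R
  open BinomialSums R
  open Mult semiring using (×-homo-+; ×1-homo-*; ×-assoc-*; ×-congˡ; ×-congʳ; ×-homo-1) renaming (_×_ to _·_)
  open Sum semiring using (sum; sum-cong-≋; sum-replicate; sum-replicate-zero)
  open FiniteFields.RingSummation F R
  open SetoidReasoning setoid

  range : ℕ → ℕ → (ℕ → Carrier) → Carrier
  range = rangeSum +-commutativeMonoid

  multiple≈0 : ∀ {n} → l ∣ n → ∀ x → n · x ≈ 0#
  multiple≈0 {n} l∣n x = begin
    n · x ≈⟨ ×-congʳ n (*-identityˡ x) ⟨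
    n · (1# * x) ≈⟨ ×-assoc-* n 1# x ⟨
    n · 1# * x ≈⟨ *-congʳ (×-congˡ (ℕ∣.m∣n⇒n≡m*quotient l∣n)) ⟩
    (l ℕ.* ℕ∣.quotient l∣n) · 1# * x ≈⟨ *-congʳ (×1-homo-* l _) ⟩
    l · 1# * (ℕ∣.quotient l∣n · 1#) * x ≈⟨ *-congʳ (*-congʳ l≈0) ⟩
    0# * (ℕ∣.quotient l∣n · 1#) * x ≈⟨ solve 2 (λ y x → con (+ 0) :* y :* x := con (+ 0)) refl _ x ⟩
    0# ∎

  l∣order-1 : l ∣ order ℕ.∸ 1
  l∣order-1 = ℕ∣.∣-trans (ℕ∣.m∣m*n l) l*l∣order-1

  order·1≈1 : order · 1# ≈ 1#
  order·1≈1 = begin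
    order · 1# ≈⟨ ×-congˡ (F.order≡1+[order-1] generates) ⟩
    1# + (order ℕ.∸ 1) · 1# ≈⟨ +-congˡ (multiple≈0 l∣order-1 1#) ⟩
    1# + 0# ≈⟨ +-identityʳ 1# ⟩
    1# ∎

  -- As `l` is odd, l x = x + (l / 2)(x + x), and l x = 0.
  half : ∀ {x} → x + x ≈ 0# → x ≈ 0#
  half {x} x+x≈0 = begin
    x ≈⟨ +-identityʳ x ⟨
    x + 0# ≈⟨ +-congˡ (zero-multiple (l ℕ./ 2)) ⟨
    x + (l ℕ./ 2) · (x + x) ≈⟨ +-congˡ (double (l ℕ./ 2)) ⟩
    suc (l ℕ./ 2 ℕ.* 2) · x ≡⟨ ≡.cong (_· x) l≡1+2k ⟨
    l · x ≈⟨ multiple≈0 ℕ∣.∣-refl x ⟩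
    0# ∎
    where
    zero-multiple : ∀ k → k · (x + x) ≈ 0#
    zero-multiple zero    = refl
    zero-multiple (suc k) = trans (+-cong x+x≈0 (zero-multiple k)) (+-identityˡ 0#)

    double : ∀ k → k · (x + x) ≈ (k ℕ.* 2) · x
    double zero    = refl
    double (suc k) = trans (+-congˡ (double k)) (+-assoc x x _)

    l≡1+2k : l ≡ suc (l ℕ./ 2 ℕ.* 2)
    l≡1+2k = odd≡1+2* (prime-odd l-prime 3≤l)

  -- The index, as a homomorphism from the unit group of 𝔽 to the additive group of R.
  L : 𝔽 → Carrier
  L v = ind γ v · 1#

  private
    power-injective-≤ : ∀ {i j} → i ≤ j → γ F.^ i F.≈ γ F.^ j → i · 1# ≈ j · 1#
    power-injective-≤ {i} {j} i≤j eq = begin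
      i · 1# ≈⟨ +-identityʳ _ ⟨
      i · 1# + 0# ≈⟨ +-congˡ (multiple≈0 (ℕ∣.∣-trans l∣order-1 (F.γ^k≈1⇒order-1∣k generates (j ℕ.∸ i) γ^[j-i]≈1)) 1#) ⟨
      i · 1# + (j ℕ.∸ i) · 1# ≈⟨ ×-homo-+ 1# i (j ℕ.∸ i) ⟨
      (i ℕ.+ (j ℕ.∸ i)) · 1# ≡⟨ ≡.cong (_· 1#) (ℕ.m+[n∸m]≡n i≤j) ⟩
      j · 1# ∎
      where
      γ^[j-i]≈1 : γ F.^ (j ℕ.∸ i) F.≈ F.1#
      γ^[j-i]≈1 = F.*-cancelˡ (F.^-≉0 i (F.generator-≉0 generates)) (F.trans (F.sym (F.^-homo-* γ i (j ℕ.∸ i)))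
        (F.trans (F.^-congʳ γ (ℕ.m+[n∸m]≡n i≤j)) (F.trans (F.sym eq) (F.sym (F.*-identityʳ _)))))

  -- Exponents of the same power of γ differ by a multiple of `order ∸ 1`, hence of `l`.
  power-injective : ∀ i j → γ F.^ i F.≈ γ F.^ j → i · 1# ≈ j · 1#
  power-injective i j eq with ℕ.≤-total i j
  ... | inj₁ i≤j = power-injective-≤ i≤j eq
  ... | inj₂ j≤i = sym (power-injective-≤ j≤i (F.sym eq))

  -- The default value q - 1 of `ind` at 0 is a multiple of `l`, so `L` is extended to 0 by the
  -- value 0.
  L-0 : ∀ {v} → v F.≈ F.0# → L v ≈ 0#
  L-0 v≈0 = trans (×-congˡ (F.ind-0 generates v≈0)) (multiple≈0 l∣order-1 1#)

  L-power : ∀ {v} k → γ F.^ k F.≈ v → L v ≈ k · 1#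
  L-power {v} k γ^k≈v = power-injective (ind γ v) k (F.trans (F.γ^ind≈ generates v≉0) (F.sym γ^k≈v))
    where
    v≉0 : ¬ v F.≈ F.0#
    v≉0 v≈0 = F.^-≉0 k (F.generator-≉0 generates) (F.trans γ^k≈v v≈0)

  L-cong : ∀ {v w} → v F.≈ w → L v ≈ L w
  L-cong {v} {w} v≈w with w F.≟ F.0#
  ... | yes w≈0 = trans (L-0 (F.trans v≈w w≈0)) (sym (L-0 w≈0))
  ... | no  w≉0 = L-power (ind γ w) (F.trans (F.γ^ind≈ generates w≉0) (F.sym v≈w))

  L-* : ∀ {v w} → ¬ v F.≈ F.0# → ¬ w F.≈ F.0# → L (v F.* w) ≈ L v + L w
  L-* {v} {w} v≉0 w≉0 = trans
    (L-power (ind γ v ℕ.+ ind γ w) (F.trans (F.^-homo-* γ (ind γ v) (ind γ w)) (F.*-cong (F.γ^ind≈ generates v≉0) (F.γ^ind≈ generates w≉0))))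
    (×-homo-+ 1# (ind γ v) (ind γ w))

  L-1 : ∀ {v} → v F.≈ F.1# → L v ≈ 0#
  L-1 v≈1 = L-power 0 (F.sym v≈1)

  L-[-1] : L F.-1# ≈ 0#
  L-[-1] = half (trans (sym (L-* F.-1≉0 F.-1≉0)) (L-1 (F.solve 0 (F.:- F.con (+ 1) F.:* F.:- F.con (+ 1) F.:= F.con (+ 1)) F.refl)))

  L-neg : ∀ {v} → ¬ v F.≈ F.0# → L (F.- v) ≈ L v
  L-neg {v} v≉0 = begin
    L (F.- v) ≈⟨ L-cong (F.sym (F.-1*x≈-x v)) ⟩
    L (F.- F.1# F.* v) ≈⟨ L-* F.-1≉0 v≉0 ⟩
    L F.-1# + L v ≈⟨ +-congʳ L-[-1] ⟩
    0# + L v ≈⟨ +-identityˡ _ ⟩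
    L v ∎

  L-⁻¹ : ∀ {v} → ¬ v F.≈ F.0# → L (v F.⁻¹) ≈ - L v
  L-⁻¹ {v} v≉0 = begin
    L (v F.⁻¹) ≈⟨ solve 2 (λ x y → y := (x :+ y) :- x) refl (L v) (L (v F.⁻¹)) ⟩
    (L v + L (v F.⁻¹)) - L v ≈⟨ +-congʳ (L-* v≉0 (F.⁻¹-≉0 v≉0)) ⟨
    L (v F.* v F.⁻¹) - L v ≈⟨ +-congʳ (L-1 (F.*-inverse v≉0)) ⟩
    0# - L v ≈⟨ +-identityˡ _ ⟩
    - L v ∎

  Admissible : 𝔽 → Set ℓ₁
  Admissible v = ¬ v F.≈ F.0# × ¬ v F.≈ F.- F.1#

  ∑ᵃ : (𝔽 → Carrier) → Carrier
  ∑ᵃ g = ∑ (λ v → if does (admissible? v) then g v else 0#)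

  ∑ᵃ-cong : ∀ {g h : 𝔽 → Carrier} → (∀ v → Admissible v → g v ≈ h v) → ∑ᵃ g ≈ ∑ᵃ h
  ∑ᵃ-cong {g} {h} g≈h = ∑-cong (λ v → pointwise v (admissible? v))
    where
    pointwise : ∀ v (v? : Dec (Admissible v)) → (if does v? then g v else 0#) ≈ (if does v? then h v else 0#)
    pointwise v (yes va) = g≈h v va
    pointwise v (no _)   = refl

  ∑ᵃ-+ : ∀ (g h : 𝔽 → Carrier) → ∑ᵃ (λ v → g v + h v) ≈ ∑ᵃ g + ∑ᵃ h
  ∑ᵃ-+ g h = trans (∑-cong (λ v → pointwise v (admissible? v))) (∑-+ (λ v → if does (admissible? v) then g v else 0#) (λ v → if does (admissible? v) then h v else 0#))
    where
    pointwise : ∀ v (v? : Dec (Admissible v)) → (if does v? then g v + h v else 0#) ≈ (if does v? then g v else 0#) + (if does v? then h v else 0#)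
    pointwise v (yes va) = refl
    pointwise v (no _)   = sym (+-identityˡ 0#)

  ∑ᵃ-*ʳ : ∀ (g : 𝔽 → Carrier) x → ∑ᵃ (λ v → g v * x) ≈ ∑ᵃ g * x
  ∑ᵃ-*ʳ g x = trans (∑-cong (λ v → pointwise v (admissible? v))) (∑-*ʳ (λ v → if does (admissible? v) then g v else 0#) x)
    where
    pointwise : ∀ v (v? : Dec (Admissible v)) → (if does v? then g v * x else 0#) ≈ (if does v? then g v else 0#) * x
    pointwise v (yes va) = refl
    pointwise v (no _)   = sym (zeroˡ x)

  ∑ᵃ-sum : ∀ {n} (g : 𝔽 → Fin n → Carrier) → ∑ᵃ (λ v → sum (g v)) ≈ sum (λ i → ∑ᵃ (λ v → g v i))
  ∑ᵃ-sum {n} g = trans (∑-cong (λ v → pointwise v (admissible? v))) (∑-sum (λ v i → if does (admissible? v) then g v i else 0#))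
    where
    pointwise : ∀ v (v? : Dec (Admissible v)) → (if does v? then sum (g v) else 0#) ≈ sum (λ i → if does v? then g v i else 0#)
    pointwise v (yes va) = refl
    pointwise v (no _)   = sym (sum-replicate-zero n)

  -- Only the involutions v ↦ -1 - v and v ↦ v⁻¹ are used; for an involution one direction of
  -- admissibility implies the other.
  ∑ᵃ-substitute : ∀ {g : 𝔽 → Carrier} (g-cong : ∀ {v w} → v F.≈ w → g v ≈ g w) (φ : 𝔽 → 𝔽) → (∀ {v w} → v F.≈ w → φ v F.≈ φ w) →
                  (∀ v → φ (φ v) F.≈ v) → (∀ v → Admissible v → Admissible (φ v)) → ∑ᵃ g ≈ ∑ᵃ (λ v → g (φ v))
  ∑ᵃ-substitute {g} g-cong φ φ-cong φφ φ-adm = trans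
    (∑-substitute (λ {v} {w} v≈w → restricted-cong v≈w) φ φ φ-cong φ-cong φφ φφ)
    (∑-cong λ v → same (admissible? (φ v)) (admissible? v) (λ a → adm-cong (φφ v) (φ-adm (φ v) a)) (φ-adm v) {g (φ v)} refl)
    where
    adm-cong : ∀ {v w} → v F.≈ w → Admissible v → Admissible w
    adm-cong v≈w (v≉0 , v≉-1) = (λ w≈0 → v≉0 (F.trans v≈w w≈0)) , (λ w≈-1 → v≉-1 (F.trans v≈w w≈-1))

    same : ∀ {A : Set ℓ₁} {B : Set ℓ₁} (A? : Dec A) (B? : Dec B) → (A → B) → (B → A) → ∀ {x y} → x ≈ y →
           (if does A? then x else 0#) ≈ (if does B? then y else 0#)
    same (yes _)  (yes _)  _   _   x≈y = x≈y
    same (yes a)  (no ¬b)  a→b _   _   = contradiction (a→b a) ¬b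
    same (no ¬a)  (yes b)  _   b→a _   = contradiction (b→a b) ¬a
    same (no _)   (no _)   _   _   _   = refl

    restricted-cong : ∀ {v w} → v F.≈ w → (if does (admissible? v) then g v else 0#) ≈ (if does (admissible? w) then g w else 0#)
    restricted-cong {v} {w} v≈w = same (admissible? v) (admissible? w) (adm-cong v≈w) (adm-cong (F.sym v≈w)) (g-cong v≈w)

  ∑ᵃ≈∑ : ∀ {g : 𝔽 → Carrier} → (∀ v → ¬ Admissible v → g v ≈ 0#) → ∑ᵃ g ≈ ∑ g
  ∑ᵃ≈∑ {g} g≈0 = ∑-cong (λ v → pointwise v (admissible? v))
    where
    pointwise : ∀ v (v? : Dec (Admissible v)) → (if does v? then g v else 0#) ≈ g v
    pointwise v (yes _)  = refl
    pointwise v (no ¬va) = sym (g≈0 v ¬va)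

  -- `L` vanishes at both excluded points 0 and -1, which allows positive powers of `L` to be summed
  -- over the whole field instead.
  L-inadmissible : ∀ v → ¬ Admissible v → L v ≈ 0#
  L-inadmissible v ¬va with v F.≟ F.0# | v F.≟ F.-1#
  ... | yes v≈0 | _         = L-0 v≈0
  ... | no  _   | yes v≈-1  = trans (L-cong v≈-1) L-[-1]
  ... | no  v≉0 | no  v≉-1  = contradiction (v≉0 , v≉-1) ¬va

  sum-periodic : ∀ c (f : ℕ → Carrier) → (∀ k → f (l ℕ.+ k) ≈ f k) → sum {c ℕ.* l} (λ k → f (toℕ k)) ≈ c · sum {l} (λ k → f (toℕ k))
  sum-periodic zero    f f-periodic = refl
  sum-periodic (suc c) f f-periodic = trans (Sums.sum-split +-commutativeMonoid l (c ℕ.* l) f)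
    (+-congˡ (trans (sum-cong-≋ {c ℕ.* l} (λ k → f-periodic (toℕ k))) (sum-periodic c f f-periodic)))

  -- Each residue class modulo l contains a multiple of l of the numbers 0, …, order - 2.
  ∑L^≈0 : ∀ n → ∑ (λ v → L v ^ suc n) ≈ 0#
  ∑L^≈0 n = begin
    ∑ (λ v → L v ^ suc n)
      ≈⟨ F.∑-powers generates +-commutativeMonoid (λ v≈w → ^-congˡ (suc n) (L-cong v≈w)) ⟩
    L F.0# ^ suc n + sum {order ℕ.∸ 1} (λ k → L (γ F.^ toℕ k) ^ suc n)
      ≈⟨ +-cong (trans (*-congʳ (L-0 F.refl)) (zeroˡ _)) (sum-cong-≋ {order ℕ.∸ 1} (λ k → ^-congˡ (suc n) (L-power (toℕ k) F.refl))) ⟩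
    0# + sum {order ℕ.∸ 1} (λ k → (toℕ k · 1#) ^ suc n)
      ≈⟨ +-identityˡ _ ⟩
    sum {order ℕ.∸ 1} (λ k → (toℕ k · 1#) ^ suc n)
      ≡⟨ ≡.cong (λ m → sum {m} (λ k → (toℕ k · 1#) ^ suc n)) (≡.trans (ℕ∣.m∣n⇒n≡quotient*m l*l∣order-1) (≡.sym (ℕ.*-assoc e l l))) ⟩
    sum {e ℕ.* l ℕ.* l} (λ k → (toℕ k · 1#) ^ suc n)
      ≈⟨ sum-periodic (e ℕ.* l) (λ k → (k · 1#) ^ suc n) (λ k → ^-congˡ (suc n) (trans (×-homo-+ 1# l k) (trans (+-congʳ l≈0) (+-identityˡ _)))) ⟩
    (e ℕ.* l) · sum {l} (λ k → (toℕ k · 1#) ^ suc n)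
      ≈⟨ multiple≈0 (ℕ∣.n∣m*n e) _ ⟩
    0# ∎
    where e = ℕ∣.quotient l*l∣order-1

  ∑ᵃL^≈0 : ∀ n → ∑ᵃ (λ v → L v ^ suc n) ≈ 0#
  ∑ᵃL^≈0 n = trans (∑ᵃ≈∑ (λ v ¬va → trans (*-congʳ (L-inadmissible v ¬va)) (zeroˡ (L v ^ n)))) (∑L^≈0 n)

  v+1≉0 : ∀ {v} → Admissible v → ¬ v F.+ F.1# F.≈ F.0#
  v+1≉0 {v} (_ , v≉-1) v+1≈0 = v≉-1 (F.trans
    (F.solve 1 (λ v → v F.:= (v F.:+ F.con (+ 1)) F.:- F.con (+ 1)) F.refl v)
    (F.trans (F.+-congʳ v+1≈0) (F.+-identityˡ _)))

  -- The involution v ↦ -1 - v exchanges 0 and -1 and turns v + 1 into -v, where `L` has the same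
  -- value as at v.
  ∑ᵃL[v+1]^≈0 : ∀ n → ∑ᵃ (λ v → L (v F.+ F.1#) ^ suc n) ≈ 0#
  ∑ᵃL[v+1]^≈0 n = begin
    ∑ᵃ (λ v → L (v F.+ F.1#) ^ suc n)
      ≈⟨ ∑ᵃ-substitute (λ v≈w → ^-congˡ (suc n) (L-cong (F.+-congʳ v≈w))) φ (λ v≈w → F.+-congˡ (F.-‿cong v≈w))
           (F.solve 1 (λ v → F.:- F.con (+ 1) F.:- (F.:- F.con (+ 1) F.:- v) F.:= v) F.refl) φ-admissible ⟩
    ∑ᵃ (λ v → L (φ v F.+ F.1#) ^ suc n)
      ≈⟨ ∑ᵃ-cong (λ v va → ^-congˡ (suc n) (trans (L-cong (F.solve 1 (λ v → F.:- F.con (+ 1) F.:- v F.:+ F.con (+ 1) F.:= F.:- v) F.refl v)) (L-neg (proj₁ va)))) ⟩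
    ∑ᵃ (λ v → L v ^ suc n)
      ≈⟨ ∑ᵃL^≈0 n ⟩
    0# ∎
    where
    φ : 𝔽 → 𝔽
    φ v = F.- F.1# F.- v

    φ-admissible : ∀ v → Admissible v → Admissible (φ v)
    φ-admissible v (v≉0 , v≉-1) =
        (λ φv≈0 → v≉-1 (F.trans (F.solve 1 (λ v → v F.:= F.:- F.con (+ 1) F.:- (F.:- F.con (+ 1) F.:- v)) F.refl v)
                        (F.trans (F.+-congˡ (F.-‿cong φv≈0)) (F.solve 0 (F.:- F.con (+ 1) F.:- F.con (+ 0) F.:= F.:- F.con (+ 1)) F.refl))))
      , (λ φv≈-1 → v≉0 (F.trans (F.solve 1 (λ v → v F.:= F.:- F.con (+ 1) F.:- (F.:- F.con (+ 1) F.:- v)) F.refl v)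
                        (F.trans (F.+-congˡ (F.-‿cong φv≈-1)) (F.solve 0 (F.:- F.con (+ 1) F.:- F.:- F.con (+ 1) F.:= F.con (+ 0)) F.refl))))

  -- Under v ↦ v⁻¹ the product L v · L (v + 1) becomes (L v)² - L v · L (v + 1).
  ∑ᵃL*L≈0 : ∑ᵃ (λ v → L v * L (v F.+ F.1#)) ≈ 0#
  ∑ᵃL*L≈0 = half (begin
    A + A ≈⟨ +-congˡ inverted ⟩
    A + ∑ᵃ (λ v → - (L v * L (v F.+ F.1#)) + L v ^ 2) ≈⟨ +-congˡ (∑ᵃ-+ (λ v → - (L v * L (v F.+ F.1#))) (λ v → L v ^ 2)) ⟩
    A + (∑ᵃ (λ v → - (L v * L (v F.+ F.1#))) + ∑ᵃ (λ v → L v ^ 2)) ≈⟨ +-congˡ (trans (+-congˡ (∑ᵃL^≈0 1)) (+-identityʳ _)) ⟩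
    A + ∑ᵃ (λ v → - (L v * L (v F.+ F.1#))) ≈⟨ ∑ᵃ-+ (λ v → L v * L (v F.+ F.1#)) (λ v → - (L v * L (v F.+ F.1#))) ⟨
    ∑ᵃ (λ v → L v * L (v F.+ F.1#) - L v * L (v F.+ F.1#)) ≈⟨ ∑ᵃ-cong (λ v _ → -‿inverseʳ (L v * L (v F.+ F.1#))) ⟩
    ∑ᵃ (λ v → 0#) ≈⟨ ∑-zero (λ v → if-same (does (admissible? v))) ⟩
    0# ∎)
    where
    A : Carrier
    A = ∑ᵃ (λ v → L v * L (v F.+ F.1#))

    if-same : ∀ b → (if b then 0# else 0#) ≈ 0#
    if-same true  = refl
    if-same false = refl

    ⁻¹-admissible : ∀ v → Admissible v → Admissible (v F.⁻¹)
    ⁻¹-admissible v (v≉0 , v≉-1) = F.⁻¹-≉0 v≉0 , λ v⁻¹≈-1 → v≉-1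
      (F.trans (F.sym (F.⁻¹-involutive v)) (F.trans (F.⁻¹-cong v⁻¹≈-1)
        (F.⁻¹-unique (F.solve 0 (F.:- F.con (+ 1) F.:* F.:- F.con (+ 1) F.:= F.con (+ 1)) F.refl))))

    inverted-term : ∀ v → Admissible v → L (v F.⁻¹) * L (v F.⁻¹ F.+ F.1#) ≈ - (L v * L (v F.+ F.1#)) + L v ^ 2
    inverted-term v va@(v≉0 , _) = begin
      L (v F.⁻¹) * L (v F.⁻¹ F.+ F.1#)
        ≈⟨ *-congˡ (trans (L-cong (F.trans (F.+-cong (F.sym (F.*-identityˡ _)) (F.sym (F.*-inverse v≉0)))
                                  (F.trans (F.+-comm _ _) (F.sym (F.distribʳ _ _ _)))))
                          (L-* (v+1≉0 va) (F.⁻¹-≉0 v≉0))) ⟩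
      L (v F.⁻¹) * (L (v F.+ F.1#) + L (v F.⁻¹))
        ≈⟨ *-cong (L-⁻¹ v≉0) (+-congˡ (L-⁻¹ v≉0)) ⟩
      (- L v) * (L (v F.+ F.1#) + - L v)
        ≈⟨ solve 2 (λ x y → :- x :* (y :+ :- x) := :- (x :* y) :+ x :* (x :* con (+ 1))) refl (L v) (L (v F.+ F.1#)) ⟩
      - (L v * L (v F.+ F.1#)) + L v ^ 2 ∎

    inverted : A ≈ ∑ᵃ (λ v → - (L v * L (v F.+ F.1#)) + L v ^ 2)
    inverted = trans (∑ᵃ-substitute (λ v≈w → *-cong (L-cong v≈w) (L-cong (F.+-congʳ v≈w))) F._⁻¹ F.⁻¹-cong F.⁻¹-involutive ⁻¹-admissible)
                     (∑ᵃ-cong inverted-term)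

  -- A record, so that the summand can be inferred.
  record Vanishing (g : 𝔽 → Carrier) : Set ℓ where
    constructor vanishing
    field ∑ᵃ≈0 : ∑ᵃ g ≈ 0#

  open Vanishing

  vanishing-+ : ∀ {g h} → Vanishing g → Vanishing h → Vanishing (λ v → g v + h v)
  vanishing-+ {g} {h} (vanishing g≈0) (vanishing h≈0) = vanishing (trans (∑ᵃ-+ g h) (trans (+-cong g≈0 h≈0) (+-identityˡ 0#)))

  vanishing-*ʳ : ∀ {g} x → Vanishing g → Vanishing (λ v → g v * x)
  vanishing-*ʳ {g} x (vanishing g≈0) = vanishing (trans (∑ᵃ-*ʳ g x) (trans (*-congʳ g≈0) (zeroˡ x)))

  vanishing-cong : ∀ {g h} → (∀ v → Admissible v → g v ≈ h v) → Vanishing g → Vanishing h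
  vanishing-cong {g} {h} g≈h (vanishing g≈0) = vanishing (trans (sym (∑ᵃ-cong g≈h)) g≈0)

  L-vanishing : ∀ n → Vanishing (λ v → L v ^ suc n)
  L-vanishing n = vanishing (∑ᵃL^≈0 n)

  L[v+1]-vanishing : ∀ n → Vanishing (λ v → L (v F.+ F.1#) ^ suc n)
  L[v+1]-vanishing n = vanishing (∑ᵃL[v+1]^≈0 n)

  L*L-vanishing : Vanishing (λ v → L v * L (v F.+ F.1#))
  L*L-vanishing = vanishing ∑ᵃL*L≈0

  indicator : ∀ {A : Set b} → Dec A → Carrier
  indicator p = if does p then 1# else 0#

  -- There are q - 2 admissible points and q is 1 in R. The excluded points are added back through
  -- their indicators, which takes the place of counting.
  ∑ᵃ1≈-1 : ∑ᵃ (λ _ → 1#) ≈ - 1#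
  ∑ᵃ1≈-1 = begin
    ∑ᵃ (λ _ → 1#)
      ≈⟨ solve 1 (λ x → x := (x :+ (con (+ 1) :+ con (+ 1))) :- (con (+ 1) :+ con (+ 1))) refl _ ⟩
    (∑ᵃ (λ _ → 1#) + (1# + 1#)) - (1# + 1#)
      ≈⟨ +-congʳ (+-congˡ (+-cong (∑-indicator F.0#) (∑-indicator F.-1#))) ⟨
    (∑ᵃ (λ _ → 1#) + (∑ (λ v → indicator (v F.≟ F.0#)) + ∑ (λ v → indicator (v F.≟ F.-1#)))) - (1# + 1#)
      ≈⟨ +-congʳ (trans (∑-+ (λ v → indicator (admissible? v)) (λ v → indicator (v F.≟ F.0#) + indicator (v F.≟ F.-1#)))
                        (+-congˡ (∑-+ (λ v → indicator (v F.≟ F.0#)) (λ v → indicator (v F.≟ F.-1#))))) ⟨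
    ∑ (λ v → indicator (admissible? v) + (indicator (v F.≟ F.0#) + indicator (v F.≟ F.-1#))) - (1# + 1#)
      ≈⟨ +-congʳ (∑-cong (λ v → partition v (v F.≟ F.0#) (v F.≟ F.-1#))) ⟩
    ∑ (λ v → 1#) - (1# + 1#)
      ≈⟨ +-congʳ (trans (sum-replicate order) order·1≈1) ⟩
    1# - (1# + 1#)
      ≈⟨ solve 0 (con (+ 1) :- (con (+ 1) :+ con (+ 1)) := :- con (+ 1)) refl ⟩
    - 1# ∎
    where
    indicator-yes : ∀ {A : Set ℓ₁} (p : Dec A) → A → indicator p ≈ 1#
    indicator-yes (yes _) _ = refl
    indicator-yes (no ¬a) a = contradiction a ¬a

    indicator-no : ∀ {A : Set ℓ₁} (p : Dec A) → ¬ A → indicator p ≈ 0#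
    indicator-no (yes a) ¬a = contradiction a ¬a
    indicator-no (no _)  _  = refl

    indicator-cong : ∀ a {v w} → v F.≈ w → indicator (v F.≟ a) ≈ indicator (w F.≟ a)
    indicator-cong a {v} {w} v≈w = if-elim (λ x → indicator (v F.≟ a) ≈ x) (w F.≟ a)
      (λ w≈a → indicator-yes (v F.≟ a) (F.trans v≈w w≈a))
      (λ w≉a → indicator-no (v F.≟ a) (λ v≈a → w≉a (F.trans (F.sym v≈w) v≈a)))

    ∑-indicator : ∀ a → ∑ (λ v → indicator (v F.≟ a)) ≈ 1#
    ∑-indicator a = trans (∑-single (indicator-cong a) a (λ v → indicator-no (v F.≟ a))) (indicator-yes (a F.≟ a) F.refl)

    partition : ∀ v (p : Dec (v F.≈ F.0#)) (q : Dec (v F.≈ F.- F.1#)) →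
                indicator (¬? p ×-dec ¬? q) + (indicator p + indicator q) ≈ 1#
    partition v (yes p) (yes q) = contradiction (F.trans (F.sym q) p) F.-1≉0
    partition v (yes p) (no q)  = trans (+-identityˡ _) (+-identityʳ 1#)
    partition v (no p)  (yes q) = trans (+-identityˡ _) (+-identityˡ 1#)
    partition v (no p)  (no q)  = trans (+-congˡ (+-identityˡ 0#)) (+-identityʳ 1#)

  -- The coefficients of the expansion in powers of y - 1.

  module _ (m : ℤ) where

    private
      μ : Carrier
      μ = fromℤ m

      digit : 𝔽 → ℕ
      digit v = N m v %ℕ l

      fromℤ-N : ∀ v → fromℤ (N m v) ≈ L v + μ * L (v F.+ F.1#)
      fromℤ-N v = trans (fromℤ-+ (+ ind γ v) (m ℤ.* + ind γ (v F.+ F.1#))) (+-congˡ (fromℤ-* m (+ ind γ (v F.+ F.1#))))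

      fromℤ-%l : ∀ i → fromℤ i ≈ (i %ℕ l) · 1#
      fromℤ-%l i = begin
        fromℤ i ≡⟨ ≡.cong fromℤ (ℤ.a≡a%ℕn+[a/ℕn]*n i l) ⟩
        fromℤ (+ (i %ℕ l) ℤ.+ i /ℕ l ℤ.* + l) ≈⟨ fromℤ-+ (+ (i %ℕ l)) (i /ℕ l ℤ.* + l) ⟩
        (i %ℕ l) · 1# + fromℤ (i /ℕ l ℤ.* + l) ≈⟨ +-congˡ (fromℤ-* (i /ℕ l) (+ l)) ⟩
        (i %ℕ l) · 1# + fromℤ (i /ℕ l) * (l · 1#) ≈⟨ +-congˡ (trans (*-congˡ l≈0) (zeroʳ _)) ⟩
        (i %ℕ l) · 1# + 0# ≈⟨ +-identityʳ _ ⟩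
        (i %ℕ l) · 1# ∎

      -- The remainder of `N m v` modulo `l` is a linear form in `L v` and `L (v + 1)` once l = 0;
      -- this is what makes the low coefficients computable.
      digit≈ : ∀ v → digit v · 1# ≈ L v + μ * L (v F.+ F.1#)
      digit≈ v = trans (sym (fromℤ-%l (N m v))) (fromℤ-N v)

      -- The coefficient of (y - 1)^i for i < l as it arises from the binomial theorem, summed over
      -- points `v` instead of residues `s`.
      D : ℕ → Carrier
      D i = ∑ᵃ (λ v → (digit v C i) · 1#)

      D₀≈-1 : D 0 ≈ - 1#
      D₀≈-1 = trans (∑ᵃ-cong (λ v _ → trans (×-congˡ (nC0≡1 (digit v))) (×-homo-1 1#))) ∑ᵃ1≈-1

      D₁≈0 : D 1 ≈ 0#
      D₁≈0 = ∑ᵃ≈0 (vanishing-cong {h = λ v → (digit v C 1) · 1#}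
        (λ v _ → trans (solve 3 (λ x y μ → x :* con (+ 1) :+ y :* con (+ 1) :* μ := x :+ μ :* y) refl (L v) (L (v F.+ F.1#)) μ)
                 (trans (sym (digit≈ v)) (×-congˡ (≡.sym (nC1≡n (digit v))))))
        (vanishing-+ (L-vanishing 0) (vanishing-*ʳ μ (L[v+1]-vanishing 0))))

      2*[nC2] : ∀ n → (n C 2) · 1# + (n C 2) · 1# ≈ n · 1# * (n · 1#) - n · 1#
      2*[nC2] zero    = solve 0 (con (+ 0) :+ con (+ 0) := con (+ 0) :* con (+ 0) :- con (+ 0)) refl
      2*[nC2] (suc n) = begin
        (suc n C 2) · 1# + (suc n C 2) · 1# ≈⟨ ×-homo-+ 1# (suc n C 2) (suc n C 2) ⟨
        (suc n C 2 ℕ.+ suc n C 2) · 1# ≡⟨ ≡.cong (λ k → (suc n C 2 ℕ.+ k) · 1#) (ℕ.+-identityʳ (suc n C 2)) ⟨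
        (2 ℕ.* (suc n C 2)) · 1# ≈⟨ ×-congˡ (≡.trans ([k+1]*[n+1]C[k+1] n 1) (≡.cong (suc n ℕ.*_) (nC1≡n n))) ⟩
        (suc n ℕ.* n) · 1# ≈⟨ ×1-homo-* (suc n) n ⟩
        (1# + n · 1#) * (n · 1#) ≈⟨ solve 1 (λ x → (con (+ 1) :+ x) :* x := (con (+ 1) :+ x) :* (con (+ 1) :+ x) :- (con (+ 1) :+ x)) refl (n · 1#) ⟩
        suc n · 1# * (suc n · 1#) - suc n · 1# ∎

      -- Twice C(n, 2) is n² - n, and `half` spares a division. Expanding the square of the linear
      -- form leaves multiples of L(v)², L(v + 1)², L(v) L(v + 1), L(v) and L(v + 1), each with
      -- vanishing sum.
      D₂≈0 : D 2 ≈ 0#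
      D₂≈0 = half (trans (sym (∑ᵃ-+ (λ v → (digit v C 2) · 1#) (λ v → (digit v C 2) · 1#)))
        (∑ᵃ≈0 (vanishing-cong {h = λ v → (digit v C 2) · 1# + (digit v C 2) · 1#} (λ v _ → trans (expand (L v) (L (v F.+ F.1#))) (sym (trans (2*[nC2] (digit v)) (+-cong (*-cong (digit≈ v) (digit≈ v)) (-‿cong (digit≈ v))))))
          (vanishing-+ (L-vanishing 1)
            (vanishing-+ (vanishing-*ʳ (μ * μ) (L[v+1]-vanishing 1))
              (vanishing-+ (vanishing-*ʳ (μ + μ) L*L-vanishing)
                (vanishing-+ (vanishing-*ʳ (- 1#) (L-vanishing 0)) (vanishing-*ʳ (- μ) (L[v+1]-vanishing 0)))))))))
        where
        expand : ∀ x y → x ^ 2 + (y ^ 2 * (μ * μ) + (x * y * (μ + μ) + (x ^ 1 * - 1# + y ^ 1 * - μ))) ≈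
                         (x + μ * y) * (x + μ * y) - (x + μ * y)
        expand x y = solve 3 (λ x y μ → x :^ 2 :+ (y :^ 2 :* (μ :* μ) :+ (x :* y :* (μ :+ μ) :+ (x :^ 1 :* :- con (+ 1) :+ y :^ 1 :* :- μ)))
                                     := (x :+ μ :* y) :* (x :+ μ :* y) :- (x :+ μ :* y)) refl x y μ

      l≡1+[l-1] : l ≡ suc (l ℕ.∸ 1)
      l≡1+[l-1] = ≡.sym (ℕ.m+[n∸m]≡n (ℕ.≤-trans (s≤s z≤n) 3≤l))

      -- `b[ s , m ]` counts the points with digit `s`; interchanging the sums leaves for each `v`
      -- the single term `s = digit v`. The range starts at `i`, and the terms with s < i may be
      -- added because C(s, i) = 0.
      fromℤ-coeff : ∀ i → i < l → fromℤ (coeff i m) ≈ D i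
      fromℤ-coeff i i<l = if-elim (λ x → fromℤ x ≈ D i) (i ℕ.≟ l) (λ i≡l → contradiction i≡l (ℕ.<⇒≢ i<l)) (λ _ → begin
        (rangeSum ℕ.+-0-commutativeMonoid i (l ℕ.∸ 1) (λ s → (s C i) ℕ.* b[ s , m ])) · 1#
          ≈⟨ SumHomomorphism.sum-homo ℕ.+-0-commutativeMonoid +-commutativeMonoid (_· 1#) refl (×-homo-+ 1#)
               {suc (l ℕ.∸ 1) ℕ.∸ i} (λ k → ((i ℕ.+ toℕ k) C i) ℕ.* b[ i ℕ.+ toℕ k , m ]) ⟩
        range i (l ℕ.∸ 1) (λ s → ((s C i) ℕ.* b[ s , m ]) · 1#)
          ≈⟨ sum-cong-≋ {suc (l ℕ.∸ 1) ℕ.∸ i} (λ k → count (i ℕ.+ toℕ k)) ⟩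
        range i (l ℕ.∸ 1) (λ s → ∑ᵃ (λ v → term v s))
          ≈⟨ ∑ᵃ-sum {suc (l ℕ.∸ 1) ℕ.∸ i} (λ v k → term v (i ℕ.+ toℕ k)) ⟨
        ∑ᵃ (λ v → range i (l ℕ.∸ 1) (term v))
          ≈⟨ ∑ᵃ-cong (λ v _ → select v) ⟩
        D i ∎)
        where
        term : 𝔽 → ℕ → Carrier
        term v s = indicator (digit v ℕ.≟ s) * ((s C i) · 1#)

        weight : ∀ v s (p : Dec (Admissible v)) (q : Dec (digit v ≡ s)) →
                 (if does (p ×-dec q) then 1 else 0) · 1# ≈ (if does p then indicator q else 0#)
        weight v s (yes _) (yes _) = ×-homo-1 1#
        weight v s (yes _) (no _)  = refl
        weight v s (no _)  q       = refl

        count : ∀ s → ((s C i) ℕ.* b[ s , m ]) · 1# ≈ ∑ᵃ (λ v → term v s)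
        count s = begin
          ((s C i) ℕ.* b[ s , m ]) · 1# ≈⟨ ×1-homo-* (s C i) b[ s , m ] ⟩
          (s C i) · 1# * (b[ s , m ] · 1#) ≈⟨ *-comm _ _ ⟩
          b[ s , m ] · 1# * ((s C i) · 1#)
            ≈⟨ *-congʳ (trans (SumHomomorphism.sum-homo ℕ.+-0-commutativeMonoid +-commutativeMonoid (_· 1#) refl (×-homo-+ 1#) {order} _)
                              (∑-cong (λ v → weight v s (admissible? v) (digit v ℕ.≟ s)))) ⟩
          ∑ᵃ (λ v → indicator (digit v ℕ.≟ s)) * ((s C i) · 1#)
            ≈⟨ ∑ᵃ-*ʳ (λ v → indicator (digit v ℕ.≟ s)) ((s C i) · 1#) ⟨
          ∑ᵃ (λ v → term v s) ∎

        select : ∀ v → range i (l ℕ.∸ 1) (term v) ≈ (digit v C i) · 1#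
        select v = begin
          range i (l ℕ.∸ 1) (term v)
            ≈⟨ +-identityˡ _ ⟨
          0# + range i (l ℕ.∸ 1) (term v)
            ≈⟨ +-congʳ (trans (sum-cong-≋ {i} (λ k → below k)) (sum-replicate-zero i)) ⟨
          sum {i} (λ k → term v (toℕ k)) + range i (l ℕ.∸ 1) (term v)
            ≈⟨ Sums.sum≈rangeSum +-commutativeMonoid i (l ℕ.∸ 1) (term v) (≡.subst (i ≤_) l≡1+[l-1] (ℕ.<⇒≤ i<l)) ⟨
          sum {suc (l ℕ.∸ 1)} (λ k → term v (toℕ k))
            ≡⟨ ≡.cong (λ n → sum {n} (λ k → term v (toℕ k))) l≡1+[l-1] ⟨
          sum {l} (λ k → term v (toℕ k))
            ≈⟨ Sums.sum-single +-commutativeMonoid (λ k → term v (toℕ k)) (fromℕ< digit<l) at-digit away ⟩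
          (digit v C i) · 1# ∎
          where
          digit<l : digit v < l
          digit<l = ℤ.n%ℕd<d (N m v) l

          below : ∀ (k : Fin i) → term v (toℕ k) ≈ 0#
          below k = trans (*-congˡ (×-congˡ (k>n⇒nCk≡0 (Fin.toℕ<n k)))) (zeroʳ _)

          at-digit : term v (toℕ (fromℕ< digit<l)) ≈ (digit v C i) · 1#
          at-digit = trans (reflexive (≡.cong (term v) (Fin.toℕ-fromℕ< digit<l)))
            (if-elim (λ x → x * ((digit v C i) · 1#) ≈ (digit v C i) · 1#) (digit v ℕ.≟ digit v) (λ _ → *-identityˡ _) (λ ≢ → contradiction ≡.refl ≢))

          away : ∀ k → ¬ k ≡ fromℕ< digit<l → term v (toℕ k) ≈ 0#
          away k k≢ = if-elim (λ x → x * ((toℕ k C i) · 1#) ≈ 0#) (digit v ℕ.≟ toℕ k)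
            (λ digit≡k → contradiction (Fin.toℕ-injective (≡.trans (≡.sym digit≡k) (≡.sym (Fin.toℕ-fromℕ< digit<l)))) k≢)
            (λ _ → zeroˡ _)

      fromℤ-S : fromℤ (S m) ≈ ∑ᵃ (λ v → fromℤ (N m v /ℕ l))
      fromℤ-S = trans
        (SumHomomorphism.sum-homo ℤ.+-0-commutativeMonoid +-commutativeMonoid fromℤ refl fromℤ-+ {order} _)
        (∑-cong (λ v → commute v (admissible? v)))
        where
        commute : ∀ v (p : Dec (Admissible v)) → fromℤ (if does p then N m v /ℕ l else + 0) ≈ (if does p then fromℤ (N m v /ℕ l) else 0#)
        commute v (yes _) = refl
        commute v (no _)  = refl

    module _ (y : Carrier) (nilpotent : (y - 1#) ^ suc l ≈ 0#) where

      private
        instance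
          l²≢0 : NonZero (l ℕ.^ 2)
          l²≢0 = ℕ.m^n≢0 l 2

        u : Carrier
        u = y - 1#

        1+u≈y : 1# + u ≈ y
        1+u≈y = solve 1 (λ y → con (+ 1) :+ (y :- con (+ 1)) := y) refl y

        y^l≈1+u^l : y ^ l ≈ 1# + u ^ l
        y^l≈1+u^l with x , _ , eq ← frobenius l l-prime u = begin
          y ^ l ≈⟨ ^-congˡ l 1+u≈y ⟨
          (1# + u) ^ l ≈⟨ eq ⟩
          1# + u ^ l + l · 1# * (u * (1# + u * x)) ≈⟨ +-congˡ (trans (*-congʳ l≈0) (zeroˡ _)) ⟩
          1# + u ^ l + 0# ≈⟨ +-identityʳ _ ⟩
          1# + u ^ l ∎

        u^l*u^l≈0 : u ^ l * u ^ l ≈ 0#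
        u^l*u^l≈0 = begin
          u ^ l * u ^ l ≡⟨ ≡.cong (λ k → u ^ l * u ^ k) l≡1+[l-1] ⟩
          u ^ l * (u * u ^ (l ℕ.∸ 1)) ≈⟨ solve 3 (λ x u y → x :* (u :* y) := (u :* x) :* y) refl (u ^ l) u (u ^ (l ℕ.∸ 1)) ⟩
          (u * u ^ l) * u ^ (l ℕ.∸ 1) ≈⟨ trans (*-congʳ nilpotent) (zeroˡ _) ⟩
          0# ∎

        [1+u^l]^t : ∀ t → (1# + u ^ l) ^ t ≈ 1# + t · 1# * u ^ l
        [1+u^l]^t zero    = solve 1 (λ w → con (+ 1) := con (+ 1) :+ con (+ 0) :* w) refl (u ^ l)
        [1+u^l]^t (suc t) = begin
          (1# + w) * (1# + w) ^ t ≈⟨ *-congˡ ([1+u^l]^t t) ⟩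
          (1# + w) * (1# + t · 1# * w) ≈⟨ solve 2 (λ w t → (con (+ 1) :+ w) :* (con (+ 1) :+ t :* w)
                                                                                  := con (+ 1) :+ (con (+ 1) :+ t) :* w :+ t :* (w :* w)) refl w (t · 1#) ⟩
          1# + (1# + t · 1#) * w + t · 1# * (w * w) ≈⟨ +-congˡ (trans (*-congˡ u^l*u^l≈0) (zeroʳ _)) ⟩
          1# + (1# + t · 1#) * w + 0# ≈⟨ +-identityʳ _ ⟩
          1# + suc t · 1# * w ∎
          where w = u ^ l

        -- `u` annihilates `u ^ l`, so `1# + u` fixes it. Hence the digit does not interfere with
        -- the term that carries the floor.
        [1+u]^s*u^l : ∀ s → (1# + u) ^ s * u ^ l ≈ u ^ l
        [1+u]^s*u^l zero    = *-identityˡ _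
        [1+u]^s*u^l (suc s) = begin
          (1# + u) * (1# + u) ^ s * u ^ l ≈⟨ *-assoc _ _ _ ⟩
          (1# + u) * ((1# + u) ^ s * u ^ l) ≈⟨ *-congˡ ([1+u]^s*u^l s) ⟩
          (1# + u) * u ^ l ≈⟨ solve 2 (λ u w → (con (+ 1) :+ u) :* w := w :+ u :* w) refl u (u ^ l) ⟩
          u ^ l + u * u ^ l ≈⟨ +-congˡ nilpotent ⟩
          u ^ l + 0# ≈⟨ +-identityʳ _ ⟩
          u ^ l ∎

        y^n≈ : ∀ n → y ^ n ≈ binomialSum (n ℕ.% l) l u + (n ℕ./ l) · 1# * u ^ l
        y^n≈ n = begin
          y ^ n ≡⟨ ≡.cong (y ^_) (ℕ.m≡m%n+[m/n]*n n l) ⟩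
          y ^ (s ℕ.+ t ℕ.* l) ≡⟨ ≡.cong (λ k → y ^ (s ℕ.+ k)) (ℕ.*-comm t l) ⟩
          y ^ (s ℕ.+ l ℕ.* t) ≈⟨ ^-homo-* y s (l ℕ.* t) ⟩
          y ^ s * y ^ (l ℕ.* t) ≈⟨ *-cong (^-congˡ s (sym 1+u≈y)) (trans (sym (^-assocʳ y l t)) (trans (^-congˡ t y^l≈1+u^l) ([1+u^l]^t t))) ⟩
          (1# + u) ^ s * (1# + t · 1# * u ^ l) ≈⟨ solve 3 (λ x t w → x :* (con (+ 1) :+ t :* w) := x :+ t :* (x :* w)) refl ((1# + u) ^ s) (t · 1#) (u ^ l) ⟩
          (1# + u) ^ s + t · 1# * ((1# + u) ^ s * u ^ l) ≈⟨ +-cong (sym (binomialSum≈[1+u]^s s l u (ℕ.m%n<n n l))) (*-congˡ ([1+u]^s*u^l s)) ⟩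
          binomialSum s l u + t · 1# * u ^ l ∎
          where
          s = n ℕ.% l
          t = n ℕ./ l

        -- Reducing `i` modulo l² keeps its remainder modulo `l` and changes its quotient by a
        -- multiple of `l`, which is 0 in R.
        powMod≈ : ∀ i → powMod (l ℕ.^ 2) y i ≈ binomialSum (i %ℕ l) l u + fromℤ (i /ℕ l) * u ^ l
        powMod≈ i = begin
          y ^ n ≈⟨ y^n≈ n ⟩
          binomialSum (n ℕ.% l) l u + (n ℕ./ l) · 1# * u ^ l
            ≈⟨ +-cong (reflexive (≡.cong (λ s → binomialSum s l u) (≡.sym (proj₁ division)))) (*-congʳ quotient≈) ⟩
          binomialSum (i %ℕ l) l u + fromℤ (i /ℕ l) * u ^ l ∎
          where
          n = i %ℕ (l ℕ.^ 2)
          k = i /ℕ (l ℕ.^ 2)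

          division : i %ℕ l ≡ n ℕ.% l × i /ℕ l ≡ + (n ℕ./ l) ℤ.+ k ℤ.* + l
          division = %ℕ-/ℕ-unique i (+ (n ℕ./ l) ℤ.+ k ℤ.* + l) l (ℕ.m%n<n n l) (≡.trans (ℤ.a≡a%ℕn+[a/ℕn]*n i (l ℕ.^ 2))
            (≡.trans (≡.cong₂ (λ x y → x ℤ.+ k ℤ.* y)
                       (≡.trans (ℤ.a≡a%ℕn+[a/ℕn]*n (+ n) l) ≡.refl)
                       (≡.trans (≡.cong +_ (≡.cong (l ℕ.*_) (ℕ.*-identityʳ l))) (ℤ.pos-* l l)))
                     (collect (+ (n ℕ.% l)) (+ (n ℕ./ l)) k (+ l))))
            where
            collect : ∀ s t k l → s ℤ.+ t ℤ.* l ℤ.+ k ℤ.* (l ℤ.* l) ≡ s ℤ.+ (t ℤ.+ k ℤ.* l) ℤ.* l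
            collect = ℤ-solve

          quotient≈ : (n ℕ./ l) · 1# ≈ fromℤ (i /ℕ l)
          quotient≈ = sym (begin
            fromℤ (i /ℕ l) ≡⟨ ≡.cong fromℤ (proj₂ division) ⟩
            fromℤ (+ (n ℕ./ l) ℤ.+ k ℤ.* + l) ≈⟨ fromℤ-+ (+ (n ℕ./ l)) (k ℤ.* + l) ⟩
            (n ℕ./ l) · 1# + fromℤ (k ℤ.* + l) ≈⟨ +-congˡ (trans (fromℤ-* k (+ l)) (trans (*-congˡ l≈0) (zeroʳ _))) ⟩
            (n ℕ./ l) · 1# + 0# ≈⟨ +-identityʳ _ ⟩
            (n ℕ./ l) · 1# ∎)

      -- Sum `powMod≈` over `v`: the remainders give `D i` for i < l, of which the first three are
      -- known, and the floors add up to `S m`, the coefficient for i = l.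
      character-sum-expansion : ∑ᵃ (λ v → powMod (l ℕ.^ 2) y (N m v)) ≈
                                - 1# + range 3 l (λ i → fromℤ (coeff i m) * (y - 1#) ^ i)
      character-sum-expansion = begin
        ∑ᵃ (λ v → powMod (l ℕ.^ 2) y (N m v))
          ≈⟨ ∑ᵃ-cong (λ v _ → trans (powMod≈ (N m v)) (+-congʳ (sum-cong-≋ {l} (λ i → split-multiple (digit v C toℕ i) (u ^ toℕ i))))) ⟩
        ∑ᵃ (λ v → sum {l} (λ i → (digit v C toℕ i) · 1# * u ^ toℕ i) + fromℤ (N m v /ℕ l) * u ^ l)
          ≈⟨ ∑ᵃ-+ (λ v → sum {l} (λ i → (digit v C toℕ i) · 1# * u ^ toℕ i)) (λ v → fromℤ (N m v /ℕ l) * u ^ l) ⟩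
        ∑ᵃ (λ v → sum {l} (λ i → (digit v C toℕ i) · 1# * u ^ toℕ i)) + ∑ᵃ (λ v → fromℤ (N m v /ℕ l) * u ^ l)
          ≈⟨ +-cong (trans (∑ᵃ-sum {l} (λ v i → (digit v C toℕ i) · 1# * u ^ toℕ i)) (sum-cong-≋ {l} (λ i → ∑ᵃ-*ʳ (λ v → (digit v C toℕ i) · 1#) (u ^ toℕ i))))
                    (trans (∑ᵃ-*ʳ (λ v → fromℤ (N m v /ℕ l)) (u ^ l)) (*-congʳ (sym fromℤ-S))) ⟩
        sum {l} (λ i → D (toℕ i) * u ^ toℕ i) + fromℤ (S m) * u ^ l
          ≡⟨ ≡.cong (λ n → sum {n} (λ i → D (toℕ i) * u ^ toℕ i) + fromℤ (S m) * u ^ l) l≡1+[l-1] ⟩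
        sum {suc (l ℕ.∸ 1)} (λ i → D (toℕ i) * u ^ toℕ i) + fromℤ (S m) * u ^ l
          ≈⟨ +-congʳ (Sums.sum≈rangeSum +-commutativeMonoid 3 (l ℕ.∸ 1) (λ i → D i * u ^ i) 3≤1+[l-1]) ⟩
        (D 0 * u ^ 0 + (D 1 * u ^ 1 + (D 2 * u ^ 2 + 0#))) + range 3 (l ℕ.∸ 1) (λ i → D i * u ^ i) + fromℤ (S m) * u ^ l
          ≈⟨ +-cong (+-cong first-three (sum-cong-≋ {suc (l ℕ.∸ 1) ℕ.∸ 3} later)) (*-congʳ (reflexive (≡.cong fromℤ (≡.sym coeff-l)))) ⟩
        - 1# + range 3 (l ℕ.∸ 1) f + f l
          ≈⟨ +-assoc _ _ _ ⟩
        - 1# + (range 3 (l ℕ.∸ 1) f + f l)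
          ≡⟨ ≡.cong (λ n → - 1# + (range 3 (l ℕ.∸ 1) f + f n)) l≡1+[l-1] ⟩
        - 1# + (range 3 (l ℕ.∸ 1) f + f (suc (l ℕ.∸ 1)))
          ≈⟨ +-congˡ (Sums.rangeSum-snoc +-commutativeMonoid 3 (l ℕ.∸ 1) f 3≤1+[l-1]) ⟨
        - 1# + range 3 (suc (l ℕ.∸ 1)) f
          ≡⟨ ≡.cong (λ n → - 1# + range 3 n f) l≡1+[l-1] ⟨
        - 1# + range 3 l f ∎
        where
        f : ℕ → Carrier
        f i = fromℤ (coeff i m) * u ^ i

        3≤1+[l-1] : 3 ≤ suc (l ℕ.∸ 1)
        3≤1+[l-1] = ≡.subst (3 ≤_) l≡1+[l-1] 3≤l

        split-multiple : ∀ n x → n · x ≈ n · 1# * x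
        split-multiple n x = sym (trans (×-assoc-* n 1# x) (×-congʳ n (*-identityˡ x)))

        first-three : D 0 * u ^ 0 + (D 1 * u ^ 1 + (D 2 * u ^ 2 + 0#)) ≈ - 1#
        first-three = trans (+-cong (*-congʳ D₀≈-1) (+-cong (*-congʳ D₁≈0) (+-congʳ (*-congʳ D₂≈0))))
          (solve 1 (λ u → :- con (+ 1) :* u :^ 0 :+ (con (+ 0) :* u :^ 1 :+ (con (+ 0) :* u :^ 2 :+ con (+ 0))) := :- con (+ 1)) refl u)

        later : ∀ (k : Fin (suc (l ℕ.∸ 1) ℕ.∸ 3)) → D (3 ℕ.+ toℕ k) * u ^ (3 ℕ.+ toℕ k) ≈ f (3 ℕ.+ toℕ k)
        later k = *-congʳ (sym (fromℤ-coeff (3 ℕ.+ toℕ k) (≡.subst (3 ℕ.+ toℕ k <_)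
          (≡.trans (ℕ.m+[n∸m]≡n 3≤1+[l-1]) (≡.sym l≡1+[l-1])) (ℕ.+-monoʳ-< 3 (Fin.toℕ<n k)))))

        coeff-l : coeff l m ≡ S m
        coeff-l = if-elim (_≡ S m) (l ℕ.≟ l) (λ _ → ≡.refl) (λ ≢ → contradiction ≡.refl ≢)

-- Convolution of characters and identities between Jacobi sums.

module JacobiSums (F : FiniteField a ℓ₁ ℓ₂) (R : CommutativeRing c ℓ) where

  private
    module F = FiniteFields F
    module S = SetoidReasoning (FiniteField.setoid F)
  open FiniteField F using (order) renaming (Carrier to 𝔽)
  open CommutativeRing R hiding (zero)
  open RingNotions R using (_^_)
  open IntegerMultiples R
  open Powers R
  open Mult semiring using () renaming (_×_ to _·_)
  open Sum semiring using (sum; sum-cong-≋; ∑-distrib-+; sum-replicate)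
  open FiniteFields.RingSummation F R
  open SetoidReasoning setoid

  record IsCharacter (f : 𝔽 → Carrier) : Set (a ⊔ ℓ₁ ⊔ ℓ) where
    field
      f-cong : ∀ {x y} → x F.≈ y → f x ≈ f y
      f-0    : f F.0# ≈ 0#
      f-1    : f F.1# ≈ 1#
      f-*    : ∀ x y → f (x F.* y) ≈ f x * f y

    f-zero : ∀ {x} → x F.≈ F.0# → f x ≈ 0#
    f-zero x≈0 = trans (f-cong x≈0) f-0

    f[-1]² : f F.-1# * f F.-1# ≈ 1#
    f[-1]² = trans (sym (f-* _ _)) (trans (f-cong (F.solve 0 (F.:- F.con (+ 1) F.:* F.:- F.con (+ 1) F.:= F.con (+ 1)) F.refl)) f-1)

    f-neg : ∀ x → f (F.- x) ≈ f F.-1# * f x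
    f-neg x = trans (f-cong (F.sym (F.-1*x≈-x x))) (f-* _ x)

    f-⁻¹ : ∀ {x} → ¬ x F.≈ F.0# → f x * f (x F.⁻¹) ≈ 1#
    f-⁻¹ x≉0 = trans (sym (f-* _ _)) (trans (f-cong (F.*-inverse x≉0)) f-1)

  open IsCharacter

  Inverse[_,_] : (f k : 𝔽 → Carrier) → Set (a ⊔ ℓ₁ ⊔ ℓ)
  Inverse[ f , k ] = ∀ v → ¬ v F.≈ F.0# → f v * k v ≈ 1#

  inverse-unique : ∀ {x y z} → x * y ≈ 1# → x * z ≈ 1# → y ≈ z
  inverse-unique {x} {y} {z} xy≈1 xz≈1 = begin
    y ≈⟨ *-identityʳ y ⟨
    y * 1# ≈⟨ *-congˡ xz≈1 ⟨
    y * (x * z) ≈⟨ solve 3 (λ x y z → y :* (x :* z) := (x :* y) :* z) refl x y z ⟩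
    (x * y) * z ≈⟨ *-congʳ xy≈1 ⟩
    1# * z ≈⟨ *-identityˡ z ⟩
    z ∎

  convolution : (f g : 𝔽 → Carrier) → 𝔽 → Carrier
  convolution f g t = ∑ (λ x → f x * g (t F.- x))

  -- The convolution at 1 involves 1 - x, which makes this form symmetric in `f` and `g`;
  -- `jacobiSum≈` gives the sign relating it to the form with v + 1.
  J : (f g : 𝔽 → Carrier) → Carrier
  J f g = convolution f g F.1#

  J-cong : ∀ {f f′ g g′} → (∀ v → f v ≈ f′ v) → (∀ v → g v ≈ g′ v) → J f g ≈ J f′ g′
  J-cong f≈ g≈ = ∑-cong (λ v → *-cong (f≈ v) (g≈ (F.1# F.- v)))

  module _ {f : 𝔽 → Carrier} (f-cong : ∀ {x y} → x F.≈ y → f x ≈ f y) where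

    ∑-translate : ∀ t → ∑ f ≈ ∑ (λ v → f (v F.+ t))
    ∑-translate t = ∑-substitute f-cong (F._+ t) (F._- t) F.+-congʳ F.+-congʳ
      (λ v → F.solve 2 (λ v t → (v F.:- t) F.:+ t F.:= v) F.refl v t)
      (λ v → F.solve 2 (λ v t → (v F.:+ t) F.:- t F.:= v) F.refl v t)

    ∑-reflect : ∀ t → ∑ f ≈ ∑ (λ v → f (t F.- v))
    ∑-reflect t = ∑-substitute f-cong (λ v → t F.- v) (λ v → t F.- v) reflect-cong reflect-cong reflect-reflect reflect-reflect
      where
      reflect-cong : ∀ {v w} → v F.≈ w → t F.- v F.≈ t F.- w
      reflect-cong v≈w = F.+-congˡ (F.-‿cong v≈w)
      reflect-reflect : ∀ v → t F.- (t F.- v) F.≈ v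
      reflect-reflect v = F.solve 2 (λ v t → t F.:- (t F.:- v) F.:= v) F.refl v t

    ∑-scale : ∀ {t} → ¬ t F.≈ F.0# → ∑ f ≈ ∑ (λ v → f (t F.* v))
    ∑-scale {t} t≉0 = ∑-substitute f-cong (t F.*_) (t F.⁻¹ F.*_) F.*-congˡ F.*-congˡ
      (λ v → cancel v (F.*-inverse t≉0)) (λ v → cancel v (F.trans (F.*-comm _ _) (F.*-inverse t≉0)))
      where
      cancel : ∀ {r s} v → r F.* s F.≈ F.1# → r F.* (s F.* v) F.≈ v
      cancel v rs≈1 = F.trans (F.sym (F.*-assoc _ _ v)) (F.trans (F.*-congʳ rs≈1) (F.*-identityˡ v))

    ∑-invert : ∑ f ≈ ∑ (λ v → f (v F.⁻¹))
    ∑-invert = ∑-substitute f-cong F._⁻¹ F._⁻¹ F.⁻¹-cong F.⁻¹-cong F.⁻¹-involutive F.⁻¹-involutive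

  J-comm : ∀ {f g} → IsCharacter f → IsCharacter g → J f g ≈ J g f
  J-comm {f} {g} cf cg = trans
    (∑-reflect {λ v → f v * g (F.1# F.- v)} (λ v≈w → *-cong (f-cong cf v≈w) (f-cong cg (F.+-congˡ (F.-‿cong v≈w)))) F.1#)
    (∑-cong (λ v → trans (*-congˡ (f-cong cg (F.solve 1 (λ v → F.con (+ 1) F.:- (F.con (+ 1) F.:- v) F.:= v) F.refl v))) (*-comm (f (F.1# F.- v)) (g v))))

  -- Associativity of convolution, evaluated at 1: interchange the sums and translate `s` by `x`.
  convolution-assoc : ∀ {f g h} → IsCharacter g → IsCharacter h →
                      ∑ (λ s → convolution f g s * h (F.1# F.- s)) ≈ ∑ (λ x → f x * convolution g h (F.1# F.- x))
  convolution-assoc {f} {g} {h} cg ch = begin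
    ∑ (λ s → ∑ (λ x → f x * g (s F.- x)) * h (F.1# F.- s))
      ≈⟨ ∑-cong (λ s → ∑-*ʳ (λ x → f x * g (s F.- x)) (h (F.1# F.- s))) ⟨
    ∑ (λ s → ∑ (λ x → f x * g (s F.- x) * h (F.1# F.- s)))
      ≈⟨ ∑-∑-comm (λ s x → f x * g (s F.- x) * h (F.1# F.- s)) ⟩
    ∑ (λ x → ∑ (λ s → f x * g (s F.- x) * h (F.1# F.- s)))
      ≈⟨ ∑-cong (λ x → trans (∑-cong (λ s → *-assoc (f x) (g (s F.- x)) (h (F.1# F.- s)))) (∑-*ˡ (f x) (λ s → g (s F.- x) * h (F.1# F.- s)))) ⟩
    ∑ (λ x → f x * ∑ (λ s → g (s F.- x) * h (F.1# F.- s)))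
      ≈⟨ ∑-cong (λ x → *-congˡ {f x} (trans
           (∑-translate (λ v≈w → *-cong (f-cong cg (F.+-congʳ v≈w)) (f-cong ch (F.+-congˡ (F.-‿cong v≈w)))) x)
           (∑-cong (λ s → *-cong (f-cong cg (F.solve 2 (λ s x → (s F.:+ x) F.:- x F.:= s) F.refl s x))
                                 (f-cong ch (F.solve 2 (λ s x → F.con (+ 1) F.:- (s F.:+ x) F.:= (F.con (+ 1) F.:- x) F.:- s) F.refl s x)))))) ⟩
    ∑ (λ x → f x * convolution g h (F.1# F.- x)) ∎

  convolution-at-0 : ∀ {f g} → IsCharacter g → ∀ {t} → t F.≈ F.0# → convolution f g t ≈ g F.-1# * ∑ (λ x → f x * g x)
  convolution-at-0 {f} {g} cg {t} t≈0 = trans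
    (∑-cong (λ x → trans (*-congˡ (trans (f-cong cg (F.trans (F.+-congʳ t≈0) (F.+-identityˡ _))) (f-neg cg x)))
                         (solve 3 (λ x y z → x :* (y :* z) := y :* (x :* z)) refl (f x) (g F.-1#) (g x))))
    (∑-*ˡ (g F.-1#) (λ x → f x * g x))

  convolution-scale : ∀ {f g} → IsCharacter f → IsCharacter g → ∀ {t} → ¬ t F.≈ F.0# → convolution f g t ≈ J f g * (f t * g t)
  convolution-scale {f} {g} cf cg {t} t≉0 = begin
    convolution f g t
      ≈⟨ ∑-scale (λ v≈w → *-cong (f-cong cf v≈w) (f-cong cg (F.+-congˡ (F.-‿cong v≈w)))) t≉0 ⟩
    ∑ (λ x → f (t F.* x) * g (t F.- t F.* x))
      ≈⟨ ∑-cong (λ x → trans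
           (*-cong (f-* cf t x) (trans (f-cong cg (F.solve 2 (λ t x → t F.:- t F.:* x F.:= t F.:* (F.con (+ 1) F.:- x)) F.refl t x)) (f-* cg t (F.1# F.- x))))
           (solve 4 (λ a b c d → (a :* b) :* (c :* d) := (b :* d) :* (a :* c)) refl (f t) (f x) (g t) (g (F.1# F.- x)))) ⟩
    ∑ (λ x → f x * g (F.1# F.- x) * (f t * g t))
      ≈⟨ ∑-*ʳ (λ x → f x * g (F.1# F.- x)) (f t * g t) ⟩
    J f g * (f t * g t) ∎

  -- Away from 0 this is the substitution x ↦ t x. The hypothesis on the sum makes the convolution
  -- vanish at 0, as `f t * g t` does, so the formula holds everywhere and can be inserted into a
  -- second convolution.
  convolution≈ : ∀ {f g} → IsCharacter f → IsCharacter g → ∑ (λ x → f x * g x) ≈ 0# → ∀ t → convolution f g t ≈ J f g * (f t * g t)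
  convolution≈ {f} {g} cf cg ∑fg≈0 t with t F.≟ F.0#
  ... | no  t≉0 = convolution-scale cf cg t≉0
  ... | yes t≈0 = begin
    convolution f g t ≈⟨ convolution-at-0 {f} cg t≈0 ⟩
    g F.-1# * ∑ (λ x → f x * g x) ≈⟨ *-congˡ ∑fg≈0 ⟩
    g F.-1# * 0# ≈⟨ solve 3 (λ x y z → x :* con (+ 0) := y :* (con (+ 0) :* z)) refl (g F.-1#) (J f g) (g t) ⟩
    J f g * (0# * g t) ≈⟨ *-congˡ (*-congʳ (f-zero cf t≈0)) ⟨
    J f g * (f t * g t) ∎

  -- The threefold convolution of f, g and h at 1, bracketed in the two ways.
  J-cocycle : ∀ {f g h} → IsCharacter f → IsCharacter g → IsCharacter h →
              ∑ (λ x → f x * g x) ≈ 0# → ∑ (λ x → g x * h x) ≈ 0# →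
              J f g * J (λ x → f x * g x) h ≈ J g h * J f (λ x → g x * h x)
  J-cocycle {f} {g} {h} cf cg ch ∑fg≈0 ∑gh≈0 = begin
    J f g * J (λ x → f x * g x) h
      ≈⟨ ∑-*ˡ (J f g) (λ s → f s * g s * h (F.1# F.- s)) ⟨
    ∑ (λ s → J f g * (f s * g s * h (F.1# F.- s)))
      ≈⟨ ∑-cong (λ s → trans (sym (*-assoc (J f g) (f s * g s) (h (F.1# F.- s)))) (*-congʳ (sym (convolution≈ cf cg ∑fg≈0 s)))) ⟩
    ∑ (λ s → convolution f g s * h (F.1# F.- s))
      ≈⟨ convolution-assoc {f} cg ch ⟩
    ∑ (λ x → f x * convolution g h (F.1# F.- x))
      ≈⟨ ∑-cong (λ x → trans (*-congˡ (convolution≈ cg ch ∑gh≈0 (F.1# F.- x)))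
           (solve 3 (λ a b c → a :* (b :* c) := b :* (a :* c)) refl (f x) (J g h) (g (F.1# F.- x) * h (F.1# F.- x)))) ⟩
    ∑ (λ x → J g h * (f x * (g (F.1# F.- x) * h (F.1# F.- x))))
      ≈⟨ ∑-*ˡ (J g h) (λ x → f x * (g (F.1# F.- x) * h (F.1# F.- x))) ⟩
    J g h * J f (λ x → g x * h x) ∎

  ∑1≈order : ∑ (λ _ → 1#) ≈ order · 1#
  ∑1≈order = sum-replicate order

  module _ {f k : 𝔽 → Carrier} (cf : IsCharacter f) (ck : IsCharacter k) (fk≈1 : Inverse[ f , k ]) where

    private
      inverse-at : ∀ {v} → ¬ v F.≈ F.0# → f (v F.⁻¹) ≈ k v
      inverse-at v≉0 = inverse-unique (f-⁻¹ cf v≉0) (fk≈1 _ v≉0)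

    k[-1] : k F.-1# ≈ f F.-1#
    k[-1] = inverse-unique (fk≈1 _ F.-1≉0) (f[-1]² cf)

    -- The complement 1 - f k is supported at 0, where it is 1.
    ∑fk≈order-1 : ∑ (λ x → f x * k x) ≈ order · 1# - 1#
    ∑fk≈order-1 = begin
      ∑ (λ x → f x * k x)
        ≈⟨ solve 2 (λ x y → x := (x :+ y) :- y) refl _ _ ⟩
      (∑ (λ x → f x * k x) + ∑ (λ x → 1# - f x * k x)) - ∑ (λ x → 1# - f x * k x)
        ≈⟨ +-cong (sym (∑-+ (λ x → f x * k x) (λ x → 1# - f x * k x))) (-‿cong (∑-single complement-cong F.0# complement-zero)) ⟩
      ∑ (λ x → f x * k x + (1# - f x * k x)) - (1# - f F.0# * k F.0#)
        ≈⟨ +-cong (trans (∑-cong (λ x → solve 1 (λ y → y :+ (con (+ 1) :- y) := con (+ 1)) refl (f x * k x))) ∑1≈order)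
                  (-‿cong (trans (+-congˡ (-‿cong (*-congʳ (f-0 cf)))) (solve 1 (λ y → con (+ 1) :- con (+ 0) :* y := con (+ 1)) refl (k F.0#)))) ⟩
      order · 1# - 1# ∎
      where
      complement-cong : ∀ {x y} → x F.≈ y → 1# - f x * k x ≈ 1# - f y * k y
      complement-cong x≈y = +-congˡ (-‿cong (*-cong (f-cong cf x≈y) (f-cong ck x≈y)))
      complement-zero : ∀ v → ¬ v F.≈ F.0# → 1# - f v * k v ≈ 0#
      complement-zero v v≉0 = trans (+-congˡ (-‿cong (fk≈1 v v≉0))) (-‿inverseʳ 1#)

    -- The substitution y = 1 - x followed by y = u⁻¹ turns f x / f (1 - x) into f (u - 1).
    J-inverse : ∑ f ≈ 0# → J f k ≈ - f F.-1#
    J-inverse ∑f≈0 = begin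
      J f k
        ≈⟨ J-comm cf ck ⟩
      ∑ (λ y → k y * f (F.1# F.- y))
        ≈⟨ ∑-invert (λ v≈w → *-cong (f-cong ck v≈w) (f-cong cf (F.+-congˡ (F.-‿cong v≈w)))) ⟩
      ∑ (λ u → k (u F.⁻¹) * f (F.1# F.- u F.⁻¹))
        ≈⟨ solve 2 (λ x y → x := (x :+ y) :- y) refl _ _ ⟩
      (∑ (λ u → k (u F.⁻¹) * f (F.1# F.- u F.⁻¹)) + ∑ rest) - ∑ rest
        ≈⟨ +-cong (sym (∑-+ (λ u → k (u F.⁻¹) * f (F.1# F.- u F.⁻¹)) rest)) (-‿cong (∑-single rest-cong F.0# rest-zero)) ⟩
      ∑ (λ u → k (u F.⁻¹) * f (F.1# F.- u F.⁻¹) + rest u) - rest F.0#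
        ≈⟨ +-congʳ (trans (∑-cong (λ u → solve 2 (λ x y → x :+ (y :- x) := y) refl (k (u F.⁻¹) * f (F.1# F.- u F.⁻¹)) (f (u F.- F.1#))))
                          (trans (sym (∑-translate (f-cong cf) F.-1#)) ∑f≈0)) ⟩
      0# - (f (F.0# F.- F.1#) - k (F.0# F.⁻¹) * f (F.1# F.- F.0# F.⁻¹))
        ≈⟨ +-congˡ (-‿cong (+-cong (f-cong cf (F.+-identityˡ _)) (-‿cong (*-congʳ (f-zero ck (F.⁻¹-zero F.refl)))))) ⟩
      0# - (f F.-1# - 0# * f (F.1# F.- F.0# F.⁻¹))
        ≈⟨ solve 2 (λ x y → con (+ 0) :- (x :- con (+ 0) :* y) := :- x) refl (f F.-1#) (f (F.1# F.- F.0# F.⁻¹)) ⟩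
      - f F.-1# ∎
      where
      -- The defect of the substitution: the two expressions agree except at u = 0, so its sum has
      -- one term.
      rest : 𝔽 → Carrier
      rest u = f (u F.- F.1#) - k (u F.⁻¹) * f (F.1# F.- u F.⁻¹)

      rest-cong : ∀ {u w} → u F.≈ w → rest u ≈ rest w
      rest-cong u≈w = +-cong (f-cong cf (F.+-congʳ u≈w))
        (-‿cong (*-cong (f-cong ck (F.⁻¹-cong u≈w)) (f-cong cf (F.+-congˡ (F.-‿cong (F.⁻¹-cong u≈w))))))

      rest-zero : ∀ u → ¬ u F.≈ F.0# → rest u ≈ 0#
      rest-zero u u≉0 = begin
        f (u F.- F.1#) - k (u F.⁻¹) * f (F.1# F.- u F.⁻¹)
          ≈⟨ +-congʳ (f-cong cf (S.begin
               u F.- F.1# S.≈⟨ F.+-cong (F.sym (F.*-identityʳ u)) (F.-‿cong (F.sym (F.*-inverse u≉0))) ⟩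
               u F.* F.1# F.- u F.* u F.⁻¹ S.≈⟨ F.solve 2 (λ u i → u F.:* F.con (+ 1) F.:- u F.:* i F.:= u F.:* (F.con (+ 1) F.:- i)) F.refl u (u F.⁻¹) ⟩
               u F.* (F.1# F.- u F.⁻¹) S.∎)) ⟩
        f (u F.* (F.1# F.- u F.⁻¹)) - k (u F.⁻¹) * f (F.1# F.- u F.⁻¹)
          ≈⟨ +-cong (f-* cf u _) (-‿cong (*-congʳ (trans (sym (inverse-at (F.⁻¹-≉0 u≉0))) (f-cong cf (F.⁻¹-involutive u))))) ⟩
        f u * f (F.1# F.- u F.⁻¹) - f u * f (F.1# F.- u F.⁻¹)
          ≈⟨ -‿inverseʳ _ ⟩
        0# ∎

    -- The convolution of f and k is f(-1)(q δ - 1) with δ the indicator of 0: away from 0 by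
    -- `J-inverse`, at 0 by counting. Convolving with h kills the constant part and leaves q. This
    -- takes the place of the product of two conjugate Gauss sums.
    J-product : ∀ {h} → IsCharacter h → ∑ f ≈ 0# → ∑ h ≈ 0# → ∑ (λ x → k x * h x) ≈ 0# →
                J k h * J f (λ x → k x * h x) ≈ f F.-1# * (order · 1#)
    J-product {h} ch ∑f≈0 ∑h≈0 ∑kh≈0 = begin
      J k h * J f (λ x → k x * h x)
        ≈⟨ ∑-*ˡ (J k h) (λ x → f x * (k (F.1# F.- x) * h (F.1# F.- x))) ⟨
      ∑ (λ x → J k h * (f x * (k (F.1# F.- x) * h (F.1# F.- x))))
        ≈⟨ ∑-cong (λ x → trans (solve 3 (λ a b c → a :* (b :* c) := b :* (a :* c)) refl (J k h) (f x) _)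
                               (*-congˡ (sym (convolution≈ ck ch ∑kh≈0 (F.1# F.- x))))) ⟩
      ∑ (λ x → f x * convolution k h (F.1# F.- x))
        ≈⟨ convolution-assoc {f} ck ch ⟨
      ∑ (λ s → convolution f k s * h (F.1# F.- s))
        ≈⟨ solve 2 (λ x y → x := (x :+ y) :- y) refl _ _ ⟩
      (∑ (λ s → convolution f k s * h (F.1# F.- s)) + ∑ (λ s → f F.-1# * h (F.1# F.- s))) - ∑ (λ s → f F.-1# * h (F.1# F.- s))
        ≈⟨ +-cong (sym (∑-+ (λ s → convolution f k s * h (F.1# F.- s)) (λ s → f F.-1# * h (F.1# F.- s))))
                  (-‿cong (trans (∑-*ˡ (f F.-1#) (λ s → h (F.1# F.- s))) (trans (*-congˡ (trans (sym (∑-reflect (f-cong ch) F.1#)) ∑h≈0)) (zeroʳ _)))) ⟩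
      ∑ (λ s → convolution f k s * h (F.1# F.- s) + f F.-1# * h (F.1# F.- s)) - 0#
        ≈⟨ +-congʳ (trans (∑-cong (λ s → sym (distribʳ (h (F.1# F.- s)) (convolution f k s) (f F.-1#))))
                          (∑-single term-cong F.0# term-zero)) ⟩
      (convolution f k F.0# + f F.-1#) * h (F.1# F.- F.0#) - 0#
        ≈⟨ +-congʳ (*-cong (+-congʳ (trans (convolution-at-0 {f} ck F.refl) (*-cong k[-1] ∑fk≈order-1)))
                           (trans (f-cong ch (F.solve 0 (F.con (+ 1) F.:- F.con (+ 0) F.:= F.con (+ 1)) F.refl)) (f-1 ch))) ⟩
      (f F.-1# * (order · 1# - 1#) + f F.-1#) * 1# - 0#
        ≈⟨ solve 2 (λ x y → (x :* (y :- con (+ 1)) :+ x) :* con (+ 1) :- con (+ 0) := x :* y) refl (f F.-1#) (order · 1#) ⟩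
      f F.-1# * (order · 1#) ∎
      where
      convolution-cong : ∀ {s t} → s F.≈ t → convolution f k s ≈ convolution f k t
      convolution-cong s≈t = ∑-cong (λ x → *-congˡ {f x} (f-cong ck (F.+-congʳ {F.- x} s≈t)))

      term-cong : ∀ {s t} → s F.≈ t → (convolution f k s + f F.-1#) * h (F.1# F.- s) ≈ (convolution f k t + f F.-1#) * h (F.1# F.- t)
      term-cong s≈t = *-cong (+-congʳ (convolution-cong s≈t)) (f-cong ch (F.+-congˡ (F.-‿cong s≈t)))

      term-zero : ∀ s → ¬ s F.≈ F.0# → (convolution f k s + f F.-1#) * h (F.1# F.- s) ≈ 0#
      term-zero s s≉0 = begin
        (convolution f k s + f F.-1#) * h (F.1# F.- s)
          ≈⟨ *-congʳ (+-congʳ (trans (convolution-scale cf ck s≉0) (*-cong (J-inverse ∑f≈0) (fk≈1 s s≉0)))) ⟩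
        (- f F.-1# * 1# + f F.-1#) * h (F.1# F.- s)
          ≈⟨ solve 2 (λ x y → (:- x :* con (+ 1) :+ x) :* y := con (+ 0)) refl (f F.-1#) (h (F.1# F.- s)) ⟩
        0# ∎

  -- Put y = 1/w in the sum of g(y) f(1 - y). Since 1 - 1/w = -(1 - w)/w, the factors f(1/w) and
  -- g(1/w) combine to k(w), and f(-1) remains.
  J-reflection : ∀ {f g k} → IsCharacter f → IsCharacter g → IsCharacter k → Inverse[ (λ v → f v * g v) , k ] →
                 J f g ≈ f F.-1# * J f k
  J-reflection {f} {g} {k} cf cg ck fgk≈1 = begin
    J f g
      ≈⟨ J-comm cf cg ⟩
    ∑ (λ y → g y * f (F.1# F.- y))
      ≈⟨ ∑-invert (λ v≈w → *-cong (f-cong cg v≈w) (f-cong cf (F.+-congˡ (F.-‿cong v≈w)))) ⟩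
    ∑ (λ w → g (w F.⁻¹) * f (F.1# F.- w F.⁻¹))
      ≈⟨ ∑-cong pointwise ⟩
    ∑ (λ w → f F.-1# * (k w * f (F.1# F.- w)))
      ≈⟨ ∑-*ˡ (f F.-1#) (λ w → k w * f (F.1# F.- w)) ⟩
    f F.-1# * J k f
      ≈⟨ *-congˡ (J-comm ck cf) ⟩
    f F.-1# * J f k ∎
    where
    pointwise : ∀ w → g (w F.⁻¹) * f (F.1# F.- w F.⁻¹) ≈ f F.-1# * (k w * f (F.1# F.- w))
    pointwise w with w F.≟ F.0#
    ... | yes w≈0 = trans (*-congʳ (f-zero cg (F.⁻¹-zero w≈0))) (trans
          (solve 3 (λ x y z → con (+ 0) :* x := y :* (con (+ 0) :* z)) refl _ _ _) (*-congˡ (*-congʳ (sym (f-zero ck w≈0)))))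
    ... | no  w≉0 = begin
      g (w F.⁻¹) * f (F.1# F.- w F.⁻¹)
        ≈⟨ *-congˡ (f-cong cf (S.begin
             F.1# F.- w F.⁻¹ S.≈⟨ F.+-congʳ (F.sym (F.*-inverse w≉0)) ⟩
             w F.* w F.⁻¹ F.- w F.⁻¹ S.≈⟨ F.solve 2 (λ w i → w F.:* i F.:- i F.:= F.:- (F.con (+ 1) F.:- w) F.:* i) F.refl w (w F.⁻¹) ⟩
             F.- (F.1# F.- w) F.* w F.⁻¹ S.∎)) ⟩
      g (w F.⁻¹) * f (F.- (F.1# F.- w) F.* w F.⁻¹)
        ≈⟨ *-congˡ (trans (f-* cf _ _) (*-congʳ (f-neg cf _))) ⟩
      g (w F.⁻¹) * (f F.-1# * f (F.1# F.- w) * f (w F.⁻¹))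
        ≈⟨ solve 4 (λ a b c d → a :* (b :* c :* d) := b :* ((d :* a) :* c)) refl (g (w F.⁻¹)) (f F.-1#) (f (F.1# F.- w)) (f (w F.⁻¹)) ⟩
      f F.-1# * ((f (w F.⁻¹) * g (w F.⁻¹)) * f (F.1# F.- w))
        ≈⟨ *-congˡ (*-congʳ (inverse-unique
             (trans (solve 4 (λ a b c d → (a :* b) :* (c :* d) := (a :* c) :* (b :* d)) refl (f w) (g w) (f (w F.⁻¹)) (g (w F.⁻¹)))
                    (trans (*-cong (f-⁻¹ cf w≉0) (f-⁻¹ cg w≉0)) (*-identityˡ 1#)))
             (fgk≈1 w w≉0))) ⟩
      f F.-1# * (k w * f (F.1# F.- w)) ∎

  -- Squares in the field and the duplication formula.

  sum-pairs : ∀ n (f : ℕ → Carrier) → sum {n ℕ.* 2} (λ k → f (toℕ k)) ≈ sum {n} (λ k → f (toℕ k ℕ.* 2) + f (suc (toℕ k ℕ.* 2)))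
  sum-pairs zero    f = refl
  sum-pairs (suc n) f = trans (sym (+-assoc _ _ _)) (+-congˡ (sum-pairs n (λ k → f (suc (suc k)))))

  two : 𝔽
  two = F.1# F.+ F.1#

  module _ {γ : 𝔽} (generates : FiniteField.IsGenerator F γ) {M : ℕ} (order-1≡M*2 : order ℕ.∸ 1 ≡ M ℕ.* 2) where

    private
      γ^[M*2]≈1 : γ F.^ (M ℕ.* 2) F.≈ F.1#
      γ^[M*2]≈1 = F.trans (F.^-congʳ γ (≡.sym order-1≡M*2)) (F.γ^[order-1]≈1 generates)

      0<M : 0 < M
      0<M = ℕ.n≢0⇒n>0 (λ M≡0 → contradiction (F.0<order-1 generates)
        (ℕ.≤⇒≯ (ℕ.≤-reflexive (≡.trans order-1≡M*2 (≡.cong (ℕ._* 2) M≡0)))))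

      γ^M≉1 : ¬ γ F.^ M F.≈ F.1#
      γ^M≉1 γ^M≈1 = contradiction (ℕ∣.∣⇒≤ {{ℕ.>-nonZero 0<M}} (F.γ^k≈1⇒order-1∣k generates M γ^M≈1))
        (ℕ.<⇒≱ (≡.subst (M <_) (≡.sym (≡.trans order-1≡M*2 (≡.trans (ℕ.*-comm M 2) (≡.cong (M ℕ.+_) (ℕ.+-identityʳ M))))) (ℕ.m<m+n M 0<M)))

    γ^M≈-1 : γ F.^ M F.≈ F.- F.1#
    γ^M≈-1 = S.begin
      γ F.^ M S.≈⟨ F.solve 1 (λ x → x F.:= (x F.:+ F.con (+ 1)) F.:- F.con (+ 1)) F.refl (γ F.^ M) ⟩
      γ F.^ M F.+ F.1# F.- F.1# S.≈⟨ F.+-congʳ (F.*-cancel-0 difference-of-squares γ^M-1≉0) ⟩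
      F.0# F.- F.1# S.≈⟨ F.+-identityˡ _ ⟩
      F.- F.1# S.∎
      where
      γ^M-1≉0 : ¬ γ F.^ M F.- F.1# F.≈ F.0#
      γ^M-1≉0 eq = γ^M≉1 (F.trans (F.solve 1 (λ x → x F.:= (x F.:- F.con (+ 1)) F.:+ F.con (+ 1)) F.refl _) (F.trans (F.+-congʳ eq) (F.+-identityˡ _)))

      difference-of-squares : (γ F.^ M F.- F.1#) F.* (γ F.^ M F.+ F.1#) F.≈ F.0#
      difference-of-squares = S.begin
        (γ F.^ M F.- F.1#) F.* (γ F.^ M F.+ F.1#) S.≈⟨ F.solve 1 (λ x → (x F.:- F.con (+ 1)) F.:* (x F.:+ F.con (+ 1)) F.:= x F.:^ 2 F.:- F.con (+ 1)) F.refl _ ⟩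
        (γ F.^ M) F.^ 2 F.- F.1# S.≈⟨ F.+-congʳ (F.trans (F.^-assocʳ γ M 2) γ^[M*2]≈1) ⟩
        F.1# F.- F.1# S.≈⟨ F.-‿inverseʳ _ ⟩
        F.0# S.∎

    -- If 2 were 0, then `γ ^ M`, which is -1, would be 1 although M is below the order of γ.
    two≉0 : ¬ two F.≈ F.0#
    two≉0 2≈0 = γ^M≉1 (F.trans γ^M≈-1 (F.trans (F.solve 0 (F.:- F.con (+ 1) F.:= F.con (+ 1) F.:- (F.con (+ 1) F.:+ F.con (+ 1))) F.refl)
      (F.trans (F.+-congˡ (F.-‿cong 2≈0)) (F.solve 0 (F.con (+ 1) F.:- F.con (+ 0) F.:= F.con (+ 1)) F.refl))))

    module _ {η : 𝔽 → Carrier} (cη : IsCharacter η) (ηγ≈-1 : η γ ≈ - 1#) where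

      private
        η[γ^2k] : ∀ k → η (γ F.^ (k ℕ.* 2)) ≈ 1#
        η[γ^2k] zero    = f-1 cη
        η[γ^2k] (suc k) = begin
          η (γ F.* (γ F.* γ F.^ (k ℕ.* 2))) ≈⟨ trans (f-* cη _ _) (*-cong ηγ≈-1 (trans (f-* cη _ _) (*-cong ηγ≈-1 (η[γ^2k] k)))) ⟩
          - 1# * (- 1# * 1#) ≈⟨ solve 0 (:- con (+ 1) :* (:- con (+ 1) :* con (+ 1)) := con (+ 1)) refl ⟩
          1# ∎

        η[γ^[1+2k]] : ∀ k → η (γ F.^ suc (k ℕ.* 2)) ≈ - 1#
        η[γ^[1+2k]] k = trans (f-* cη _ _) (trans (*-cong ηγ≈-1 (η[γ^2k] k)) (*-identityʳ _))

      -- t is the square of 1 + η t elements of the field.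
      ∑-squares : ∀ {G : 𝔽 → Carrier} → (∀ {x y} → x F.≈ y → G x ≈ G y) → ∑ (λ v → G (v F.* v)) ≈ ∑ (λ t → G t * (1# + η t))
      ∑-squares {G} G-cong = begin
        ∑ (λ v → G (v F.* v))
          ≈⟨ F.∑-powers generates +-commutativeMonoid (λ v≈w → G-cong (F.*-cong v≈w v≈w)) ⟩
        G (F.0# F.* F.0#) + sum {order ℕ.∸ 1} (λ k → G (γ F.^ toℕ k F.* γ F.^ toℕ k))
          ≈⟨ +-cong at-zero (trans (sum-cong-≋ {order ℕ.∸ 1} (λ k → G-cong (double (toℕ k)))) squares) ⟩
        G F.0# * (1# + η F.0#) + sum {order ℕ.∸ 1} (λ k → G (γ F.^ toℕ k) * (1# + η (γ F.^ toℕ k)))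
          ≈⟨ F.∑-powers generates +-commutativeMonoid (λ v≈w → *-cong (G-cong v≈w) (+-congˡ (f-cong cη v≈w))) ⟨
        ∑ (λ t → G t * (1# + η t)) ∎
        where
        at-zero : G (F.0# F.* F.0#) ≈ G F.0# * (1# + η F.0#)
        at-zero = begin
          G (F.0# F.* F.0#) ≈⟨ G-cong (F.zeroˡ _) ⟩
          G F.0# ≈⟨ solve 1 (λ x → x := x :* (con (+ 1) :+ con (+ 0))) refl (G F.0#) ⟩
          G F.0# * (1# + 0#) ≈⟨ *-congˡ (+-congˡ (f-0 cη)) ⟨
          G F.0# * (1# + η F.0#) ∎

        double : ∀ k → γ F.^ k F.* γ F.^ k F.≈ γ F.^ (k ℕ.* 2)
        double k = F.trans (F.sym (F.^-homo-* γ k k)) (F.^-congʳ γ (k+k≡k*2 k))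
          where
          k+k≡k*2 : ∀ k → k ℕ.+ k ≡ k ℕ.* 2
          k+k≡k*2 = ℕ-solve

        H : ℕ → Carrier
        H k = G (γ F.^ k) * (1# + η (γ F.^ k))

        shifted : ∀ k → γ F.^ ((M ℕ.+ k) ℕ.* 2) F.≈ γ F.^ (k ℕ.* 2)
        shifted k = F.trans (F.^-congʳ γ (rearrange M k)) (F.trans (F.^-homo-* γ (M ℕ.* 2) (k ℕ.* 2))
          (F.trans (F.*-congʳ γ^[M*2]≈1) (F.*-identityˡ _)))
          where
          rearrange : ∀ M k → (M ℕ.+ k) ℕ.* 2 ≡ M ℕ.* 2 ℕ.+ k ℕ.* 2
          rearrange = ℕ-solve

        pair : ∀ k → H (k ℕ.* 2) + H (suc (k ℕ.* 2)) ≈ G (γ F.^ (k ℕ.* 2)) + G (γ F.^ (k ℕ.* 2))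
        pair k = trans (+-cong (*-congˡ (+-congˡ (η[γ^2k] k))) (*-congˡ (+-congˡ (η[γ^[1+2k]] k))))
          (solve 2 (λ x y → x :* (con (+ 1) :+ con (+ 1)) :+ y :* (con (+ 1) :+ :- con (+ 1)) := x :+ x) refl (G (γ F.^ (k ℕ.* 2))) (G (γ F.^ suc (k ℕ.* 2))))

        M+M≡M*2 : ∀ M → M ℕ.* 2 ≡ M ℕ.+ M
        M+M≡M*2 = ℕ-solve

        E : ℕ → Carrier
        E k = G (γ F.^ (k ℕ.* 2))

        -- Squaring runs twice through the even exponents below 2M. On the right the weight 1 + η is
        -- 2 at even and 0 at odd exponents, so grouping neighbouring exponents gives the same sum.
        squares : sum {order ℕ.∸ 1} (λ k → E (toℕ k)) ≈ sum {order ℕ.∸ 1} (λ k → H (toℕ k))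
        squares = begin
          sum {order ℕ.∸ 1} (λ k → E (toℕ k))
            ≡⟨ ≡.cong (λ n → sum {n} (λ k → E (toℕ k))) (≡.trans order-1≡M*2 (M+M≡M*2 M)) ⟩
          sum {M ℕ.+ M} (λ k → E (toℕ k))
            ≈⟨ Sums.sum-split +-commutativeMonoid M M E ⟩
          sum {M} (λ k → E (toℕ k)) + sum {M} (λ k → E (M ℕ.+ toℕ k))
            ≈⟨ +-congˡ (sum-cong-≋ {M} (λ k → G-cong (shifted (toℕ k)))) ⟩
          sum {M} (λ k → E (toℕ k)) + sum {M} (λ k → E (toℕ k))
            ≈⟨ ∑-distrib-+ {M} (λ k → E (toℕ k)) (λ k → E (toℕ k)) ⟨
          sum {M} (λ k → E (toℕ k) + E (toℕ k))
            ≈⟨ sum-cong-≋ {M} (λ k → pair (toℕ k)) ⟨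
          sum {M} (λ k → H (toℕ k ℕ.* 2) + H (suc (toℕ k ℕ.* 2)))
            ≈⟨ sum-pairs M H ⟨
          sum {M ℕ.* 2} (λ k → H (toℕ k))
            ≡⟨ ≡.cong (λ n → sum {n} (λ k → H (toℕ k))) order-1≡M*2 ⟨
          sum {order ℕ.∸ 1} (λ k → H (toℕ k)) ∎

      -- Completing the square: x (1 - x) = (1 - v²) / 4 for x = (1 + v) / 2.
      J-duplication : ∀ {f k} → IsCharacter f → Inverse[ f , k ] → ∑ f ≈ 0# → J f f ≈ k two * k two * J f η
      J-duplication {f} {k} cf fk≈1 ∑f≈0 = begin
        J f f
          ≈⟨ ∑-scale {λ x → f x * f (F.1# F.- x)} G-cong (F.⁻¹-≉0 two≉0) ⟩
        ∑ (λ v → f (½ F.* v) * f (F.1# F.- ½ F.* v))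
          ≈⟨ ∑-translate {λ v → f (½ F.* v) * f (F.1# F.- ½ F.* v)} (λ v≈w → G-cong (F.*-congˡ v≈w)) F.1# ⟩
        ∑ (λ v → f (½ F.* (v F.+ F.1#)) * f (F.1# F.- ½ F.* (v F.+ F.1#)))
          ≈⟨ ∑-cong complete-square ⟩
        ∑ (λ v → k two * k two * f (F.1# F.- v F.* v))
          ≈⟨ ∑-*ˡ (k two * k two) (λ v → f (F.1# F.- v F.* v)) ⟩
        k two * k two * ∑ (λ v → f (F.1# F.- v F.* v))
          ≈⟨ *-congˡ (∑-squares {λ t → f (F.1# F.- t)} (λ v≈w → f-cong cf (F.+-congˡ (F.-‿cong v≈w)))) ⟩
        k two * k two * ∑ (λ t → f (F.1# F.- t) * (1# + η t))
          ≈⟨ *-congˡ (trans (∑-cong (λ t → solve 2 (λ x y → x :* (con (+ 1) :+ y) := x :+ y :* x) refl (f (F.1# F.- t)) (η t)))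
                            (∑-+ (λ t → f (F.1# F.- t)) (λ t → η t * f (F.1# F.- t)))) ⟩
        k two * k two * (∑ (λ t → f (F.1# F.- t)) + J η f)
          ≈⟨ *-congˡ (+-cong (trans (sym (∑-reflect (f-cong cf) F.1#)) ∑f≈0) (J-comm cη cf)) ⟩
        k two * k two * (0# + J f η)
          ≈⟨ *-congˡ (+-identityˡ _) ⟩
        k two * k two * J f η ∎
        where
        ½ : 𝔽
        ½ = two F.⁻¹

        G-cong : ∀ {x y} → x F.≈ y → f x * f (F.1# F.- x) ≈ f y * f (F.1# F.- y)
        G-cong x≈y = *-cong (f-cong cf x≈y) (f-cong cf (F.+-congˡ (F.-‿cong x≈y)))

        f½≈k2 : f ½ ≈ k two
        f½≈k2 = inverse-unique (f-⁻¹ cf two≉0) (fk≈1 two two≉0)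

        1-½[v+1] : ∀ v → F.1# F.- ½ F.* (v F.+ F.1#) F.≈ ½ F.* (F.1# F.- v)
        1-½[v+1] v = F.trans (F.+-congʳ (F.sym (F.*-inverse two≉0)))
          (F.solve 2 (λ h v → (F.con (+ 1) F.:+ F.con (+ 1)) F.:* h F.:- h F.:* (v F.:+ F.con (+ 1)) F.:= h F.:* (F.con (+ 1) F.:- v)) F.refl ½ v)

        complete-square : ∀ v → f (½ F.* (v F.+ F.1#)) * f (F.1# F.- ½ F.* (v F.+ F.1#)) ≈ k two * k two * f (F.1# F.- v F.* v)
        complete-square v = begin
          f (½ F.* (v F.+ F.1#)) * f (F.1# F.- ½ F.* (v F.+ F.1#))
            ≈⟨ *-cong (f-* cf _ _) (trans (f-cong cf (1-½[v+1] v)) (f-* cf _ _)) ⟩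
          (f ½ * f (v F.+ F.1#)) * (f ½ * f (F.1# F.- v))
            ≈⟨ *-cong (*-congʳ f½≈k2) (*-congʳ f½≈k2) ⟩
          (k two * f (v F.+ F.1#)) * (k two * f (F.1# F.- v))
            ≈⟨ solve 3 (λ a b c → (a :* b) :* (a :* c) := a :* a :* (b :* c)) refl (k two) (f (v F.+ F.1#)) (f (F.1# F.- v)) ⟩
          k two * k two * (f (v F.+ F.1#) * f (F.1# F.- v))
            ≈⟨ *-congˡ (trans (sym (f-* cf _ _)) (f-cong cf (F.solve 1 (λ v → (v F.:+ F.con (+ 1)) F.:* (F.con (+ 1) F.:- v) F.:= F.con (+ 1) F.:- v F.:* v) F.refl v))) ⟩
          k two * k two * f (F.1# F.- v F.* v) ∎

-- Powers of a character of order e and their Jacobi sums.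

module CharacterPowers (F : FiniteField a ℓ₁ ℓ₂) {γ : FiniteField.Carrier F} (generates : FiniteField.IsGenerator F γ)
                       (K : HeytingField b c ℓ) (e : ℕ) .{{_ : NonZero e}}
                       {ζ : CommutativeRing.Carrier (fieldRing K)} (ζ-primitive : RingNotions.IsPrimitiveRoot (fieldRing K) e ζ)
                       {χ : FiniteField.Carrier F → CommutativeRing.Carrier (fieldRing K)}
                       (χ-character : Characters.IsMultiplicativeCharacter F (fieldRing K) χ)
                       (χγ≈ζ : CommutativeRing._≈_ (fieldRing K) (χ γ) ζ) where

  private
    R : CommutativeRing b c
    R = fieldRing K
    module F = FiniteFields F
  open FiniteField F using (order; ind) renaming (Carrier to 𝔽)
  open CommutativeRing R hiding (zero)
  open RingNotions R
  open Characters F R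
  open IsMultiplicativeCharacter χ-character using (1-homo; *-homo) renaming (cong to χ-cong)
  open Powers R
  open IntegerMultiples R using (solve; _:=_; _:+_; _:*_; _:-_; :-_; con)
  open Domains K
  open Mult semiring using () renaming (_×_ to _·_)
  open FiniteFields.RingSummation F R
  open JacobiSums F R
  open IsCharacter
  open SetoidReasoning setoid

  χ^ : ℤ → 𝔽 → Carrier
  χ^ = charPower e χ

  ζ^e≈1 : ζ ^ e ≈ 1#
  ζ^e≈1 = proj₁ ζ-primitive

  χ-power : ∀ k → χ (γ F.^ k) ≈ ζ ^ k
  χ-power zero    = 1-homo
  χ-power (suc k) = trans (*-homo (proj₁ generates) (F.≉0⇒#0 (F.^-≉0 k (F.generator-≉0 generates)))) (*-cong χγ≈ζ (χ-power k))

  χ≈ζ^ind : ∀ {v} → ¬ v F.≈ F.0# → χ v ≈ ζ ^ ind γ v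
  χ≈ζ^ind {v} v≉0 = trans (χ-cong (F.sym (F.γ^ind≈ generates v≉0))) (χ-power (ind γ v))

  χ^-zero : ∀ i {v} → v F.≈ F.0# → χ^ i v ≈ 0#
  χ^-zero i {v} v≈0 = if-elim (_≈ 0#) (v F.≟ F.0#) (λ _ → refl) (contradiction v≈0)

  χ^≈powMod-χ : ∀ i {v} → ¬ v F.≈ F.0# → χ^ i v ≈ powMod e (χ v) i
  χ^≈powMod-χ i {v} v≉0 = if-elim (_≈ powMod e (χ v) i) (v F.≟ F.0#) (λ v≈0 → contradiction v≈0 v≉0) (λ _ → refl)

  χ^≈powMod : ∀ i {v} → ¬ v F.≈ F.0# → χ^ i v ≈ powMod e ζ (+ ind γ v ℤ.* i)
  χ^≈powMod i {v} v≉0 = begin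
    χ^ i v ≈⟨ χ^≈powMod-χ i v≉0 ⟩
    powMod e (χ v) i ≈⟨ powMod-cong e i (trans (χ≈ζ^ind v≉0) (sym (powMod-pos e ζ^e≈1 (ind γ v)))) ⟩
    powMod e (powMod e ζ (+ ind γ v)) i ≈⟨ powMod-* e ζ^e≈1 (+ ind γ v) i ⟨
    powMod e ζ (+ ind γ v ℤ.* i) ∎

  χ^-character : ∀ i → IsCharacter (χ^ i)
  χ^-character i = record
    { f-cong = χ^-cong
    ; f-0    = χ^-zero i F.refl
    ; f-1    = trans (χ^≈powMod-χ i F.1≉0) (trans (powMod-cong e i 1-homo) (1^n≈1 (i %ℕ e)))
    ; f-*    = χ^-*
    }
    where
    χ^-cong : ∀ {x y} → x F.≈ y → χ^ i x ≈ χ^ i y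
    χ^-cong {x} {y} x≈y with y F.≟ F.0#
    ... | yes y≈0 = trans (χ^-zero i (F.trans x≈y y≈0)) (sym (χ^-zero i y≈0))
    ... | no  y≉0 = trans (χ^≈powMod-χ i (λ x≈0 → y≉0 (F.trans (F.sym x≈y) x≈0)))
      (trans (powMod-cong e i (χ-cong x≈y)) (sym (χ^≈powMod-χ i y≉0)))

    χ^-* : ∀ x y → χ^ i (x F.* y) ≈ χ^ i x * χ^ i y
    χ^-* x y with x F.≟ F.0# | y F.≟ F.0#
    ... | yes x≈0 | _       = trans (χ^-zero i (F.trans (F.*-congʳ x≈0) (F.zeroˡ y))) (sym (trans (*-congʳ (χ^-zero i x≈0)) (zeroˡ _)))
    ... | no  _   | yes y≈0 = trans (χ^-zero i (F.trans (F.*-congˡ y≈0) (F.zeroʳ x))) (sym (trans (*-congˡ (χ^-zero i y≈0)) (zeroʳ _)))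
    ... | no  x≉0 | no  y≉0 = begin
      χ^ i (x F.* y) ≈⟨ χ^≈powMod-χ i (F.*-≉0 x≉0 y≉0) ⟩
      powMod e (χ (x F.* y)) i ≈⟨ powMod-cong e i (*-homo (F.≉0⇒#0 x≉0) (F.≉0⇒#0 y≉0)) ⟩
      powMod e (χ x * χ y) i ≈⟨ ^-distrib-* (χ x) (χ y) (i %ℕ e) ⟩
      powMod e (χ x) i * powMod e (χ y) i ≈⟨ *-cong (χ^≈powMod-χ i x≉0) (χ^≈powMod-χ i y≉0) ⟨
      χ^ i x * χ^ i y ∎

  χ^-resp : ∀ {i} j t → i ≡ j ℤ.+ t ℤ.* + e → ∀ v → χ^ i v ≈ χ^ j v
  χ^-resp {i} j t ≡.refl v with v F.≟ F.0#
  ... | yes v≈0 = trans (χ^-zero i v≈0) (sym (χ^-zero j v≈0))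
  ... | no  v≉0 = trans (χ^≈powMod-χ i v≉0) (trans (powMod-shift e χv^e≈1 j t) (sym (χ^≈powMod-χ j v≉0)))
    where
    χv^e≈1 : χ v ^ e ≈ 1#
    χv^e≈1 = begin
      χ v ^ e ≈⟨ ^-congˡ e (trans (χ≈ζ^ind v≉0) (sym (powMod-pos e ζ^e≈1 (ind γ v)))) ⟩
      powMod e ζ (+ ind γ v) ^ e ≈⟨ powMod^e≈1 e ζ^e≈1 (+ ind γ v) ⟩
      1# ∎

  χ^-+ : ∀ i j v → χ^ i v * χ^ j v ≈ χ^ (i ℤ.+ j) v
  χ^-+ i j v with v F.≟ F.0#
  ... | yes v≈0 = trans (*-congʳ (χ^-zero i v≈0)) (trans (zeroˡ _) (sym (χ^-zero (i ℤ.+ j) v≈0)))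
  ... | no  v≉0 = begin
    χ^ i v * χ^ j v
      ≈⟨ *-cong (χ^≈powMod i v≉0) (χ^≈powMod j v≉0) ⟩
    powMod e ζ (+ ind γ v ℤ.* i) * powMod e ζ (+ ind γ v ℤ.* j)
      ≈⟨ powMod-+ e ζ^e≈1 (+ ind γ v ℤ.* i) (+ ind γ v ℤ.* j) ⟨
    powMod e ζ (+ ind γ v ℤ.* i ℤ.+ + ind γ v ℤ.* j)
      ≡⟨ ≡.cong (powMod e ζ) (ℤ.*-distribˡ-+ (+ ind γ v) i j) ⟨
    powMod e ζ (+ ind γ v ℤ.* (i ℤ.+ j))
      ≈⟨ χ^≈powMod (i ℤ.+ j) v≉0 ⟨
    χ^ (i ℤ.+ j) v ∎

  χ^-+-resp : ∀ i j k t → i ℤ.+ j ≡ k ℤ.+ t ℤ.* + e → ∀ v → χ^ i v * χ^ j v ≈ χ^ k v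
  χ^-+-resp i j k t eq v = trans (χ^-+ i j v) (χ^-resp k t eq v)

  χ^-trivial : ∀ t {i} → i ≡ t ℤ.* + e → ∀ {v} → ¬ v F.≈ F.0# → χ^ i v ≈ 1#
  χ^-trivial t {i} eq {v} v≉0 = begin
    χ^ i v ≈⟨ χ^-resp (+ 0) t (≡.trans eq (≡.sym (ℤ.+-identityˡ _))) v ⟩
    χ^ (+ 0) v ≈⟨ χ^≈powMod (+ 0) v≉0 ⟩
    powMod e ζ (+ ind γ v ℤ.* + 0) ≡⟨ ≡.cong (powMod e ζ) (ℤ.*-zeroʳ (+ ind γ v)) ⟩
    powMod e ζ (+ 0) ≈⟨ powMod-pos e ζ^e≈1 0 ⟩
    1# ∎

  χ^-inverse : ∀ i j t → i ℤ.+ j ≡ t ℤ.* + e → Inverse[ χ^ i , χ^ j ]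
  χ^-inverse i j t eq v v≉0 = trans (χ^-+ i j v) (χ^-trivial t eq v≉0)

  χ^-inverse₃ : ∀ i j k t → i ℤ.+ j ℤ.+ k ≡ t ℤ.* + e → Inverse[ (λ v → χ^ i v * χ^ j v) , χ^ k ]
  χ^-inverse₃ i j k t eq v v≉0 = trans (*-congʳ (χ^-+ i j v)) (χ^-inverse (i ℤ.+ j) k t eq v v≉0)

  χ^-even[-1] : ∀ {i} j → i ≡ j ℤ.+ j → χ^ i F.-1# ≈ 1#
  χ^-even[-1] j ≡.refl = trans (sym (χ^-+ j j F.-1#)) (f[-1]² (χ^-character j))

  Nontrivial : ℤ → Set
  Nontrivial i = ∀ t → ¬ i ≡ t ℤ.* + e

  -- Scaling the variable by γ multiplies the sum by `χ^ i γ`, which is not 1 because ζ is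
  -- primitive.
  ∑χ^≈0 : ∀ {i} → Nontrivial i → ∑ (χ^ i) ≈ 0#
  ∑χ^≈0 {i} nontrivial = *-cancel-0 (begin
    (1# - χ^ i γ) * ∑ (χ^ i) ≈⟨ solve 2 (λ x y → (con (+ 1) :- x) :* y := y :- x :* y) refl (χ^ i γ) (∑ (χ^ i)) ⟩
    ∑ (χ^ i) - χ^ i γ * ∑ (χ^ i) ≈⟨ +-congˡ (-‿cong (begin
      χ^ i γ * ∑ (χ^ i) ≈⟨ ∑-*ˡ (χ^ i γ) (χ^ i) ⟨
      ∑ (λ v → χ^ i γ * χ^ i v) ≈⟨ ∑-cong (λ v → f-* (χ^-character i) γ v) ⟨
      ∑ (λ v → χ^ i (γ F.* v)) ≈⟨ ∑-scale (f-cong (χ^-character i)) (F.generator-≉0 generates) ⟨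
      ∑ (χ^ i) ∎)) ⟩
    ∑ (χ^ i) - ∑ (χ^ i) ≈⟨ -‿inverseʳ _ ⟩
    0# ∎)
    (λ 1-Cγ≈0 → ζ^r≉1 (begin
      ζ ^ r ≈⟨ powMod-cong e i χγ≈ζ ⟨
      powMod e (χ γ) i ≈⟨ χ^≈powMod-χ i (F.generator-≉0 generates) ⟨
      χ^ i γ ≈⟨ solve 1 (λ x → x := con (+ 1) :- (con (+ 1) :- x)) refl (χ^ i γ) ⟩
      1# - (1# - χ^ i γ) ≈⟨ +-congˡ (-‿cong 1-Cγ≈0) ⟩
      1# - 0# ≈⟨ solve 0 (con (+ 1) :- con (+ 0) := con (+ 1)) refl ⟩
      1# ∎))
    where
    r = i %ℕ e
    ζ^r≉1 : ¬ ζ ^ r ≈ 1#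
    ζ^r≉1 = proj₂ ζ-primitive r
      (ℕ.n≢0⇒n>0 (λ r≡0 → nontrivial (i /ℕ e) (≡.trans (ℤ.a≡a%ℕn+[a/ℕn]*n i e)
        (≡.trans (≡.cong (λ k → + k ℤ.+ i /ℕ e ℤ.* + e) r≡0) (ℤ.+-identityˡ _)))))
      (ℤ.n%ℕd<d i e)

  Jc : ℤ → ℤ → Carrier
  Jc i j = J (χ^ i) (χ^ j)

  Jc-comm : ∀ i j → Jc i j ≈ Jc j i
  Jc-comm i j = J-comm (χ^-character i) (χ^-character j)

  Jc-resp : ∀ {i j} i′ j′ s t → i ≡ i′ ℤ.+ s ℤ.* + e → j ≡ j′ ℤ.+ t ℤ.* + e → Jc i j ≈ Jc i′ j′
  Jc-resp i′ j′ s t eq eq′ = J-cong (χ^-resp i′ s eq) (χ^-resp j′ t eq′)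

  -- The substitution v ↦ -v turns v + 1 into 1 - v and costs the value of the first character at
  -- -1.
  jacobiSum≈ : ∀ i j → jacobiSum e χ i j ≈ χ^ i F.-1# * Jc i j
  jacobiSum≈ i j = begin
    ∑ (λ v → χ^ i v * χ^ j (v F.+ F.1#))
      ≈⟨ ∑-reflect {λ v → χ^ i v * χ^ j (v F.+ F.1#)} (λ v≈w → *-cong (f-cong (χ^-character i) v≈w) (f-cong (χ^-character j) (F.+-congʳ v≈w))) F.0# ⟩
    ∑ (λ v → χ^ i (F.0# F.- v) * χ^ j (F.0# F.- v F.+ F.1#))
      ≈⟨ ∑-cong (λ v → trans (*-cong (trans (f-cong (χ^-character i) (F.+-identityˡ (F.- v))) (f-neg (χ^-character i) v))
                                     (f-cong (χ^-character j) (F.solve 1 (λ v → F.con (+ 0) F.:- v F.:+ F.con (+ 1) F.:= F.con (+ 1) F.:- v) F.refl v)))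
                             (*-assoc _ _ _)) ⟩
    ∑ (λ v → χ^ i F.-1# * (χ^ i v * χ^ j (F.1# F.- v)))
      ≈⟨ ∑-*ˡ (χ^ i F.-1#) (λ v → χ^ i v * χ^ j (F.1# F.- v)) ⟩
    χ^ i F.-1# * Jc i j ∎

  Jc-reflection : ∀ i j k t → i ℤ.+ j ℤ.+ k ≡ t ℤ.* + e → Jc i j ≈ χ^ i F.-1# * Jc i k
  Jc-reflection i j k t eq = J-reflection (χ^-character i) (χ^-character j) (χ^-character k) (χ^-inverse₃ i j k t eq)

  private
    ∑χ^χ^≈0 : ∀ i j k t → i ℤ.+ j ≡ k ℤ.+ t ℤ.* + e → Nontrivial k → ∑ (λ v → χ^ i v * χ^ j v) ≈ 0#
    ∑χ^χ^≈0 i j k t eq nontrivial = trans (∑-cong (χ^-+-resp i j k t eq)) (∑χ^≈0 nontrivial)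

  -- `ij` and `jk` are any representatives of i + j and j + k modulo `e`, so that `h + (a + h)` can
  -- be replaced by `a` when 2h = e.
  Jc-cocycle : ∀ i j k ij jk s t → i ℤ.+ j ≡ ij ℤ.+ s ℤ.* + e → j ℤ.+ k ≡ jk ℤ.+ t ℤ.* + e → Nontrivial ij → Nontrivial jk →
               Jc i j * Jc ij k ≈ Jc j k * Jc i jk
  Jc-cocycle i j k ij jk s t eq eq′ ij-nontrivial jk-nontrivial = begin
    Jc i j * Jc ij k
      ≈⟨ *-congˡ (J-cong {g = χ^ k} (χ^-+-resp i j ij s eq) (λ _ → refl)) ⟨
    Jc i j * J (λ v → χ^ i v * χ^ j v) (χ^ k)
      ≈⟨ J-cocycle (χ^-character i) (χ^-character j) (χ^-character k) (∑χ^χ^≈0 i j ij s eq ij-nontrivial) (∑χ^χ^≈0 j k jk t eq′ jk-nontrivial) ⟩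
    Jc j k * J (χ^ i) (λ v → χ^ j v * χ^ k v)
      ≈⟨ *-congˡ (J-cong {f = χ^ i} (λ _ → refl) (χ^-+-resp j k jk t eq′)) ⟩
    Jc j k * Jc i jk ∎

  Jc-product : ∀ i j k s → i ℤ.+ j ≡ k → Nontrivial (ℤ.- i) → Nontrivial j → Nontrivial k → χ^ (ℤ.- i) F.-1# ≈ s →
               Jc i j * Jc (ℤ.- i) k ≈ s * (order · 1#)
  Jc-product i j k s ≡.refl i-nontrivial j-nontrivial k-nontrivial χ^[-1]≈s = begin
    Jc i j * Jc (ℤ.- i) (i ℤ.+ j)
      ≈⟨ *-congˡ (J-cong {f = χ^ (ℤ.- i)} (λ _ → refl) (χ^-+ i j)) ⟨
    Jc i j * J (χ^ (ℤ.- i)) (λ v → χ^ i v * χ^ j v)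
      ≈⟨ J-product (χ^-character (ℤ.- i)) (χ^-character i) (χ^-inverse (ℤ.- i) i (+ 0) (≡.trans (ℤ.+-inverseˡ i) (≡.sym (ℤ.*-zeroˡ (+ e)))))
           (χ^-character j) (∑χ^≈0 i-nontrivial) (∑χ^≈0 j-nontrivial) (trans (∑-cong (χ^-+ i j)) (∑χ^≈0 k-nontrivial)) ⟩
    χ^ (ℤ.- i) F.-1# * (order · 1#)
      ≈⟨ *-congʳ χ^[-1]≈s ⟩
    s * (order · 1#) ∎

  -- In terms of Gauss sums g, both sides are order · g(a + h) g(b + h) / g(a + b).
  Jc-quadratic-twist : ∀ a b h → h ℤ.+ h ≡ + e → χ^ (ℤ.- b) F.-1# ≈ 1# →
    Nontrivial a → Nontrivial h → Nontrivial (ℤ.- b) → Nontrivial (a ℤ.+ h) → Nontrivial (b ℤ.+ (a ℤ.+ h)) →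
    (order · 1#) * Jc (a ℤ.+ h) (b ℤ.+ h) ≈ χ^ h F.-1# * (Jc (ℤ.- a) h * Jc (ℤ.- b) h * Jc a b)
  Jc-quadratic-twist a b h 2h≡e χ^-b[-1]≈1 a-nontrivial h-nontrivial b-nontrivial ah-nontrivial s-nontrivial = sym (begin
    ε * (Jc (ℤ.- a) h * Jc (ℤ.- b) h * Jc a b)
      ≈⟨ *-congˡ (*-congʳ (*-cong (trans (Jc-comm (ℤ.- a) h) (Jc-reflection h (ℤ.- a) (a ℤ.+ h) (+ 1) (twice h a 2h≡e)))
                                  (trans (Jc-reflection (ℤ.- b) h (b ℤ.+ h) (+ 1) (twice′ h b 2h≡e)) (trans (*-cong χ^-b[-1]≈1 (Jc-comm (ℤ.- b) (b ℤ.+ h))) (*-identityˡ _))))) ⟩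
    ε * (ε * Jc h (a ℤ.+ h) * Jc (b ℤ.+ h) (ℤ.- b) * Jc a b)
      ≈⟨ solve 4 (λ ε x y w → ε :* (ε :* x :* y :* w) := (ε :* ε) :* (y :* (x :* w))) refl ε (Jc h (a ℤ.+ h)) (Jc (b ℤ.+ h) (ℤ.- b)) (Jc a b) ⟩
    (ε * ε) * (Jc (b ℤ.+ h) (ℤ.- b) * (Jc h (a ℤ.+ h) * Jc a b))
      ≈⟨ *-cong (f[-1]² (χ^-character h)) (*-congˡ (Jc-cocycle h (a ℤ.+ h) b a s (+ 1) (+ 0) (cocycle₁ h a 2h≡e) (cocycle₂ a b h) a-nontrivial s-nontrivial)) ⟩
    1# * (Jc (b ℤ.+ h) (ℤ.- b) * (Jc (a ℤ.+ h) b * Jc h s))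
      ≈⟨ solve 3 (λ x y w → con (+ 1) :* (x :* (y :* w)) := y :* (x :* w)) refl (Jc (b ℤ.+ h) (ℤ.- b)) (Jc (a ℤ.+ h) b) (Jc h s) ⟩
    Jc (a ℤ.+ h) b * (Jc (b ℤ.+ h) (ℤ.- b) * Jc h s)
      ≈⟨ *-cong (Jc-comm (a ℤ.+ h) b) (Jc-cocycle (b ℤ.+ h) (ℤ.- b) s h (a ℤ.+ h) (+ 0) (+ 0) (cocycle₃ b h) (cocycle₄ a b h) h-nontrivial ah-nontrivial) ⟩
    Jc b (a ℤ.+ h) * (Jc (ℤ.- b) s * Jc (b ℤ.+ h) (a ℤ.+ h))
      ≈⟨ trans (sym (*-assoc _ _ _)) (*-cong (Jc-product b (a ℤ.+ h) s 1# ≡.refl b-nontrivial ah-nontrivial s-nontrivial χ^-b[-1]≈1) (Jc-comm (b ℤ.+ h) (a ℤ.+ h))) ⟩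
    1# * (order · 1#) * Jc (a ℤ.+ h) (b ℤ.+ h)
      ≈⟨ *-congʳ (*-identityˡ _) ⟩
    (order · 1#) * Jc (a ℤ.+ h) (b ℤ.+ h) ∎)
    where
    s = b ℤ.+ (a ℤ.+ h)
    ε = χ^ h F.-1#
    twice : ∀ h a → h ℤ.+ h ≡ + e → h ℤ.+ ℤ.- a ℤ.+ (a ℤ.+ h) ≡ + 1 ℤ.* + e
    twice h a 2h≡e = ≡.trans (identity h a) (≡.trans 2h≡e (≡.sym (ℤ.*-identityˡ (+ e))))
      where
      identity : ∀ h a → h ℤ.+ ℤ.- a ℤ.+ (a ℤ.+ h) ≡ h ℤ.+ h
      identity = ℤ-solve
    twice′ : ∀ h b → h ℤ.+ h ≡ + e → ℤ.- b ℤ.+ h ℤ.+ (b ℤ.+ h) ≡ + 1 ℤ.* + e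
    twice′ h b 2h≡e = ≡.trans (identity h b) (≡.trans 2h≡e (≡.sym (ℤ.*-identityˡ (+ e))))
      where
      identity : ∀ h b → ℤ.- b ℤ.+ h ℤ.+ (b ℤ.+ h) ≡ h ℤ.+ h
      identity = ℤ-solve
    cocycle₁ : ∀ h a → h ℤ.+ h ≡ + e → h ℤ.+ (a ℤ.+ h) ≡ a ℤ.+ + 1 ℤ.* + e
    cocycle₁ h a 2h≡e = ≡.trans (identity h a) (≡.cong (λ x → a ℤ.+ + 1 ℤ.* x) 2h≡e)
      where
      identity : ∀ h a → h ℤ.+ (a ℤ.+ h) ≡ a ℤ.+ + 1 ℤ.* (h ℤ.+ h)
      identity = ℤ-solve
    drop-zero : ∀ {i} j → i ≡ j → i ≡ j ℤ.+ + 0 ℤ.* + e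
    drop-zero j eq = ≡.trans eq (≡.sym (≡.trans (≡.cong (ℤ._+_ j) (ℤ.*-zeroˡ (+ e))) (ℤ.+-identityʳ j)))
    cocycle₂ : ∀ a b h → a ℤ.+ h ℤ.+ b ≡ b ℤ.+ (a ℤ.+ h) ℤ.+ + 0 ℤ.* + e
    cocycle₂ a b h = drop-zero (b ℤ.+ (a ℤ.+ h)) (ℤ.+-comm (a ℤ.+ h) b)
    cocycle₃ : ∀ b h → b ℤ.+ h ℤ.+ ℤ.- b ≡ h ℤ.+ + 0 ℤ.* + e
    cocycle₃ b h = drop-zero h (identity b h)
      where
      identity : ∀ b h → b ℤ.+ h ℤ.+ ℤ.- b ≡ h
      identity = ℤ-solve
    cocycle₄ : ∀ a b h → ℤ.- b ℤ.+ (b ℤ.+ (a ℤ.+ h)) ≡ a ℤ.+ h ℤ.+ + 0 ℤ.* + e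
    cocycle₄ a b h = drop-zero (a ℤ.+ h) (identity a b h)
      where
      identity : ∀ a b h → ℤ.- b ℤ.+ (b ℤ.+ (a ℤ.+ h)) ≡ a ℤ.+ h
      identity = ℤ-solve

-- Jacobi sums of orders l² and 2l² modulo (1 - ζ_{l²})^(l + 1).

module Congruences (l : ℕ) .{{_ : NonZero l}} (3≤l : 3 ≤ l) (l-prime : Prime l)
                   (F : FiniteField a ℓ₁ ℓ₂) (2l²∣order-1 : 2 ℕ.* l ℕ.^ 2 ∣ FiniteField.order F ℕ.∸ 1)
                   {γ : FiniteField.Carrier F} (generates : FiniteField.IsGenerator F γ)
                   (K : HeytingField b c ℓ)
                   {ζ : CommutativeRing.Carrier (fieldRing K)} (ζ-primitive : RingNotions.IsPrimitiveRoot (fieldRing K) (2 ℕ.* l ℕ.^ 2) ζ)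
                   {χ : FiniteField.Carrier F → CommutativeRing.Carrier (fieldRing K)}
                   (χ-character : Characters.IsMultiplicativeCharacter F (fieldRing K) χ)
                   (χγ≈ζ : CommutativeRing._≈_ (fieldRing K) (χ γ) ζ) where

  private
    R : CommutativeRing b c
    R = fieldRing K
    module F = FiniteFields F

    instance
      l²≢0 : NonZero (l ℕ.^ 2)
      l²≢0 = ℕ.m^n≢0 l 2

      2l²≢0 : NonZero (2 ℕ.* l ℕ.^ 2)
      2l²≢0 = ℕ.m*n≢0 2 (l ℕ.^ 2)

    h e : ℕ
    h = l ℕ.^ 2
    e = 2 ℕ.* h

    H : ℤ
    H = + h

  open FiniteField F using (order; ind)
  open CommutativeRing R hiding (zero)
  open RingNotions R
  open Coefficients l F γ using (coeff; N; admissible?)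
  open Setting l F γ R ζ χ renaming (J to jacobi)
  open Powers R
  open Subrings R
  open Domains K
  open IntegerMultiples R using (solve; _:=_; _:+_; _:*_; _:-_; :-_; con)
  open Mult semiring using () renaming (_×_ to _·_)
  open Sum semiring using (sum-cong-≋)
  open FiniteFields.RingSummation F R
  open JacobiSums F R
  open IsCharacter
  open CharacterPowers F generates K e ζ-primitive χ-character χγ≈ζ
  open SetoidReasoning setoid

  private
    z g : Carrier
    z = ζ[l²]
    g = (1# - z) ^ (l ℕ.+ 1)

  open Ideals R z
  private module Q = Quotient R z g

  l²≡l*l : h ≡ l ℕ.* l
  l²≡l*l = ≡.cong (l ℕ.*_) (ℕ.*-identityʳ l)

  1<l² : 1 < h
  1<l² = ℕ.≤-trans (ℕ.≤-trans (s≤s (s≤s z≤n)) 3≤l) (≡.subst (l ≤_) (≡.sym l²≡l*l) (ℕ.m≤m*n l l))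

  2∤l² : ¬ 2 ∣ h
  2∤l² 2∣l² with euclidsLemma l l prime[2] (≡.subst (2 ∣_) l²≡l*l 2∣l²)
  ... | inj₁ 2∣l = prime-odd l-prime 3≤l 2∣l
  ... | inj₂ 2∣l = prime-odd l-prime 3≤l 2∣l

  -- k = (l² - 1) / 2
  k : ℤ
  k = + (h ℕ./ 2)

  H≡1+2k : H ≡ + 1 ℤ.+ + 2 ℤ.* k
  H≡1+2k = odd-+ h 2∤l²

  e≡2H : + e ≡ + 2 ℤ.* H
  e≡2H = ℤ.pos-* 2 h

  private
    index-shift : ∀ {i} j t → i ≡ j ℤ.+ t ℤ.* (+ 2 ℤ.* H) → i ≡ j ℤ.+ t ℤ.* + e
    index-shift j t eq = ≡.trans eq (≡.cong (λ x → j ℤ.+ t ℤ.* x) (≡.sym e≡2H))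

    ζ^e≡ : ∀ n → n ≡ e → ζ ^ n ≈ 1#
    ζ^e≡ n ≡.refl = ζ^e≈1

    [z^l]^l≈1 : (z ^ l) ^ l ≈ 1#
    [z^l]^l≈1 = trans (^-assocʳ z l l) (trans (^-assocʳ ζ 2 (l ℕ.* l)) (ζ^e≡ _ (≡.cong (2 ℕ.*_) (≡.sym l²≡l*l))))

    z^l≉1 : ¬ z ^ l ≈ 1#
    z^l≉1 z^l≈1 = proj₂ ζ-primitive (2 ℕ.* l) (ℕ.≤-trans (ℕ.≤-trans (s≤s z≤n) 3≤l) (ℕ.m≤n*m l 2))
      (ℕ.*-monoʳ-< 2 (≡.subst (l <_) (≡.sym l²≡l*l) (ℕ.m<m*n l l (ℕ.≤-trans (s≤s (s≤s z≤n)) 3≤l))))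
      (trans (sym (^-assocʳ ζ 2 l)) z^l≈1)

    z^h≈1 : z ^ h ≈ 1#
    z^h≈1 = trans (^-assocʳ ζ 2 h) ζ^e≈1

    g∣l : g divides l · 1#
    g∣l = [1-z]^[p+1]-divides-p l l-prime 3≤l z [z^l]^l≈1 z^l≉1

    π∈ : ℤ[ z ] (1# - z)
    π∈ = sub one gen

    l≈0-in-Q : CongruentMod z g (proj₁ (Mult._×_ (CommutativeRing.semiring Q.quotient) l (CommutativeRing.1# Q.quotient))) 0#
    l≈0-in-Q = ≡.subst (λ x → CongruentMod z g x 0#) (≡.sym (Q.proj₁-·1 l)) (divides⇒congruent-0 g∣l)

    l*l∣order-1 : l ℕ.* l ∣ order ℕ.∸ 1
    l*l∣order-1 = ℕ∣.∣-trans (≡.subst (_∣ e) l²≡l*l (ℕ∣.n∣m*n 2)) 2l²∣order-1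

    module X = Expansion F generates l l-prime 3≤l l*l∣order-1 Q.quotient l≈0-in-Q
    module QN = RingNotions Q.quotient
    module QR = CommutativeRing Q.quotient

  order≅1 : order · 1# ≅ 1#
  order≅1 = ≡.subst (_≅ 1#) (Q.proj₁-·1 order) X.order·1≈1

  ζ^h≈-1 : ζ ^ h ≈ - 1#
  ζ^h≈-1 = begin
    ζ ^ h ≈⟨ solve 1 (λ x → x := (x :+ con (+ 1)) :- con (+ 1)) refl (ζ ^ h) ⟩
    (ζ ^ h + 1#) - 1# ≈⟨ +-congʳ (*-cancel-0 difference-of-squares ζ^h-1≉0) ⟩
    0# - 1# ≈⟨ +-identityˡ _ ⟩
    - 1# ∎
    where
    ζ^h-1≉0 : ¬ ζ ^ h - 1# ≈ 0#
    ζ^h-1≉0 eq = proj₂ ζ-primitive h (ℕ.<-trans (s≤s z≤n) 1<l²) (ℕ.m<m+n h (ℕ.<-≤-trans (ℕ.<-trans (s≤s z≤n) 1<l²) (ℕ.m≤m+n h 0)))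
      (trans (solve 1 (λ x → x := (x :- con (+ 1)) :+ con (+ 1)) refl (ζ ^ h)) (trans (+-congʳ eq) (+-identityˡ 1#)))
    difference-of-squares : (ζ ^ h - 1#) * (ζ ^ h + 1#) ≈ 0#
    difference-of-squares = begin
      (ζ ^ h - 1#) * (ζ ^ h + 1#) ≈⟨ solve 1 (λ x → (x :- con (+ 1)) :* (x :+ con (+ 1)) := x :* (x :* con (+ 1)) :- con (+ 1)) refl (ζ ^ h) ⟩
      (ζ ^ h) ^ 2 - 1# ≈⟨ +-congʳ (trans (^-assocʳ ζ h 2) (ζ^e≡ _ (ℕ.*-comm h 2))) ⟩
      1# - 1# ≈⟨ -‿inverseʳ 1# ⟩
      0# ∎

  -- As l² is odd and ζ^(l²) = -1, one has ζ = - ζ^(l² + 1) = - (ζ²)^((l² + 1)/2).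
  ζ∈ : ℤ[ z ] ζ
  ζ∈ = resp (begin
    - (z ^ suc m) ≈⟨ -‿cong (^-assocʳ ζ 2 (suc m)) ⟩
    - (ζ ^ (2 ℕ.* suc m)) ≡⟨ ≡.cong (λ n → - (ζ ^ n)) (≡.trans (double m) (≡.cong suc (≡.sym (odd≡1+2* 2∤l²)))) ⟩
    - (ζ * ζ ^ h) ≈⟨ -‿cong (*-congˡ ζ^h≈-1) ⟩
    - (ζ * - 1#) ≈⟨ solve 1 (λ x → :- (x :* :- con (+ 1)) := x) refl ζ ⟩
    ζ ∎) (neg (pow (suc m) gen))
    where
    m = h ℕ./ 2
    double : ∀ m → 2 ℕ.* suc m ≡ suc (suc (m ℕ.* 2))
    double = ℕ-solve

  χ^∈ : ∀ i v → ℤ[ z ] (χ^ i v)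
  χ^∈ i v with v F.≟ F.0#
  ... | yes v≈0 = resp (sym (χ^-zero i v≈0)) zero∈
  ... | no  v≉0 = resp (sym (χ^≈powMod i v≉0)) (pow ((+ ind γ v ℤ.* i) %ℕ e) ζ∈)

  jacobi∈ : ∀ i j → ℤ[ z ] (jacobi i j)
  jacobi∈ i j = sum∈ {n = order} _ (λ v → mul (χ^∈ i (F.element v)) (χ^∈ j (F.element v F.+ F.1#)))

  P∈ : ∀ m {y} → ℤ[ z ] y → ℤ[ z ] (P m y)
  P∈ m y∈ = add (neg one) (sum∈ {n = suc l ℕ.∸ 3} _ (λ i → mul (fromℤ∈ (coeff (3 ℕ.+ toℕ i) m)) (pow (3 ℕ.+ toℕ i) (sub y∈ one))))

  powMod∈ : ∀ i → ℤ[ z ] (ζ[l²]^ i)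
  powMod∈ i = pow (i %ℕ h) gen

  powMod-l²≈ : ∀ i → ζ[l²]^ i ≈ powMod e ζ (+ 2 ℤ.* i)
  powMod-l²≈ = powMod-square h ζ^e≈1

  -- The left side is the Jacobi sum of order l² with exponents j and jm: an admissible `v`
  -- contributes ζ_{l²}^(j N) = y^N with N = `N m v` and y = ζ_{l²}^j. As 1 - ζ_{l²} divides y - 1,
  -- the expansion in the quotient applies to y.
  jacobi≅P : ∀ j m → jacobi (+ 2 ℤ.* j) (+ 2 ℤ.* (j ℤ.* m)) ≅ P m (ζ[l²]^ j)
  jacobi≅P j m = congruent-trans (congruent-sym (≈⇒congruent left)) (congruent-trans (X.character-sum-expansion m Y nilpotent) (≈⇒congruent right))
    where
    y : Carrier
    y = ζ[l²]^ j

    Y : QR.Carrier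
    Y = y , powMod∈ j

    nilpotent : (Y QR.- QR.1#) QN.^ suc l QR.≈ QR.0#
    nilpotent = ≡.subst (λ x → CongruentMod z g x 0#) (≡.sym (Q.proj₁-^ (Y QR.- QR.1#) (suc l)))
      (divides⇒congruent-0 (≡.subst (λ n → g divides (y - 1#) ^ n) (ℕ.+-comm l 1)
        (divides-^ (l ℕ.+ 1) (divides-trans π∣z-1 (x-1-divides-x^n-1 gen (j %ℕ h))))))
      where
      π∣z-1 : (1# - z) divides (z - 1#)
      π∣z-1 = divides-resp (solve 1 (λ z → :- (con (+ 1) :- z) := z :- con (+ 1)) refl z) (divides-neg divides-refl)

    left : proj₁ (X.∑ᵃ (λ v → QN.powMod h Y (N m v))) ≈ jacobi (+ 2 ℤ.* j) (+ 2 ℤ.* (j ℤ.* m))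
    left = trans (reflexive (Q.proj₁-sum {order} _)) (∑-cong (λ v → term v (admissible? v)))
      where
      exponent : ∀ j m s t → + 2 ℤ.* (j ℤ.* (s ℤ.+ m ℤ.* t)) ≡ s ℤ.* (+ 2 ℤ.* j) ℤ.+ t ℤ.* (+ 2 ℤ.* (j ℤ.* m))
      exponent = ℤ-solve

      term : ∀ v (v? : Dec (¬ v F.≈ F.0# × ¬ v F.≈ F.- F.1#)) → proj₁ (if does v? then QN.powMod h Y (N m v) else QR.0#) ≈
                χ^ (+ 2 ℤ.* j) v * χ^ (+ 2 ℤ.* (j ℤ.* m)) (v F.+ F.1#)
      term v (yes (v≉0 , v≉-1)) = begin
        proj₁ (QN.powMod h Y (N m v))
          ≡⟨ Q.proj₁-^ Y (N m v %ℕ h) ⟩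
        powMod h y (N m v)
          ≈⟨ powMod-* h z^h≈1 j (N m v) ⟨
        powMod h z (j ℤ.* N m v)
          ≈⟨ powMod-l²≈ (j ℤ.* N m v) ⟩
        powMod e ζ (+ 2 ℤ.* (j ℤ.* N m v))
          ≡⟨ ≡.cong (powMod e ζ) (exponent j m (+ ind γ v) (+ ind γ (v F.+ F.1#))) ⟩
        powMod e ζ (+ ind γ v ℤ.* (+ 2 ℤ.* j) ℤ.+ + ind γ (v F.+ F.1#) ℤ.* (+ 2 ℤ.* (j ℤ.* m)))
          ≈⟨ powMod-+ e ζ^e≈1 (+ ind γ v ℤ.* (+ 2 ℤ.* j)) (+ ind γ (v F.+ F.1#) ℤ.* (+ 2 ℤ.* (j ℤ.* m))) ⟩
        powMod e ζ (+ ind γ v ℤ.* (+ 2 ℤ.* j)) * powMod e ζ (+ ind γ (v F.+ F.1#) ℤ.* (+ 2 ℤ.* (j ℤ.* m)))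
          ≈⟨ *-cong (χ^≈powMod (+ 2 ℤ.* j) v≉0) (χ^≈powMod (+ 2 ℤ.* (j ℤ.* m)) (X.v+1≉0 (v≉0 , v≉-1))) ⟨
        χ^ (+ 2 ℤ.* j) v * χ^ (+ 2 ℤ.* (j ℤ.* m)) (v F.+ F.1#) ∎
      term v (no inadmissible) with v F.≟ F.0# | v F.≟ F.-1#
      ... | yes v≈0 | _        = sym (trans (*-congʳ (χ^-zero (+ 2 ℤ.* j) v≈0)) (zeroˡ _))
      ... | no  _   | yes v≈-1 = sym (trans (*-congˡ (χ^-zero (+ 2 ℤ.* (j ℤ.* m)) (F.trans (F.+-congʳ v≈-1) (F.-‿inverseˡ F.1#)))) (zeroʳ _))
      ... | no  v≉0 | no  v≉-1 = contradiction (v≉0 , v≉-1) inadmissible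

    right : proj₁ (QR.- QR.1# QR.+ rangeSum QR.+-commutativeMonoid 3 l (λ i → QN.fromℤ (coeff i m) QR.* (Y QR.- QR.1#) QN.^ i)) ≈ P m y
    right = +-congˡ (trans (reflexive (Q.proj₁-sum {suc l ℕ.∸ 3} _))
      (sum-cong-≋ {suc l ℕ.∸ 3} (λ i → *-cong (reflexive (Q.proj₁-fromℤ (coeff (3 ℕ.+ toℕ i) m)))
                                              (reflexive (Q.proj₁-^ (Y QR.- QR.1#) (3 ℕ.+ toℕ i))))))

  -- Here y is a power of ζ_{l²}^l, so (1 - ζ_{l²})^l divides y - 1. Every term of the sum contains
  -- (y - 1)³, and 3l ≥ l + 1.
  Pd≅-1 : ∀ m d → P m (ζ[l²]^ (+ (d ℕ.* l))) ≅ - 1#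
  Pd≅-1 m d = divides-resp (solve 1 (λ x → x := (:- con (+ 1) :+ x) :- :- con (+ 1)) refl _)
    (divides-sum {n = suc l ℕ.∸ 3} _ (λ i → divides-*ˡ (fromℤ∈ (coeff (3 ℕ.+ toℕ i) m))
      (divides-resp (sym (^-homo-* (y - 1#) 3 (toℕ i))) (divides-*ʳ (pow (toℕ i) (sub (powMod∈ (+ (d ℕ.* l))) one)) g∣[y-1]^3))))
    where
    y : Carrier
    y = ζ[l²]^ (+ (d ℕ.* l))

    y≈ : y ≈ (z ^ l) ^ d
    y≈ = trans (powMod-pos h z^h≈1 (d ℕ.* l)) (trans (^-congʳ z (ℕ.*-comm d l)) (sym (^-assocʳ z l d)))

    l+1≤l*3 : l ℕ.+ 1 ≤ l ℕ.* 3
    l+1≤l*3 = ℕ.≤-trans (ℕ.+-monoʳ-≤ l (ℕ.≤-trans (s≤s z≤n) (ℕ.≤-trans 3≤l (ℕ.m≤m+n l l)))) (ℕ.≤-reflexive (triple l))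
      where
      triple : ∀ l → l ℕ.+ (l ℕ.+ l) ≡ l ℕ.* 3
      triple = ℕ-solve

    g∣[y-1]^3 : g divides (y - 1#) ^ 3
    g∣[y-1]^3 = ^-divides-≤ π∈ l+1≤l*3 (divides-congˡ (^-assocʳ (1# - z) l 3) (divides-^ 3
      (divides-resp (+-congʳ (sym y≈)) (divides-trans ([1-z]^p-divides-z^p-1 l l-prime 3≤l z [z^l]^l≈1 z^l≉1) (x-1-divides-x^n-1 (pow l gen) d)))))

  w : ℕ
  w = ind γ two

  private
    M : ℕ
    M = ℕ∣.quotient 2l²∣order-1 ℕ.* h

    order-1≡M*2 : order ℕ.∸ 1 ≡ M ℕ.* 2
    order-1≡M*2 = ≡.trans (ℕ∣.m∣n⇒n≡quotient*m 2l²∣order-1) (rearrange (ℕ∣.quotient 2l²∣order-1) h)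
      where
      rearrange : ∀ t h → t ℕ.* (2 ℕ.* h) ≡ t ℕ.* h ℕ.* 2
      rearrange = ℕ-solve

    2≉0 : ¬ two F.≈ F.0#
    2≉0 = two≉0 generates {M} order-1≡M*2

    ηγ≈-1 : χ^ H γ ≈ - 1#
    ηγ≈-1 = begin
      χ^ H γ ≈⟨ χ^≈powMod-χ H (F.generator-≉0 generates) ⟩
      powMod e (χ γ) H ≈⟨ powMod-cong e H χγ≈ζ ⟩
      powMod e ζ H ≈⟨ powMod-pos e ζ^e≈1 h ⟩
      ζ ^ h ≈⟨ ζ^h≈-1 ⟩
      - 1# ∎

    1+H : ℤ
    1+H = + 1 ℤ.+ H

    -- 1 + l² is even, so χη is the square of a character. Hence the sign χ(-1) from `jacobiSum≈`
    -- cancels the sign η(-1) from reflection.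
    χη[-1]≈1 : χ^ (+ 1) F.-1# * χ^ H F.-1# ≈ 1#
    χη[-1]≈1 = trans (χ^-+ (+ 1) H F.-1#) (χ^-even[-1] (+ 1 ℤ.+ k) (≡.trans (≡.cong (ℤ._+_ (+ 1)) H≡1+2k) (twice k)))
      where
      twice : ∀ k → + 1 ℤ.+ (+ 1 ℤ.+ + 2 ℤ.* k) ≡ + 1 ℤ.+ k ℤ.+ (+ 1 ℤ.+ k)
      twice = ℤ-solve

    χ^-multiple[-1] : ∀ m {i} → i ≡ m ℤ.* 1+H → χ^ i F.-1# ≈ 1#
    χ^-multiple[-1] m eq = χ^-even[-1] (m ℤ.* (+ 1 ℤ.+ k)) (≡.trans eq (≡.trans (≡.cong (λ x → m ℤ.* (+ 1 ℤ.+ x)) H≡1+2k) (twice m k)))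
      where
      twice : ∀ m k → m ℤ.* (+ 1 ℤ.+ (+ 1 ℤ.+ + 2 ℤ.* k)) ≡ m ℤ.* (+ 1 ℤ.+ k) ℤ.+ m ℤ.* (+ 1 ℤ.+ k)
      twice = ℤ-solve

    nontrivial-odd : ∀ {i} j → i ≡ + 1 ℤ.+ + 2 ℤ.* j → Nontrivial i
    nontrivial-odd j ≡.refl t i≡te = odd≢even j (t ℤ.* H) (≡.trans i≡te (≡.trans (≡.cong (t ℤ.*_) e≡2H) (swap t H)))
      where
      swap : ∀ t H → t ℤ.* (+ 2 ℤ.* H) ≡ + 2 ℤ.* (t ℤ.* H)
      swap = ℤ-solve

    -- If -m (1 + l²) = 2 t l², then m = (-m - 2t) l².
    nontrivial-multiple : ∀ m → ¬ h ∣ m → ∀ {i} → i ≡ ℤ.- (+ m ℤ.* 1+H) → Nontrivial i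
    nontrivial-multiple m h∤m eq t i≡te = h∤m (ℕ∣.divides ℤ.∣ ℤ.- (+ m) ℤ.- + 2 ℤ.* t ∣ (≡.trans (≡.cong ℤ.∣_∣ m≡) (ℤ.abs-* (ℤ.- (+ m) ℤ.- + 2 ℤ.* t) H)))
      where
      isolate : ∀ m H → m ≡ ℤ.- (m ℤ.* H) ℤ.- ℤ.- (m ℤ.* (+ 1 ℤ.+ H))
      isolate = ℤ-solve
      collect : ∀ m t H → ℤ.- (m ℤ.* H) ℤ.- t ℤ.* (+ 2 ℤ.* H) ≡ (ℤ.- m ℤ.- + 2 ℤ.* t) ℤ.* H
      collect = ℤ-solve
      m≡ : + m ≡ (ℤ.- (+ m) ℤ.- + 2 ℤ.* t) ℤ.* H
      m≡ = ≡.trans (isolate (+ m) H) (≡.trans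
        (≡.cong (λ x → ℤ.- (+ m ℤ.* H) ℤ.- x) (≡.trans (≡.sym eq) (≡.trans i≡te (≡.cong (t ℤ.*_) e≡2H))))
        (collect (+ m) t H))

    h∤1 : ¬ h ∣ 1
    h∤1 h∣1 = contradiction (ℕ∣.∣⇒≤ h∣1) (ℕ.<⇒≱ 1<l²)

    -- The exponents of the characters A of order l² with χ = A η, and B = Aⁿ, where η = χ^ H is quadratic.
    A : ℤ
    A = + 1 ℤ.* 1+H

    B : ℕ → ℤ
    B n = + n ℤ.* 1+H

  χ^-two : ∀ i → χ^ (+ 2 ℤ.* ℤ.- (+ i)) two ≈ ζ[l²]^ (ℤ.- (+ (w ℕ.* i)))
  χ^-two i = begin
    χ^ (+ 2 ℤ.* ℤ.- (+ i)) two ≈⟨ χ^≈powMod (+ 2 ℤ.* ℤ.- (+ i)) 2≉0 ⟩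
    powMod e ζ (+ w ℤ.* (+ 2 ℤ.* ℤ.- (+ i))) ≡⟨ ≡.cong (powMod e ζ) (≡.trans (rearrange (+ w) (+ i)) (≡.cong (λ x → + 2 ℤ.* ℤ.- x) (≡.sym (ℤ.pos-* w i)))) ⟩
    powMod e ζ (+ 2 ℤ.* ℤ.- (+ (w ℕ.* i))) ≈⟨ powMod-l²≈ (ℤ.- (+ (w ℕ.* i))) ⟨
    ζ[l²]^ (ℤ.- (+ (w ℕ.* i))) ∎
    where
    rearrange : ∀ w i → w ℤ.* (+ 2 ℤ.* ℤ.- i) ≡ + 2 ℤ.* ℤ.- (w ℤ.* i)
    rearrange = ℤ-solve

  -- `J-duplication` for f = χ^(-i), solved for the sum with η: the factor f(2)² cancels the values
  -- of the inverse character.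
  Jc-duplication : ∀ i → Nontrivial (ℤ.- i) → Jc (ℤ.- i) H ≈ χ^ (ℤ.- i ℤ.- i) two * Jc (ℤ.- i) (ℤ.- i)
  Jc-duplication i nontrivial = sym (begin
    χ^ (ℤ.- i ℤ.- i) two * Jc (ℤ.- i) (ℤ.- i)
      ≈⟨ *-cong (sym (χ^-+ (ℤ.- i) (ℤ.- i) two))
                (J-duplication generates {M} order-1≡M*2 (χ^-character H) ηγ≈-1 (χ^-character (ℤ.- i)) -i+i (∑χ^≈0 nontrivial)) ⟩
    χ^ (ℤ.- i) two * χ^ (ℤ.- i) two * (χ^ i two * χ^ i two * Jc (ℤ.- i) H)
      ≈⟨ solve 3 (λ x y w → x :* x :* (y :* y :* w) := (x :* y) :* ((x :* y) :* w)) refl (χ^ (ℤ.- i) two) (χ^ i two) (Jc (ℤ.- i) H) ⟩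
    (χ^ (ℤ.- i) two * χ^ i two) * ((χ^ (ℤ.- i) two * χ^ i two) * Jc (ℤ.- i) H)
      ≈⟨ *-cong (-i+i two 2≉0) (trans (*-congʳ (-i+i two 2≉0)) (*-identityˡ _)) ⟩
    1# * Jc (ℤ.- i) H
      ≈⟨ *-identityˡ _ ⟩
    Jc (ℤ.- i) H ∎)
    where
    -i+i : Inverse[ χ^ (ℤ.- i) , χ^ i ]
    -i+i = χ^-inverse (ℤ.- i) i (+ 0) (≡.trans (ℤ.+-inverseˡ i) (≡.sym (ℤ.*-zeroˡ (+ e))))

  jacobi-even : ∀ i j → jacobi (+ 2 ℤ.* i) j ≈ Jc (+ 2 ℤ.* i) j
  jacobi-even i j = trans (jacobiSum≈ (+ 2 ℤ.* i) j) (trans (*-congʳ (χ^-even[-1] i (double i))) (*-identityˡ _))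
    where
    double : ∀ i → + 2 ℤ.* i ≡ i ℤ.+ i
    double = ℤ-solve

  -- J(B̄, B̄) for B = Aⁿ.
  Jc-B̄B̄ : ∀ n → Jc (ℤ.- B n) (ℤ.- B n) ≈ jacobi (+ 2 ℤ.* + n) (+ 2 ℤ.* (+ n ℤ.* k))
  Jc-B̄B̄ n = begin
    Jc (ℤ.- B n) (ℤ.- B n)
      ≈⟨ Jc-reflection (ℤ.- B n) (ℤ.- B n) (+ 2 ℤ.* B n) (+ 0) (cancel (B n) (+ e)) ⟩
    χ^ (ℤ.- B n) F.-1# * Jc (ℤ.- B n) (+ 2 ℤ.* B n)
      ≈⟨ trans (*-congʳ (χ^-multiple[-1] (ℤ.- + n) (ℤ.neg-distribˡ-* (+ n) 1+H))) (*-identityˡ _) ⟩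
    Jc (ℤ.- B n) (+ 2 ℤ.* B n)
      ≈⟨ Jc-comm (ℤ.- B n) (+ 2 ℤ.* B n) ⟩
    Jc (+ 2 ℤ.* B n) (ℤ.- B n)
      ≈⟨ Jc-resp (+ 2 ℤ.* + n) (+ 2 ℤ.* (+ n ℤ.* k)) (+ n) (ℤ.- + n)
           (index-shift (+ 2 ℤ.* + n) (+ n) (index₁ (+ n) H))
           (index-shift (+ 2 ℤ.* (+ n ℤ.* k)) (ℤ.- + n) (≡.subst (λ H → ℤ.- (+ n ℤ.* (+ 1 ℤ.+ H)) ≡ + 2 ℤ.* (+ n ℤ.* k) ℤ.+ ℤ.- + n ℤ.* (+ 2 ℤ.* H)) (≡.sym H≡1+2k) (index₂ (+ n) k))) ⟩
    Jc (+ 2 ℤ.* + n) (+ 2 ℤ.* (+ n ℤ.* k))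
      ≈⟨ jacobi-even (+ n) (+ 2 ℤ.* (+ n ℤ.* k)) ⟨
    jacobi (+ 2 ℤ.* + n) (+ 2 ℤ.* (+ n ℤ.* k)) ∎
    where
    cancel : ∀ b e → ℤ.- b ℤ.+ ℤ.- b ℤ.+ + 2 ℤ.* b ≡ + 0 ℤ.* e
    cancel = ℤ-solve
    index₁ : ∀ n H → + 2 ℤ.* (n ℤ.* (+ 1 ℤ.+ H)) ≡ + 2 ℤ.* n ℤ.+ n ℤ.* (+ 2 ℤ.* H)
    index₁ = ℤ-solve
    index₂ : ∀ n k → ℤ.- (n ℤ.* (+ 1 ℤ.+ (+ 1 ℤ.+ + 2 ℤ.* k))) ≡ + 2 ℤ.* (n ℤ.* k) ℤ.+ ℤ.- n ℤ.* (+ 2 ℤ.* (+ 1 ℤ.+ + 2 ℤ.* k))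
    index₂ = ℤ-solve

  Jc-B̄B̄∈ : ∀ n → ℤ[ z ] (Jc (ℤ.- B n) (ℤ.- B n))
  Jc-B̄B̄∈ n = resp (sym (Jc-B̄B̄ n)) (jacobi∈ (+ 2 ℤ.* + n) (+ 2 ℤ.* (+ n ℤ.* k)))

  -- The index (l² - 1)/2 comes from here: after reflection the pair is (B², B̄), with B² = χ_{l²}^n
  -- and B̄ = χ_{l²}^(n (l² - 1)/2).
  Jc-B̄B̄≅ : ∀ n → Jc (ℤ.- B n) (ℤ.- B n) ≅ P k (ζ[l²]^ (+ n))
  Jc-B̄B̄≅ n = congruent-trans (≈⇒congruent (Jc-B̄B̄ n)) (jacobi≅P (+ n) k)

  ζ[l²]^1≈ζ[l²] : ζ[l²]^ (+ 1) ≈ ζ[l²]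
  ζ[l²]^1≈ζ[l²] = trans (powMod-pos h z^h≈1 1) (*-identityʳ z)

  P-cong : ∀ m {x y} → x ≈ y → P m x ≈ P m y
  P-cong m x≈y = +-congˡ (sum-cong-≋ {suc l ℕ.∸ 3} (λ i → *-congˡ (^-congˡ (3 ℕ.+ toℕ i) (+-congʳ x≈y))))

  Jc-ĀĀ≅ : Jc (ℤ.- A) (ℤ.- A) ≅ P k ζ[l²]
  Jc-ĀĀ≅ = congruent-trans (Jc-B̄B̄≅ 1) (≈⇒congruent (P-cong k ζ[l²]^1≈ζ[l²]))

  -- χη is A, so reflection turns the pair (η, χ) into (η, Ā), and one duplication finishes. The
  -- twist identity is out of reach, because B is trivial for n = l².
  jacobi[1,l²]≅ : jacobi (+ 1) (+ h) ≅ ζ[l²]^ (ℤ.- + w) * P k ζ[l²]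
  jacobi[1,l²]≅ = congruent-trans (≈⇒congruent (begin
    jacobi (+ 1) H
      ≈⟨ jacobiSum≈ (+ 1) H ⟩
    χ^ (+ 1) F.-1# * Jc (+ 1) H
      ≈⟨ *-congˡ (trans (Jc-comm (+ 1) H) (Jc-reflection H (+ 1) (ℤ.- A) (+ 0) (cancel H (+ e)))) ⟩
    χ^ (+ 1) F.-1# * (χ^ H F.-1# * Jc H (ℤ.- A))
      ≈⟨ trans (sym (*-assoc _ _ _)) (trans (*-congʳ χη[-1]≈1) (*-identityˡ _)) ⟩
    Jc H (ℤ.- A)
      ≈⟨ trans (Jc-comm H (ℤ.- A)) (Jc-duplication A (nontrivial-multiple 1 h∤1 ≡.refl)) ⟩
    χ^ (ℤ.- A ℤ.- A) two * Jc (ℤ.- A) (ℤ.- A)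
      ≈⟨ *-congʳ (trans (χ^-resp (+ 2 ℤ.* ℤ.- + 1) (ℤ.- + 1) (index-shift (+ 2 ℤ.* ℤ.- + 1) (ℤ.- + 1) (index H)) two) (trans (χ^-two 1) (reflexive (≡.cong (λ x → ζ[l²]^ (ℤ.- + x)) (ℕ.*-identityʳ w))))) ⟩
    ζ[l²]^ (ℤ.- + w) * Jc (ℤ.- A) (ℤ.- A) ∎))
    (congruent-* (powMod∈ (ℤ.- + w)) (Jc-B̄B̄∈ 1) (≈⇒congruent refl) Jc-ĀĀ≅)
    where
    cancel : ∀ H e → H ℤ.+ + 1 ℤ.+ ℤ.- (+ 1 ℤ.* (+ 1 ℤ.+ H)) ≡ + 0 ℤ.* e
    cancel = ℤ-solve
    index : ∀ H → ℤ.- (+ 1 ℤ.* (+ 1 ℤ.+ H)) ℤ.- + 1 ℤ.* (+ 1 ℤ.+ H) ≡ + 2 ℤ.* ℤ.- + 1 ℤ.+ ℤ.- + 1 ℤ.* (+ 2 ℤ.* H)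
    index = ℤ-solve

  -- The two characters are inverse to each other, and the sign χ(-1) of `J-inverse` meets the one
  -- of `jacobiSum≈`.
  jacobi[1,2l²-1]≈-1 : ∀ n → suc n ≡ e → jacobi (+ 1) (+ n) ≈ - 1#
  jacobi[1,2l²-1]≈-1 n n+1≡e = begin
    jacobi (+ 1) (+ n)
      ≈⟨ jacobiSum≈ (+ 1) (+ n) ⟩
    χ^ (+ 1) F.-1# * Jc (+ 1) (+ n)
      ≈⟨ *-congˡ (J-inverse (χ^-character (+ 1)) (χ^-character (+ n)) (χ^-inverse (+ 1) (+ n) (+ 1) (≡.trans (≡.cong +_ n+1≡e) (≡.sym (ℤ.*-identityˡ (+ e))))) (∑χ^≈0 (nontrivial-odd (+ 0) ≡.refl))) ⟩
    χ^ (+ 1) F.-1# * - χ^ (+ 1) F.-1#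
      ≈⟨ solve 1 (λ x → x :* :- x := :- (x :* x)) refl _ ⟩
    - (χ^ (+ 1) F.-1# * χ^ (+ 1) F.-1#)
      ≈⟨ -‿cong (f[-1]² (χ^-character (+ 1))) ⟩
    - 1# ∎

  jacobi-even-reflection : ∀ n n′ → suc (n ℕ.+ n′) ≡ e → jacobi (+ 1) (+ n) ≈ χ F.-1# * jacobi (+ 1) (+ n′)
  jacobi-even-reflection n n′ eq = begin
    jacobi (+ 1) (+ n)
      ≈⟨ jacobiSum≈ (+ 1) (+ n) ⟩
    χ^ (+ 1) F.-1# * Jc (+ 1) (+ n)
      ≈⟨ *-congˡ (Jc-reflection (+ 1) (+ n) (+ n′) (+ 1) (≡.trans (≡.cong +_ eq) (≡.sym (ℤ.*-identityˡ (+ e))))) ⟩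
    χ^ (+ 1) F.-1# * (χ^ (+ 1) F.-1# * Jc (+ 1) (+ n′))
      ≈⟨ *-cong χ^1≈χ (sym (jacobiSum≈ (+ 1) (+ n′))) ⟩
    χ F.-1# * jacobi (+ 1) (+ n′) ∎
    where
    1<e : 1 < e
    1<e = ℕ.<-≤-trans 1<l² (ℕ.m≤m+n h _)
    χ^1≈χ : χ^ (+ 1) F.-1# ≈ χ F.-1#
    χ^1≈χ = trans (χ^≈powMod-χ (+ 1) F.-1≉0) (trans (^-congʳ _ (ℕ.m<n⇒m%n≡m 1<e)) (*-identityʳ _))

  -- Odd exponents n not divisible by l².

  module _ (n : ℕ) (2∤n : ¬ 2 ∣ n) (l²∤n : ¬ h ∣ n) where

    private
      n½ : ℤ
      n½ = + (n ℕ./ 2)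

      n≡1+2n½ : + n ≡ + 1 ℤ.+ + 2 ℤ.* n½
      n≡1+2n½ = odd-+ n 2∤n

      by-parity : ∀ (Φ : ℤ → Set) → Φ (+ 1 ℤ.+ + 2 ℤ.* n½) → Φ (+ n)
      by-parity Φ = ≡.subst Φ (≡.sym n≡1+2n½)

    -- (1 + l²) + l² and n (1 + l²) + l² are 1 and n modulo 2l², the second because n + 1 is even;
    -- so the twist identity for A and B speaks of J(χ, χⁿ). The two duplications contribute Ā(4)
    -- B̄(4), which is χ_{l²}(2) to the power -(n + 1): this is the power of ζ_{l²}.
    order*jacobi≈ : order · 1# * jacobi (+ 1) (+ n) ≈
                    ζ[l²]^ (ℤ.- + (w ℕ.* (n ℕ.+ 1))) * Jc (ℤ.- A) (ℤ.- A) * Jc (ℤ.- B n) (ℤ.- B n) * Jc A (B n)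
    order*jacobi≈ = begin
      q * jacobi (+ 1) (+ n)
        ≈⟨ *-congˡ (trans (jacobiSum≈ (+ 1) (+ n)) (*-congˡ (sym (Jc-resp (+ 1) (+ n) (+ 1) (+ 1 ℤ.+ n½)
             (index-shift (+ 1) (+ 1) (index₁ H)) (index-shift (+ n) (+ 1 ℤ.+ n½) (by-parity (λ n → n ℤ.* 1+H ℤ.+ H ≡ n ℤ.+ (+ 1 ℤ.+ n½) ℤ.* (+ 2 ℤ.* H)) (index₂ n½ H))))))) ⟩
      q * (χ^ (+ 1) F.-1# * Jc (A ℤ.+ H) (B n ℤ.+ H))
        ≈⟨ solve 3 (λ x y w → x :* (y :* w) := y :* (x :* w)) refl q (χ^ (+ 1) F.-1#) _ ⟩
      χ^ (+ 1) F.-1# * (q * Jc (A ℤ.+ H) (B n ℤ.+ H))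
        ≈⟨ *-congˡ (Jc-quadratic-twist A (B n) H H+H≡e (χ^-multiple[-1] (ℤ.- + n) (ℤ.neg-distribˡ-* (+ n) 1+H))
             A-nontrivial (nontrivial-odd k H≡1+2k) (nontrivial-multiple n l²∤n ≡.refl)
             (nontrivial-odd H (index₃ H)) sum-nontrivial) ⟩
      χ^ (+ 1) F.-1# * (χ^ H F.-1# * (Jc (ℤ.- A) H * Jc (ℤ.- B n) H * Jc A (B n)))
        ≈⟨ trans (sym (*-assoc _ _ _)) (trans (*-congʳ χη[-1]≈1) (*-identityˡ _)) ⟩
      Jc (ℤ.- A) H * Jc (ℤ.- B n) H * Jc A (B n)
        ≈⟨ *-congʳ (*-cong (Jc-duplication A (nontrivial-multiple 1 h∤1 ≡.refl)) (Jc-duplication (B n) (nontrivial-multiple n l²∤n ≡.refl))) ⟩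
      (χ^ (ℤ.- A ℤ.- A) two * Jc (ℤ.- A) (ℤ.- A)) * (χ^ (ℤ.- B n ℤ.- B n) two * Jc (ℤ.- B n) (ℤ.- B n)) * Jc A (B n)
        ≈⟨ solve 5 (λ s x t y w → (s :* x) :* (t :* y) :* w := (s :* t) :* x :* y :* w) refl (χ^ (ℤ.- A ℤ.- A) two) _ (χ^ (ℤ.- B n ℤ.- B n) two) _ _ ⟩
      (χ^ (ℤ.- A ℤ.- A) two * χ^ (ℤ.- B n ℤ.- B n) two) * Jc (ℤ.- A) (ℤ.- A) * Jc (ℤ.- B n) (ℤ.- B n) * Jc A (B n)
        ≈⟨ *-congʳ (*-congʳ (*-congʳ (trans (χ^-+-resp (ℤ.- A ℤ.- A) (ℤ.- B n ℤ.- B n) (+ 2 ℤ.* ℤ.- + (n ℕ.+ 1)) (ℤ.- + (n ℕ.+ 1))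
             (index-shift (+ 2 ℤ.* ℤ.- + (n ℕ.+ 1)) (ℤ.- + (n ℕ.+ 1)) (index₄ (+ n) H)) two) (χ^-two (n ℕ.+ 1))))) ⟩
      ζ[l²]^ (ℤ.- + (w ℕ.* (n ℕ.+ 1))) * Jc (ℤ.- A) (ℤ.- A) * Jc (ℤ.- B n) (ℤ.- B n) * Jc A (B n) ∎
      where
      q : Carrier
      q = order · 1#

      H+H≡e : H ℤ.+ H ≡ + e
      H+H≡e = ≡.trans (double H) (≡.sym e≡2H)
        where
        double : ∀ H → H ℤ.+ H ≡ + 2 ℤ.* H
        double = ℤ-solve

      A-nontrivial : Nontrivial A
      A-nontrivial t A≡te = nontrivial-multiple 1 h∤1 ≡.refl (ℤ.- t) (≡.trans (≡.cong ℤ.-_ A≡te) (ℤ.neg-distribˡ-* t (+ e)))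

      index₁ : ∀ H → + 1 ℤ.* (+ 1 ℤ.+ H) ℤ.+ H ≡ + 1 ℤ.+ + 1 ℤ.* (+ 2 ℤ.* H)
      index₁ = ℤ-solve
      index₂ : ∀ N H → (+ 1 ℤ.+ + 2 ℤ.* N) ℤ.* (+ 1 ℤ.+ H) ℤ.+ H ≡ + 1 ℤ.+ + 2 ℤ.* N ℤ.+ (+ 1 ℤ.+ N) ℤ.* (+ 2 ℤ.* H)
      index₂ = ℤ-solve
      index₃ : ∀ H → + 1 ℤ.* (+ 1 ℤ.+ H) ℤ.+ H ≡ + 1 ℤ.+ + 2 ℤ.* H
      index₃ = ℤ-solve
      index₄ : ∀ n H → ℤ.- (+ 1 ℤ.* (+ 1 ℤ.+ H)) ℤ.- + 1 ℤ.* (+ 1 ℤ.+ H) ℤ.+ (ℤ.- (n ℤ.* (+ 1 ℤ.+ H)) ℤ.- n ℤ.* (+ 1 ℤ.+ H)) ≡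
                       + 2 ℤ.* ℤ.- (n ℤ.+ + 1) ℤ.+ ℤ.- (n ℤ.+ + 1) ℤ.* (+ 2 ℤ.* H)
      index₄ = ℤ-solve
      index₅ : ∀ N k → (+ 1 ℤ.+ + 2 ℤ.* N) ℤ.* (+ 1 ℤ.+ (+ 1 ℤ.+ + 2 ℤ.* k)) ℤ.+ (+ 1 ℤ.* (+ 1 ℤ.+ (+ 1 ℤ.+ + 2 ℤ.* k)) ℤ.+ (+ 1 ℤ.+ + 2 ℤ.* k)) ≡
                       + 1 ℤ.+ + 2 ℤ.* ((+ 1 ℤ.+ + 2 ℤ.* N) ℤ.* (+ 1 ℤ.+ k) ℤ.+ (+ 1 ℤ.+ k) ℤ.+ k)
      index₅ = ℤ-solve

      sum-nontrivial : Nontrivial (B n ℤ.+ (A ℤ.+ H))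
      sum-nontrivial = nontrivial-odd ((+ 1 ℤ.+ + 2 ℤ.* n½) ℤ.* (+ 1 ℤ.+ k) ℤ.+ (+ 1 ℤ.+ k) ℤ.+ k)
        (≡.trans (≡.cong₂ (λ n H → n ℤ.* (+ 1 ℤ.+ H) ℤ.+ (+ 1 ℤ.* (+ 1 ℤ.+ H) ℤ.+ H)) n≡1+2n½ H≡1+2k) (index₅ n½ k))

    -- The factor q is inserted on the left, being congruent to 1, and absorbed by `order*jacobi≈`.
    -- The membership hypotheses are those asked for by `congruent-*`.
    jacobi[1,n]≅ : ∀ {x₂ x₃} → Jc (ℤ.- B n) (ℤ.- B n) ≅ x₂ → Jc A (B n) ≅ x₃ → ℤ[ z ] x₂ → ℤ[ z ] (Jc A (B n)) →
                   jacobi (+ 1) (+ n) ≅ ζ[l²]^ (ℤ.- + (w ℕ.* (n ℕ.+ 1))) * P k ζ[l²] * x₂ * x₃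
    jacobi[1,n]≅ eq₂ eq₃ x₂∈ J∈ =
      congruent-trans (≈⇒congruent (sym (*-identityˡ _)))
        (congruent-trans (congruent-* (multiple order one) (jacobi∈ (+ 1) (+ n)) (congruent-sym order≅1) (≈⇒congruent refl))
          (congruent-trans (≈⇒congruent order*jacobi≈)
            (congruent-* (mul (mul (powMod∈ s) (P∈ k gen)) x₂∈) J∈
              (congruent-* (mul (powMod∈ s) (P∈ k gen)) (Jc-B̄B̄∈ n)
                (congruent-* (powMod∈ s) (Jc-B̄B̄∈ 1) (≈⇒congruent refl) Jc-ĀĀ≅) eq₂) eq₃)))
      where
      s = ℤ.- + (w ℕ.* (n ℕ.+ 1))

    -- Reflection replaces B by the inverse of AB = A^(1 + n), whose exponent is -1 - n times that
    -- of A, and A is χ_{l²}^((1 - l²)/2).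
    Jc-AB-coprime : Jc A (B n) ≈ jacobi (+ 2 ℤ.* ℤ.- k) (+ 2 ℤ.* (ℤ.- k ℤ.* (ℤ.- + 1 ℤ.- + n)))
    Jc-AB-coprime = begin
      Jc A (B n)
        ≈⟨ Jc-reflection A (B n) (ℤ.- (A ℤ.+ B n)) (+ 0) (cancel A (B n) (+ e)) ⟩
      χ^ A F.-1# * Jc A (ℤ.- (A ℤ.+ B n))
        ≈⟨ trans (*-congʳ (χ^-multiple[-1] (+ 1) ≡.refl)) (*-identityˡ _) ⟩
      Jc A (ℤ.- (A ℤ.+ B n))
        ≈⟨ Jc-resp (+ 2 ℤ.* ℤ.- k) (+ 2 ℤ.* (ℤ.- k ℤ.* (ℤ.- + 1 ℤ.- + n))) (+ 1) (ℤ.- (+ 1 ℤ.+ + n))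
             (index-shift (+ 2 ℤ.* ℤ.- k) (+ 1) (≡.subst (λ H → + 1 ℤ.* (+ 1 ℤ.+ H) ≡ + 2 ℤ.* ℤ.- k ℤ.+ + 1 ℤ.* (+ 2 ℤ.* H)) (≡.sym H≡1+2k) (index₁ k)))
             (index-shift (+ 2 ℤ.* (ℤ.- k ℤ.* (ℤ.- + 1 ℤ.- + n))) (ℤ.- (+ 1 ℤ.+ + n)) (≡.subst (λ H → ℤ.- (+ 1 ℤ.* (+ 1 ℤ.+ H) ℤ.+ + n ℤ.* (+ 1 ℤ.+ H)) ≡ + 2 ℤ.* (ℤ.- k ℤ.* (ℤ.- + 1 ℤ.- + n)) ℤ.+ ℤ.- (+ 1 ℤ.+ + n) ℤ.* (+ 2 ℤ.* H)) (≡.sym H≡1+2k) (index₂ (+ n) k))) ⟩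
      Jc (+ 2 ℤ.* ℤ.- k) (+ 2 ℤ.* (ℤ.- k ℤ.* (ℤ.- + 1 ℤ.- + n)))
        ≈⟨ jacobi-even (ℤ.- k) (+ 2 ℤ.* (ℤ.- k ℤ.* (ℤ.- + 1 ℤ.- + n))) ⟨
      jacobi (+ 2 ℤ.* ℤ.- k) (+ 2 ℤ.* (ℤ.- k ℤ.* (ℤ.- + 1 ℤ.- + n))) ∎
      where
      cancel : ∀ a b e → a ℤ.+ b ℤ.+ ℤ.- (a ℤ.+ b) ≡ + 0 ℤ.* e
      cancel = ℤ-solve
      index₁ : ∀ k → + 1 ℤ.* (+ 1 ℤ.+ (+ 1 ℤ.+ + 2 ℤ.* k)) ≡ + 2 ℤ.* ℤ.- k ℤ.+ + 1 ℤ.* (+ 2 ℤ.* (+ 1 ℤ.+ + 2 ℤ.* k))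
      index₁ = ℤ-solve
      index₂ : ∀ n k → ℤ.- (+ 1 ℤ.* (+ 1 ℤ.+ (+ 1 ℤ.+ + 2 ℤ.* k)) ℤ.+ n ℤ.* (+ 1 ℤ.+ (+ 1 ℤ.+ + 2 ℤ.* k))) ≡
                       + 2 ℤ.* (ℤ.- k ℤ.* (ℤ.- + 1 ℤ.- n)) ℤ.+ ℤ.- (+ 1 ℤ.+ n) ℤ.* (+ 2 ℤ.* (+ 1 ℤ.+ + 2 ℤ.* k))
      index₂ = ℤ-solve

    -- Now the inverse of AB, which is χ_{l²}^(-(1 + n)/2), serves as base. Its power n - 1 is A^(1
    -- - n²), and this is A because l² divides n²; hence the index n - 1.
    Jc-AB-multiple : ∀ δ → + n ℤ.* + n ≡ (+ 1 ℤ.+ + 2 ℤ.* δ) ℤ.* (+ 1 ℤ.+ + 2 ℤ.* δ) ℤ.* H →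
                     Jc A (B n) ≈ jacobi (+ 2 ℤ.* ℤ.- (+ 1 ℤ.+ n½)) (+ 2 ℤ.* (ℤ.- (+ 1 ℤ.+ n½) ℤ.* (+ n ℤ.- + 1)))
    Jc-AB-multiple δ n²≡ = begin
      Jc A (B n)
        ≈⟨ Jc-reflection A (B n) (ℤ.- (A ℤ.+ B n)) (+ 0) (cancel A (B n) (+ e)) ⟩
      χ^ A F.-1# * Jc A (ℤ.- (A ℤ.+ B n))
        ≈⟨ trans (*-congʳ (χ^-multiple[-1] (+ 1) ≡.refl)) (*-identityˡ _) ⟩
      Jc A (ℤ.- (A ℤ.+ B n))
        ≈⟨ Jc-comm A (ℤ.- (A ℤ.+ B n)) ⟩
      Jc (ℤ.- (A ℤ.+ B n)) A
        ≈⟨ Jc-resp (+ 2 ℤ.* κ) (+ 2 ℤ.* (κ ℤ.* (+ n ℤ.- + 1))) κ τ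
             (index-shift (+ 2 ℤ.* κ) κ (by-parity (λ n → ℤ.- (+ 1 ℤ.* (+ 1 ℤ.+ H) ℤ.+ n ℤ.* (+ 1 ℤ.+ H)) ≡ + 2 ℤ.* κ ℤ.+ κ ℤ.* (+ 2 ℤ.* H)) (index₁ n½ H)))
             (index-shift (+ 2 ℤ.* (κ ℤ.* (+ n ℤ.- + 1))) τ second) ⟩
      Jc (+ 2 ℤ.* κ) (+ 2 ℤ.* (κ ℤ.* (+ n ℤ.- + 1)))
        ≈⟨ jacobi-even κ (+ 2 ℤ.* (κ ℤ.* (+ n ℤ.- + 1))) ⟨
      jacobi (+ 2 ℤ.* κ) (+ 2 ℤ.* (κ ℤ.* (+ n ℤ.- + 1))) ∎
      where
      κ τ : ℤ
      κ = ℤ.- (+ 1 ℤ.+ n½)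
      -- For d = 1 + 2δ this is (d² + 1)/2, the number of times that 2l² is contained in n² + l² =
      -- (d² + 1) l².
      τ = + 1 ℤ.+ + 2 ℤ.* δ ℤ.+ + 2 ℤ.* (δ ℤ.* δ)

      cancel : ∀ a b e → a ℤ.+ b ℤ.+ ℤ.- (a ℤ.+ b) ≡ + 0 ℤ.* e
      cancel = ℤ-solve
      index₁ : ∀ N H → ℤ.- (+ 1 ℤ.* (+ 1 ℤ.+ H) ℤ.+ (+ 1 ℤ.+ + 2 ℤ.* N) ℤ.* (+ 1 ℤ.+ H)) ≡ + 2 ℤ.* ℤ.- (+ 1 ℤ.+ N) ℤ.+ ℤ.- (+ 1 ℤ.+ N) ℤ.* (+ 2 ℤ.* H)
      index₁ = ℤ-solve
      index₂ : ∀ N H → + 1 ℤ.* (+ 1 ℤ.+ H) ≡ + 2 ℤ.* (ℤ.- (+ 1 ℤ.+ N) ℤ.* (+ 1 ℤ.+ + 2 ℤ.* N ℤ.- + 1)) ℤ.+ ((+ 1 ℤ.+ + 2 ℤ.* N) ℤ.* (+ 1 ℤ.+ + 2 ℤ.* N) ℤ.+ H)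
      index₂ = ℤ-solve
      index₃ : ∀ δ H → (+ 1 ℤ.+ + 2 ℤ.* δ) ℤ.* (+ 1 ℤ.+ + 2 ℤ.* δ) ℤ.* H ℤ.+ H ≡ (+ 1 ℤ.+ + 2 ℤ.* δ ℤ.+ + 2 ℤ.* (δ ℤ.* δ)) ℤ.* (+ 2 ℤ.* H)
      index₃ = ℤ-solve

      second : A ≡ + 2 ℤ.* (κ ℤ.* (+ n ℤ.- + 1)) ℤ.+ τ ℤ.* (+ 2 ℤ.* H)
      second = ≡.trans (by-parity (λ n → + 1 ℤ.* (+ 1 ℤ.+ H) ≡ + 2 ℤ.* (κ ℤ.* (n ℤ.- + 1)) ℤ.+ (n ℤ.* n ℤ.+ H)) (index₂ n½ H))
        (≡.cong (ℤ._+_ (+ 2 ℤ.* (κ ℤ.* (+ n ℤ.- + 1)))) (≡.trans (≡.cong (ℤ._+ H) n²≡) (index₃ δ H)))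

  [l²-1]/2≡k : (+ h ℤ.- + 1) /ℕ 2 ≡ k
  [l²-1]/2≡k = exact-/ℕ (H ℤ.- + 1) k (≡.trans (≡.cong (ℤ._- + 1) H≡1+2k) (cancel k))
    where
    cancel : ∀ k → + 1 ℤ.+ + 2 ℤ.* k ℤ.- + 1 ≡ + 2 ℤ.* k
    cancel = ℤ-solve

  [1-l²]/2≡-k : (+ 1 ℤ.- + h) /ℕ 2 ≡ ℤ.- k
  [1-l²]/2≡-k = exact-/ℕ (+ 1 ℤ.- H) (ℤ.- k) (≡.trans (≡.cong (λ x → + 1 ℤ.- x) H≡1+2k) (cancel k))
    where
    cancel : ∀ k → + 1 ℤ.- (+ 1 ℤ.+ + 2 ℤ.* k) ≡ + 2 ℤ.* ℤ.- k
    cancel = ℤ-solve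

  [-1-n]/2≡ : ∀ {n} → ¬ 2 ∣ n → (ℤ.- + 1 ℤ.- + n) /ℕ 2 ≡ ℤ.- (+ 1 ℤ.+ + (n ℕ./ 2))
  [-1-n]/2≡ {n} 2∤n = exact-/ℕ (ℤ.- + 1 ℤ.- + n) (ℤ.- (+ 1 ℤ.+ + (n ℕ./ 2)))
    (≡.trans (≡.cong (λ x → ℤ.- + 1 ℤ.- x) (odd-+ n 2∤n)) (halve (+ (n ℕ./ 2))))
    where
    halve : ∀ N → ℤ.- + 1 ℤ.- (+ 1 ℤ.+ + 2 ℤ.* N) ≡ + 2 ℤ.* ℤ.- (+ 1 ℤ.+ N)
    halve = ℤ-solve

  private
    l²∤coprime : ∀ {n} → gcd n e ≡ 1 → ¬ h ∣ n
    l²∤coprime gcd≡1 h∣n = h∤1 (≡.subst (h ∣_) gcd≡1 (gcd-greatest h∣n (ℕ∣.n∣m*n 2)))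

    -- l² ∣ dl means l ∣ d, and between 1 and 2l - 1 the only multiple of l is l itself.
    l²∤d*l : ∀ d → 1 ≤ d → d ≤ 2 ℕ.* l ℕ.∸ 1 → d ≢ l → ¬ h ∣ d ℕ.* l
    l²∤d*l d 1≤d d≤2l-1 d≢l h∣dl with ℕ∣.*-cancelʳ-∣ l (≡.subst (_∣ d ℕ.* l) l²≡l*l h∣dl)
    ... | ℕ∣.divides zero          d≡cl = contradiction 1≤d (ℕ.≤⇒≯ (ℕ.≤-reflexive d≡cl))
    ... | ℕ∣.divides (suc zero)    d≡cl = d≢l (≡.trans d≡cl (ℕ.*-identityˡ l))
    ... | ℕ∣.divides (suc (suc c)) d≡cl = contradiction (ℕ.≤-trans 2l≤d d≤2l-1)
          (ℕ.<⇒≱ (ℕ.∸-monoʳ-< (s≤s z≤n) (ℕ.≤-trans (ℕ.≤-trans (s≤s z≤n) 3≤l) (ℕ.m≤m+n l _))))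
      where
      2l≤d : 2 ℕ.* l ≤ d
      2l≤d = ℕ.≤-trans (ℕ.*-monoˡ-≤ l {2} {suc (suc c)} (s≤s (s≤s z≤n))) (ℕ.≤-reflexive (≡.sym d≡cl))

  -- `s` and `t` stand for the halves that the theorem writes with `/ℕ`; as variables they can be
  -- replaced by their exact values.
  jacobi-coprime : ∀ n → ¬ 2 ∣ n → gcd n e ≡ 1 → ∀ {s t} → s ≡ k → t ≡ ℤ.- k →
    jacobi (+ 1) (+ n) ≅ ζ[l²]^ (ℤ.- + (w ℕ.* (n ℕ.+ 1))) * P s ζ[l²] * P s (ζ[l²]^ (+ n)) * P (ℤ.- + 1 ℤ.- + n) (ζ[l²]^ t)
  jacobi-coprime n 2∤n gcd≡1 ≡.refl ≡.refl =
    jacobi[1,n]≅ n 2∤n h∤n (Jc-B̄B̄≅ n)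
      (congruent-trans (≈⇒congruent AB≈) (jacobi≅P (ℤ.- k) (ℤ.- + 1 ℤ.- + n)))
      (P∈ k (powMod∈ (+ n))) (resp (sym AB≈) (jacobi∈ (+ 2 ℤ.* ℤ.- k) (+ 2 ℤ.* (ℤ.- k ℤ.* (ℤ.- + 1 ℤ.- + n)))))
    where
    h∤n : ¬ h ∣ n
    h∤n = l²∤coprime gcd≡1
    AB≈ = Jc-AB-coprime n 2∤n h∤n

  -- The factor J(B̄, B̄) is -1 here by `Pd≅-1`, which gives the sign.
  jacobi-multiple : ∀ n → ¬ 2 ∣ n → ∀ d → ¬ 2 ∣ d → 1 ≤ d → d ≤ 2 ℕ.* l ℕ.∸ 1 → d ≢ l → n ≡ d ℕ.* l →
    ∀ {s t} → s ≡ k → t ≡ ℤ.- (+ 1 ℤ.+ + (n ℕ./ 2)) →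
    jacobi (+ 1) (+ n) ≅ - (ζ[l²]^ (ℤ.- + (w ℕ.* (d ℕ.* l ℕ.+ 1))) * P s ζ[l²] * P (+ (d ℕ.* l) ℤ.- + 1) (ζ[l²]^ t))
  jacobi-multiple n 2∤n d 2∤d 1≤d d≤2l-1 d≢l ≡.refl ≡.refl ≡.refl =
    congruent-trans
      (jacobi[1,n]≅ n 2∤n h∤n (congruent-trans (Jc-B̄B̄≅ n) (Pd≅-1 k d))
        (congruent-trans (≈⇒congruent AB≈) (jacobi≅P κ (+ n ℤ.- + 1)))
        (neg one) (resp (sym AB≈) (jacobi∈ (+ 2 ℤ.* κ) (+ 2 ℤ.* (κ ℤ.* (+ n ℤ.- + 1))))))
      (≈⇒congruent (solve 3 (λ x y w → x :* y :* :- con (+ 1) :* w := :- (x :* y :* w)) refl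
        (ζ[l²]^ (ℤ.- + (w ℕ.* (d ℕ.* l ℕ.+ 1)))) (P k ζ[l²]) (P (+ n ℤ.- + 1) (ζ[l²]^ κ))))
    where
    κ : ℤ
    κ = ℤ.- (+ 1 ℤ.+ + (n ℕ./ 2))

    h∤n : ¬ h ∣ n
    h∤n = l²∤d*l d 1≤d d≤2l-1 d≢l

    n²≡d²H : + n ℤ.* + n ≡ (+ 1 ℤ.+ + 2 ℤ.* + (d ℕ./ 2)) ℤ.* (+ 1 ℤ.+ + 2 ℤ.* + (d ℕ./ 2)) ℤ.* H
    n²≡d²H = ≡.trans (≡.cong (λ x → x ℤ.* x) (ℤ.pos-* d l)) (≡.trans (rearrange (+ d) (+ l))
      (≡.cong₂ (λ x y → x ℤ.* x ℤ.* y) (odd-+ d 2∤d) (≡.sym (≡.trans (≡.cong +_ l²≡l*l) (ℤ.pos-* l l)))))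
      where
      rearrange : ∀ d l → d ℤ.* l ℤ.* (d ℤ.* l) ≡ d ℤ.* d ℤ.* (l ℤ.* l)
      rearrange = ℤ-solve

    AB≈ = Jc-AB-multiple n 2∤n h∤n (+ (d ℕ./ 2)) n²≡d²H

  jacobi-l² : ∀ n → n ≡ h → ∀ {s} → s ≡ k → jacobi (+ 1) (+ n) ≅ ζ[l²]^ (ℤ.- + w) * P s ζ[l²]
  jacobi-l² n ≡.refl ≡.refl = jacobi[1,l²]≅

  jacobi-last : ∀ n → n ≡ e ℕ.∸ 1 → jacobi (+ 1) (+ n) ≅ - 1#
  jacobi-last n n≡e-1 = ≈⇒congruent (jacobi[1,2l²-1]≈-1 n
    (≡.trans (≡.cong suc n≡e-1) (ℕ.m+[n∸m]≡n (ℕ.≤-trans (ℕ.<⇒≤ 1<l²) (ℕ.m≤m+n h _)))))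

  module _ {n : ℕ} (n≤e-2 : n ≤ e ℕ.∸ 2) where

    private
      2≤e : 2 ≤ e
      2≤e = ℕ.≤-trans 1<l² (ℕ.m≤m+n h _)

      n+2≤e : n ℕ.+ 2 ≤ e
      n+2≤e = ℕ.≤-trans (ℕ.+-monoˡ-≤ 2 n≤e-2) (ℕ.≤-reflexive (ℕ.m∸n+n≡m 2≤e))

      1≤e-n : 1 ≤ e ℕ.∸ n
      1≤e-n = ℕ.m<n⇒0<n∸m (ℕ.≤-trans (ℕ.≤-reflexive (ℕ.+-comm 1 n)) (ℕ.≤-trans (ℕ.+-monoʳ-≤ n (s≤s z≤n)) n+2≤e))

    complement : suc (n ℕ.+ (e ℕ.∸ n ℕ.∸ 1)) ≡ e
    complement = ≡.trans (≡.sym (ℕ.+-suc n _)) (≡.trans (≡.cong (n ℕ.+_) (ℕ.m+[n∸m]≡n 1≤e-n))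
      (ℕ.m+[n∸m]≡n (ℕ.≤-trans (ℕ.m≤m+n n 2) n+2≤e)))

    -- Otherwise 2 would divide both the sum of n with its complement and that sum plus 1, which is
    -- 2l².
    complement-odd : 2 ∣ n → ¬ 2 ∣ e ℕ.∸ n ℕ.∸ 1
    complement-odd 2∣n 2∣n′ = contradiction
      (ℕ∣.∣⇒≤ (ℕ∣.∣m+n∣m⇒∣n (≡.subst (2 ∣_) (≡.sym (≡.trans (ℕ.+-comm _ 1) complement)) (ℕ∣.m∣m*n h)) (ℕ∣.∣m∣n⇒∣m+n 2∣n 2∣n′)))
      (ℕ.<⇒≱ {1} ℕ.≤-refl)

open import Data.Integer using (ℤ; +_; -_; _-_; _/ℕ_)
open import Data.Nat using (ℕ; NonZero; _+_; _*_; _^_; _∸_; _≤_; _<_)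

theorem5p1 :
  ∀ {a ℓ₁ ℓ₂ c ℓ₃ ℓ₄}
  (l : ℕ) .{{_ : NonZero l}} → 3 ≤ l → Prime l →
  (F : FiniteField a ℓ₁ ℓ₂) (p r : ℕ) →
  let module F = FiniteField F in
  Prime p → 1 ≤ r → F.order ≡ p ^ r → 2 * l ^ 2 ∣ F.order ∸ 1 →
  (γ : F.Carrier) → F.IsGenerator γ →
  (K : HeytingField c ℓ₃ ℓ₄) →
  let R = fieldRing K
      module K = CommutativeRing R
      open RingNotions R using (CharacteristicZero)
      open RingNotions R using (IsPrimitiveRoot)
      open Characters F R using (IsMultiplicativeCharacter)
  in
  CharacteristicZero →
  (ζ : K.Carrier) → IsPrimitiveRoot (2 * l ^ 2) ζ →
  (χ : F.Carrier → K.Carrier) → IsMultiplicativeCharacter χ → χ γ K.≈ ζ →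
  let open Setting l F γ R ζ χ
      w = F.ind γ (F.1# F.+ F.1#)
      h = (+ (l ^ 2) - + 1) /ℕ 2
  in
  (∀ n → 2 ∤ n → 1 ≤ n → n ≤ 2 * l ^ 2 ∸ 1 →
    (n ≡ l ^ 2 →
      J (+ 1) (+ n) ≅ ζ[l²]^ (- + w) K.* P h ζ[l²])
    ×
    (∀ d → 2 ∤ d → 1 ≤ d → d ≤ 2 * l ∸ 1 → d ≢ l → n ≡ d * l →
      J (+ 1) (+ n) ≅
        K.- (ζ[l²]^ (- + (w * (d * l + 1)))
          K.* P h ζ[l²]
          K.* P (+ (d * l) - + 1) (ζ[l²]^ ((- + 1 - + (d * l)) /ℕ 2))))
    ×
    (gcd n (2 * l ^ 2) ≡ 1 → n < 2 * l ^ 2 ∸ 1 →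
      J (+ 1) (+ n) ≅
        ζ[l²]^ (- + (w * (n + 1)))
          K.* P h ζ[l²]
          K.* P h (ζ[l²]^ (+ n))
          K.* P (- + 1 - + n) (ζ[l²]^ ((+ 1 - + (l ^ 2)) /ℕ 2)))
    ×
    (n ≡ 2 * l ^ 2 ∸ 1 →
      J (+ 1) (+ n) ≅ K.- K.1#))
  ×
  (∀ n → 2 ∣ n → 2 ≤ n → n ≤ 2 * l ^ 2 ∸ 2 →
    (2 ∤ 2 * l ^ 2 ∸ n ∸ 1)
    ×
    (J (+ 1) (+ n) K.≈ χ (F.- F.1#) K.* J (+ 1) (+ (2 * l ^ 2 ∸ n ∸ 1))))
theorem5p1 l 3≤l l-prime F p r _ _ _ 2l²∣order-1 γ generates K _ ζ ζ-primitive χ χ-character χγ≈ζ =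
    (λ n 2∤n _ _ →
        (λ n≡l² → jacobi-l² n n≡l² [l²-1]/2≡k)
      , (λ d 2∤d 1≤d d≤2l-1 d≢l n≡dl → jacobi-multiple n 2∤n d 2∤d 1≤d d≤2l-1 d≢l n≡dl [l²-1]/2≡k
           (≡.trans (≡.cong (λ m → (- + 1 - + m) /ℕ 2) (≡.sym n≡dl)) ([-1-n]/2≡ 2∤n)))
      , (λ gcd≡1 _ → jacobi-coprime n 2∤n gcd≡1 [l²-1]/2≡k [1-l²]/2≡-k)
      , jacobi-last n)
  , (λ n 2∣n _ n≤2l²-2 → complement-odd n≤2l²-2 2∣n , jacobi-even-reflection n _ (complement n≤2l²-2))
  where open Congruences l 3≤l l-prime F 2l²∣order-1 generates K ζ-primitive χ-character χγ≈ζ
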